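{- For every integer $r\geq 10$, the Vietoris--Rips complex $\mathrm{VR}(\mathbb{Z}^6;r)$ is contractible.
   Context: $\mathbb{Z}^6$ is equipped with the Manhattan metric $d(x,y)=\sum_{i=1}^6 |x_i-y_i|$. For a metric space $X$ and $r\geq 0$, $\mathrm{VR}(X;r)$ is the simplicial complex with vertex set $X$ whose simplices are the finite subsets of $X$ of diameter at most $r$. -}

module Defs where

open import Data.Nat.Base as ℕ using (ℕ; zero; suc)
import Data.Nat.Properties as ℕ
open import Data.Integer.Base as ℤ using (ℤ; +_; -[1+_]; +[1+_]; +0)
import Data.Integer.Properties as ℤ
import Data.Integer.Solver as ℤSolver
open import Data.Rational.Base as ℚ using (ℚ; mkℚ; 0ℚ; 1ℚ; _/_; *≤*; *<*)
import Data.Rational.Properties as ℚ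
import Data.Rational.Solver as ℚSolver
open import Data.Rational.Unnormalised.Base as ℚᵘ using (ℚᵘ; mkℚᵘ; *≡*)
import Data.Rational.Unnormalised.Properties as ℚᵘ
open import Data.Empty using (⊥-elim)
open import Data.List.Base using (List; []; _∷_; foldr)
open import Data.List.Membership.Propositional using (_∈_; _∉_)
open import Data.List.Relation.Binary.Subset.Propositional using (_⊆_)
open import Data.List.Relation.Unary.Any using (here)
open import Data.List.Relation.Unary.Unique.Propositional using (Unique)
open import Data.Product.Base using (∃; ∃-syntax; Σ-syntax; _×_; _,_; proj₁; proj₂)
open import Data.Product.Relation.Binary.Pointwise.NonDependent using (×-setoid)
open import Data.Sum.Base using (inj₁; inj₂)
open import Data.Unit.Base using (tt)
open import Data.Vec.Base using (Vec; []; _∷_; zipWith; sum)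
open import Function.Base using (_∘_)
open import Function.Bundles using (Func)
open import Function.Metric.Nat.Structures using (IsMetric)
open import Level using (0ℓ)
open import Relation.Binary.Bundles using (Setoid)
open import Relation.Binary.Definitions using (_Respects_)
open import Relation.Binary.PropositionalEquality using (_≡_; refl; sym; trans; cong; cong₂; subst; isEquivalence)
open import Relation.Nullary.Decidable.Core using (yes; no)
open import Relation.Unary using (Pred; U; _∩_; ⋃)

inv : ℕ → ℚ
inv n = + 1 / suc n

private
  inv-toℚᵘ : ∀ n → ℚ.toℚᵘ (inv n) ℚᵘ.≃ mkℚᵘ (+ 1) n
  inv-toℚᵘ n = ℚ.toℚᵘ-fromℚᵘ (mkℚᵘ (+ 1) n)

0<inv : ∀ n → 0ℚ ℚ.< inv n
0<inv n = ℚ.positive⁻¹ (inv n) {{ℚ.normalize-pos 1 (suc n)}}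

double : ℕ → ℕ
double n = suc (n ℕ.+ n)

inv-double : ∀ n → inv (double n) ℚ.+ inv (double n) ≡ inv n
inv-double n = ℚ.toℚᵘ-injective (begin
  ℚ.toℚᵘ (i ℚ.+ i)           ≈⟨ ℚ.toℚᵘ-homo-+ i i ⟩
  ℚ.toℚᵘ i ℚᵘ.+ ℚ.toℚᵘ i     ≈⟨ ℚᵘ.+-cong (inv-toℚᵘ (double n)) (inv-toℚᵘ (double n)) ⟩
  u ℚᵘ.+ u                   ≈⟨ *≡* (lemma (+ n)) ⟩
  mkℚᵘ (+ 1) n               ≈⟨ inv-toℚᵘ n ⟨
  ℚ.toℚᵘ (inv n)             ∎)
  where
  open import Relation.Binary.Reasoning.Setoid ℚᵘ.≃-setoid
  open ℤSolver.+-*-Solver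
  i = inv (double n)
  u = mkℚᵘ (+ 1) (double n)
  lemma : ∀ k → let m = + 1 ℤ.+ (+ 1 ℤ.+ (k ℤ.+ k)) in
          (+ 1 ℤ.* m ℤ.+ + 1 ℤ.* m) ℤ.* (+ 1 ℤ.+ k) ≡ + 1 ℤ.* (m ℤ.* m)
  lemma = solve 1 (λ k → let m = con (+ 1) :+ (con (+ 1) :+ (k :+ k)) in
    (con (+ 1) :* m :+ con (+ 1) :* m) :* (con (+ 1) :+ k) := con (+ 1) :* (m :* m)) refl

archimedean : ∀ {ε} → 0ℚ ℚ.< ε → ∃[ k ] inv k ℚ.< ε
archimedean {mkℚ +[1+ a ] d c} _ = suc d , ℚ.toℚᵘ-cancel-<
  (ℚᵘ.<-respˡ-≃ (ℚᵘ.≃-sym (inv-toℚᵘ (suc d))) (ℚᵘ.*<* (ℤ.+<+ lemma)))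
  where
  lemma : suc (d ℕ.+ 0) ℕ.< suc a ℕ.* suc (suc d)
  lemma = ℕ.≤-trans (ℕ.s≤s (ℕ.s≤s (ℕ.≤-reflexive (ℕ.+-identityʳ d)))) (ℕ.m≤m+n (suc (suc d)) _)
archimedean {mkℚ +0 d c} (*<* (ℤ.+<+ ()))
archimedean {mkℚ -[1+ a ] d c} (*<* ())

p≤∣p∣ : ∀ p → p ℚ.≤ ℚ.∣ p ∣
p≤∣p∣ (mkℚ (+ n) d c)    = ℚ.≤-refl
p≤∣p∣ (mkℚ -[1+ n ] d c) = *≤* ℤ.-≤+

private
  module ℚS = ℚSolver.+-*-Solver

  -+cancel : ∀ p q → p ≡ q ℚ.+ (p ℚ.- q)
  -+cancel = solve 2 (λ p q → p := q :+ (p :- q)) refl where open ℚS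

  swap-neg : ∀ p q → ℚ.- (p ℚ.- q) ≡ q ℚ.- p
  swap-neg = solve 2 (λ p q → :- (p :- q) := q :- p) refl where open ℚS

  +-cancel : ∀ q e → (q ℚ.+ e) ℚ.- q ≡ e
  +-cancel = solve 2 (λ q e → (q :+ e) :- q := e) refl where open ℚS

  interchange : ∀ a b c d → (a ℚ.+ b) ℚ.+ (c ℚ.+ d) ≡ (a ℚ.+ c) ℚ.+ (b ℚ.+ d)
  interchange = solve 4 (λ a b c d → (a :+ b) :+ (c :+ d) := (a :+ c) :+ (b :+ d)) refl where open ℚS

∣p-q∣≤e⇒p≤q+e : ∀ {p q e} → ℚ.∣ p ℚ.- q ∣ ℚ.≤ e → p ℚ.≤ q ℚ.+ e
∣p-q∣≤e⇒p≤q+e {p} {q} h = ℚ.≤-trans (ℚ.≤-reflexive (-+cancel p q))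
  (ℚ.+-monoʳ-≤ q (ℚ.≤-trans (p≤∣p∣ (p ℚ.- q)) h))

∣p-q∣-sym : ∀ p q → ℚ.∣ p ℚ.- q ∣ ≡ ℚ.∣ q ℚ.- p ∣
∣p-q∣-sym p q = trans (sym (ℚ.∣-p∣≡∣p∣ (p ℚ.- q))) (cong ℚ.∣_∣ (swap-neg p q))

p≤q+e⇒p-q≤e : ∀ {p q e} → p ℚ.≤ q ℚ.+ e → p ℚ.- q ℚ.≤ e
p≤q+e⇒p-q≤e {p} {q} {e} h =
  ℚ.≤-trans (ℚ.+-monoˡ-≤ (ℚ.- q) h) (ℚ.≤-reflexive (+-cancel q e))

p≤q+e∧q≤p+e⇒∣p-q∣≤e : ∀ {p q e} → p ℚ.≤ q ℚ.+ e → q ℚ.≤ p ℚ.+ e → ℚ.∣ p ℚ.- q ∣ ℚ.≤ e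
p≤q+e∧q≤p+e⇒∣p-q∣≤e {p} {q} h k with ℚ.∣p∣≡p∨∣p∣≡-p (p ℚ.- q)
... | inj₁ eq = ℚ.≤-trans (ℚ.≤-reflexive eq) (p≤q+e⇒p-q≤e h)
... | inj₂ eq = ℚ.≤-trans (ℚ.≤-reflexive (trans eq (swap-neg p q))) (p≤q+e⇒p-q≤e k)

∣∣p∣-∣q∣∣≤∣p-q∣ : ∀ p q → ℚ.∣ ℚ.∣ p ∣ ℚ.- ℚ.∣ q ∣ ∣ ℚ.≤ ℚ.∣ p ℚ.- q ∣
∣∣p∣-∣q∣∣≤∣p-q∣ p q = p≤q+e∧q≤p+e⇒∣p-q∣≤e (half p q)
  (subst (λ e → ℚ.∣ q ∣ ℚ.≤ ℚ.∣ p ∣ ℚ.+ e) (∣p-q∣-sym q p) (half q p))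
  where
  half : ∀ a b → ℚ.∣ a ∣ ℚ.≤ ℚ.∣ b ∣ ℚ.+ ℚ.∣ a ℚ.- b ∣
  half a b = ℚ.≤-trans (ℚ.≤-reflexive (cong ℚ.∣_∣ (-+cancel a b))) (ℚ.∣p+q∣≤∣p∣+∣q∣ b (a ℚ.- b))

p≤q+2inv⇒p≤q : ∀ {p q} → (∀ k → p ℚ.≤ q ℚ.+ (inv k ℚ.+ inv k)) → p ℚ.≤ q
p≤q+2inv⇒p≤q {p} {q} h with p ℚ.≤? q
... | yes p≤q = p≤q
... | no  p≰q with archimedean {p ℚ.- q}
                   (subst (ℚ._< p ℚ.- q) (ℚ.+-inverseʳ q) (ℚ.+-monoˡ-< (ℚ.- q) (ℚ.≰⇒> p≰q)))
...   | k , inv<p-q = ⊥-elim (ℚ.<-irrefl refl (ℚ.<-≤-trans inv<p-q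
          (p≤q+e⇒p-q≤e (subst (λ e → p ℚ.≤ q ℚ.+ e) (inv-double k) (h (double k))))))

-- Real numbers, as Bishop's regular Cauchy sequences of rationals; the
-- n-th term is within 1/(n+1) of the number represented.

record ℝ : Set where
  field
    seq     : ℕ → ℚ
    regular : ∀ m n → ℚ.∣ seq m ℚ.- seq n ∣ ℚ.≤ inv m ℚ.+ inv n

open ℝ public

infix 4 _<_ _≤_ _≈_
infixl 6 _+_ _-_
infix 8 -_

_<_ : ℝ → ℝ → Set
x < y = ∃[ m ] ∃[ n ] seq x m ℚ.+ (inv m ℚ.+ inv n) ℚ.< seq y n

_≤_ : ℝ → ℝ → Set
x ≤ y = ∀ m n → seq x m ℚ.≤ seq y n ℚ.+ (inv m ℚ.+ inv n)

_≈_ : ℝ → ℝ → Set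
x ≈ y = x ≤ y × y ≤ x

fromℚ : ℚ → ℝ
fromℚ q .seq _ = q
fromℚ q .regular m n = ℚ.≤-trans
  (ℚ.≤-reflexive (cong ℚ.∣_∣ (ℚ.+-inverseʳ q)))
  (ℚ.+-mono-≤ (ℚ.<⇒≤ (0<inv m)) (ℚ.<⇒≤ (0<inv n)))

0ℝ 1ℝ : ℝ
0ℝ = fromℚ 0ℚ
1ℝ = fromℚ 1ℚ

≤-refl : ∀ {x} → x ≤ x
≤-refl {x} m n = ∣p-q∣≤e⇒p≤q+e (regular x m n)

≤-trans : ∀ {x y z} → x ≤ y → y ≤ z → x ≤ z
≤-trans {x} {y} {z} x≤y y≤z m n = p≤q+2inv⇒p≤q λ k →
  ℚ.≤-trans (x≤y m k) (ℚ.≤-trans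
    (ℚ.+-monoˡ-≤ (inv m ℚ.+ inv k) (y≤z k n))
    (ℚ.≤-reflexive (lemma (seq z n) (inv k) (inv n) (inv m))))
  where
  lemma : ∀ z k n m → z ℚ.+ (k ℚ.+ n) ℚ.+ (m ℚ.+ k) ≡ z ℚ.+ (m ℚ.+ n) ℚ.+ (k ℚ.+ k)
  lemma = solve 4 (λ z k n m → z :+ (k :+ n) :+ (m :+ k) := z :+ (m :+ n) :+ (k :+ k)) refl where open ℚS

≈-refl : ∀ {x} → x ≈ x
≈-refl {x} = ≤-refl {x} , ≤-refl {x}

≈-sym : ∀ {x y} → x ≈ y → y ≈ x
≈-sym (p , q) = q , p

≈-trans : ∀ {x y z} → x ≈ y → y ≈ z → x ≈ z
≈-trans {x} {y} {z} (p , q) (p′ , q′) = ≤-trans {x} {y} {z} p p′ , ≤-trans {z} {y} {x} q′ q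

_+_ : ℝ → ℝ → ℝ
(x + y) .seq n = seq x (double n) ℚ.+ seq y (double n)
(x + y) .regular m n = begin
  ℚ.∣ (a ℚ.+ b) ℚ.- (c ℚ.+ d) ∣            ≡⟨ cong ℚ.∣_∣ (rearrange a b c d) ⟩
  ℚ.∣ (a ℚ.- c) ℚ.+ (b ℚ.- d) ∣            ≤⟨ ℚ.∣p+q∣≤∣p∣+∣q∣ (a ℚ.- c) (b ℚ.- d) ⟩
  ℚ.∣ a ℚ.- c ∣ ℚ.+ ℚ.∣ b ℚ.- d ∣          ≤⟨ ℚ.+-mono-≤ (regular x m′ n′) (regular y m′ n′) ⟩
  (inv m′ ℚ.+ inv n′) ℚ.+ (inv m′ ℚ.+ inv n′) ≡⟨ interchange (inv m′) (inv n′) (inv m′) (inv n′) ⟩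
  (inv m′ ℚ.+ inv m′) ℚ.+ (inv n′ ℚ.+ inv n′) ≡⟨ cong₂ ℚ._+_ (inv-double m) (inv-double n) ⟩
  inv m ℚ.+ inv n                          ∎
  where
  open ℚ.≤-Reasoning
  m′ = double m
  n′ = double n
  a = seq x m′
  b = seq y m′
  c = seq x n′
  d = seq y n′
  rearrange : ∀ a b c d → (a ℚ.+ b) ℚ.- (c ℚ.+ d) ≡ (a ℚ.- c) ℚ.+ (b ℚ.- d)
  rearrange = solve 4 (λ a b c d → (a :+ b) :- (c :+ d) := (a :- c) :+ (b :- d)) refl where open ℚS

-_ : ℝ → ℝ
(- x) .seq n = ℚ.- seq x n
(- x) .regular m n = ℚ.≤-trans
  (ℚ.≤-reflexive (trans (cong ℚ.∣_∣ (lemma (seq x m) (seq x n))) (∣p-q∣-sym (seq x n) (seq x m))))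
  (regular x m n)
  where
  lemma : ∀ p q → ℚ.- p ℚ.- (ℚ.- q) ≡ q ℚ.- p
  lemma = solve 2 (λ p q → :- p :- (:- q) := q :- p) refl where open ℚS

_-_ : ℝ → ℝ → ℝ
x - y = x + (- y)

∣_∣ : ℝ → ℝ
∣ x ∣ .seq n = ℚ.∣ seq x n ∣
∣ x ∣ .regular m n = ℚ.≤-trans (∣∣p∣-∣q∣∣≤∣p-q∣ (seq x m) (seq x n)) (regular x m n)

≈⇒∣x-y∣<ε : ∀ {x y ε} → x ≈ y → 0ℚ ℚ.< ε → ∣ x - y ∣ < fromℚ ε
≈⇒∣x-y∣<ε {x} {y} {ε} (x≤y , y≤x) 0<ε = k , k , (begin-strict
  ℚ.∣ seq x k′ ℚ.- seq y k′ ∣ ℚ.+ (inv k ℚ.+ inv k)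
    ≤⟨ ℚ.+-monoˡ-≤ _ (p≤q+e∧q≤p+e⇒∣p-q∣≤e (x≤y k′ k′) (y≤x k′ k′)) ⟩
  (inv k′ ℚ.+ inv k′) ℚ.+ (inv k ℚ.+ inv k)
    ≡⟨ cong₂ ℚ._+_ (inv-double k) (inv-double j) ⟩
  inv k ℚ.+ inv j
    ≤⟨ ℚ.+-monoˡ-≤ (inv j) inv-k≤inv-j ⟩
  inv j ℚ.+ inv j
    ≡⟨ inv-double (proj₁ arch) ⟩
  inv (proj₁ arch)
    <⟨ proj₂ arch ⟩
  ε ∎)
  where
  open ℚ.≤-Reasoning
  arch = archimedean 0<ε
  j  = double (proj₁ arch)
  k  = double j
  k′ = double k
  inv-k≤inv-j : inv k ℚ.≤ inv j
  inv-k≤inv-j = ℚ.≤-trans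
    (ℚ.≤-trans (ℚ.≤-reflexive (sym (ℚ.+-identityʳ (inv k)))) (ℚ.+-monoʳ-≤ (inv k) (ℚ.<⇒≤ (0<inv k))))
    (ℚ.≤-reflexive (inv-double j))

<fromℚ-mono : ∀ {x ε δ} → ε ℚ.≤ δ → x < fromℚ ε → x < fromℚ δ
<fromℚ-mono ε≤δ (m , n , x<ε) = m , n , ℚ.<-≤-trans x<ε ε≤δ

0<⊓ : ∀ {ε δ} → 0ℚ ℚ.< ε → 0ℚ ℚ.< δ → 0ℚ ℚ.< ε ℚ.⊓ δ
0<⊓ {ε} {δ} 0<ε 0<δ with ℚ.⊓-sel ε δ
... | inj₁ eq = subst (0ℚ ℚ.<_) (sym eq) 0<ε
... | inj₂ eq = subst (0ℚ ℚ.<_) (sym eq) 0<δ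

-- The points form a setoid, standing for its quotient set.

record Space : Set₂ where
  field
    setoid : Setoid 0ℓ 0ℓ

  open Setoid setoid public using (Carrier) renaming (_≈_ to _≋_)

  field
    Open      : Pred Carrier 0ℓ → Set₁
    open-resp : ∀ {A} → Open A → A Respects _≋_
    open-U    : Open U
    open-∩    : ∀ {A B} → Open A → Open B → Open (A ∩ B)
    open-⋃    : ∀ {I : Set} (A : I → Pred Carrier 0ℓ) → (∀ i → Open (A i)) → Open (⋃ I A)

record ContinuousMap (X Y : Space) : Set₁ where
  private
    module X = Space X
    module Y = Space Y
  field
    func : Func X.setoid Y.setoid

  open Func func public using (to; cong)

  field
    continuous : ∀ {A} → Y.Open A → X.Open (A ∘ to)

infixr 2 _×ₛ_

_×ₛ_ : Space → Space → Space
X ×ₛ Y = record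
  { setoid    = ×-setoid X.setoid Y.setoid
  ; Open      = IsOpen
  ; open-resp = λ W-open (x≋ , y≋) w → let (A , B , A-open , B-open , a , b , AB⊆W) = W-open w in
                  AB⊆W (X.open-resp A-open x≋ a) (Y.open-resp B-open y≋ b)
  ; open-U    = λ _ → U , U , X.open-U , Y.open-U , tt , tt , λ _ _ → tt
  ; open-∩    = λ V-open W-open (v , w) →
                  let (A , B , A-open , B-open , a , b , AB⊆V) = V-open v
                      (C , D , C-open , D-open , c , d , CD⊆W) = W-open w in
                  A ∩ C , B ∩ D , X.open-∩ A-open C-open , Y.open-∩ B-open D-open , (a , c) , (b , d) ,
                  λ (a′ , c′) (b′ , d′) → AB⊆V a′ b′ , CD⊆W c′ d′
  ; open-⋃    = λ W W-open (i , w) →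
                  let (A , B , A-open , B-open , a , b , AB⊆W) = W-open i w in
                  A , B , A-open , B-open , a , b , λ a′ b′ → i , AB⊆W a′ b′
  }
  where
  module X = Space X
  module Y = Space Y
  IsOpen : Pred (X.Carrier × Y.Carrier) 0ℓ → Set₁
  IsOpen W = ∀ {x y} → W (x , y) →
    Σ[ A ∈ Pred X.Carrier 0ℓ ] Σ[ B ∈ Pred Y.Carrier 0ℓ ]
      X.Open A × Y.Open B × A x × B y × (∀ {x′ y′} → A x′ → B y′ → W (x′ , y′))

record UnitInterval : Set where
  field
    value       : ℝ
    nonNegative : 0ℝ ≤ value
    atMostOne   : value ≤ 1ℝ

open UnitInterval public using (value)

i0 i1 : UnitInterval
i0 = record { value = 0ℝ ; nonNegative = ≤-refl {0ℝ} ; atMostOne = 0≤1 }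
  where
  0≤1 : 0ℝ ≤ 1ℝ
  0≤1 m n = ℚ.+-mono-≤ {0ℚ} {1ℚ} (*≤* (ℤ.+≤+ ℕ.z≤n)) (ℚ.+-mono-≤ (ℚ.<⇒≤ (0<inv m)) (ℚ.<⇒≤ (0<inv n)))
i1 = record { value = 1ℝ ; nonNegative = i0 .UnitInterval.atMostOne ; atMostOne = ≤-refl {1ℝ} }

𝕀 : Space
𝕀 = record
  { setoid    = record
    { Carrier       = UnitInterval
    ; _≈_           = λ s t → value s ≈ value t
    ; isEquivalence = record
      { refl  = λ {s} → ≈-refl {value s}
      ; sym   = λ {s} {t} → ≈-sym {value s} {value t}
      ; trans = λ {s} {t} {u} → ≈-trans {value s} {value t} {value u}
      }
    }
  ; Open      = λ A → Level.Lift _ (IsOpen A)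
  ; open-resp = λ {A} (Level.lift A-open) {s} {t} s≈t a → let (ε , 0<ε , ball) = A-open s a in
                  ball t (≈⇒∣x-y∣<ε {value s} {value t} s≈t 0<ε)
  ; open-U    = Level.lift λ _ _ → 1ℚ , ℚ.positive⁻¹ 1ℚ , λ _ _ → tt
  ; open-∩    = λ (Level.lift A-open) (Level.lift B-open) → Level.lift λ s (a , b) →
                  let (ε , 0<ε , ballA) = A-open s a
                      (δ , 0<δ , ballB) = B-open s b in
                  ε ℚ.⊓ δ , 0<⊓ 0<ε 0<δ , λ t s~t →
                    ballA t (<fromℚ-mono {∣ value s - value t ∣} (ℚ.p⊓q≤p ε δ) s~t) ,
                    ballB t (<fromℚ-mono {∣ value s - value t ∣} (ℚ.p⊓q≤q ε δ) s~t)
  ; open-⋃    = λ A A-open → Level.lift λ s (i , a) →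
                  let (ε , 0<ε , ball) = Level.lower (A-open i) s a in
                  ε , 0<ε , λ t s~t → i , ball t s~t
  }
  where
  IsOpen : Pred UnitInterval 0ℓ → Set
  IsOpen A = ∀ s → A s → ∃[ ε ] 0ℚ ℚ.< ε × (∀ t → ∣ value s - value t ∣ < fromℚ ε → A t)

-- The identity map is homotopic to a constant map.
record Contractible (X : Space) : Set₁ where
  open Space X
  field
    basepoint  : Carrier
    homotopy   : ContinuousMap (X ×ₛ 𝕀) X

  open ContinuousMap homotopy using (to)

  field
    starts-at-identity : ∀ x → to (x , i0) ≋ x
    ends-at-basepoint  : ∀ x → to (x , i1) ≋ basepoint

-- A finite set of vertices is given by a list enumerating it; `face`
-- makes `Simplex` depend on the underlying set only. The empty set counts
-- as a simplex, but contributes no point to the realization.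
record SimplicialComplex : Set₁ where
  field
    Vertex    : Set
    Simplex   : Pred (List Vertex) 0ℓ
    singleton : ∀ v → Simplex (v ∷ [])
    face      : ∀ {σ τ} → σ ⊆ τ → Simplex τ → Simplex σ

module _ (K : SimplicialComplex) where
  open SimplicialComplex K

  VanishesOff : List Vertex → (Vertex → ℝ) → Set
  VanishesOff σ x = ∀ {v} → v ∉ σ → x v ≈ 0ℝ

  -- Barycentric coordinates, supported in some simplex.
  record Point : Set where
    field
      coord       : Vertex → ℝ
      nonNegative : ∀ v → 0ℝ ≤ coord v
      carrier     : List Vertex
      isSimplex   : Simplex carrier
      unique      : Unique carrier
      supported   : VanishesOff carrier coord
      total       : foldr (λ v s → coord v + s) 0ℝ carrier ≈ 1ℝ

  open Point

  -- The closed simplex |σ|, as a subset of the realization.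
  Cell : List Vertex → Pred Point 0ℓ
  Cell σ x = VanishesOff σ (coord x)

  OpenInCell : List Vertex → Pred Point 0ℓ → Set
  OpenInCell σ A = ∀ x → Cell σ x → A x →
    ∃[ ε ] 0ℚ ℚ.< ε ×
      (∀ y → Cell σ y → (∀ {v} → v ∈ σ → ∣ coord x v - coord y v ∣ < fromℚ ε) → A y)

  -- Topologized with the weak (coherent) topology: A is open iff A ∩ |σ| is
  -- open in |σ| for every simplex σ. The coordinates off σ vanish on |σ|, so
  -- the sup-distance over σ induces the Euclidean topology there.
  realization : Space
  realization = record
    { setoid    = record
      { Carrier       = Point
      ; _≈_           = λ x y → ∀ v → coord x v ≈ coord y v
      ; isEquivalence = record
        { refl  = λ {x} v → ≈-refl {coord x v}
        ; sym   = λ {x} {y} x≋y v → ≈-sym {coord x v} {coord y v} (x≋y v)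
        ; trans = λ {x} {y} {z} x≋y y≋z v → ≈-trans {coord x v} {coord y v} {coord z v} (x≋y v) (y≋z v)
        }
      }
    ; Open      = λ A → Level.Lift _ (∀ σ → Simplex σ → OpenInCell σ A)
    ; open-resp = λ (Level.lift A-open) {x} {y} x≋y a →
                    let (ε , 0<ε , ball) = A-open (carrier x) (isSimplex x) x (supported x) a in
                    ball y
                      (λ {v} v∉ → ≈-trans {coord y v} {coord x v} {0ℝ}
                                    (≈-sym {coord x v} {coord y v} (x≋y v)) (supported x v∉))
                      (λ {v} _ → ≈⇒∣x-y∣<ε {coord x v} {coord y v} (x≋y v) 0<ε)
    ; open-U    = Level.lift λ _ _ _ _ _ → 1ℚ , ℚ.positive⁻¹ 1ℚ , λ _ _ _ → tt
    ; open-∩    = λ (Level.lift A-open) (Level.lift B-open) → Level.lift λ σ s x x∈σ (a , b) →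
                    let (ε , 0<ε , ballA) = A-open σ s x x∈σ a
                        (δ , 0<δ , ballB) = B-open σ s x x∈σ b in
                    ε ℚ.⊓ δ , 0<⊓ 0<ε 0<δ , λ y y∈σ x~y →
                      ballA y y∈σ (λ {v} v∈σ →
                        <fromℚ-mono {∣ coord x v - coord y v ∣} (ℚ.p⊓q≤p ε δ) (x~y v∈σ)) ,
                      ballB y y∈σ (λ {v} v∈σ →
                        <fromℚ-mono {∣ coord x v - coord y v ∣} (ℚ.p⊓q≤q ε δ) (x~y v∈σ))
    ; open-⋃    = λ A A-open → Level.lift λ σ s x x∈σ (i , a) →
                    let (ε , 0<ε , ball) = Level.lower (A-open i) σ s x x∈σ a in
                    ε , 0<ε , λ y y∈σ x~y → i , ball y y∈σ x~y
    }

-- Diameter at most r, for a finite set: all pairwise distances are at most r.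
VR : ∀ {X : Set} {d : X → X → ℕ} → IsMetric _≡_ d → ℕ → SimplicialComplex
VR {X} {d} isMetric r = record
  { Vertex    = X
  ; Simplex   = λ σ → ∀ {x y} → x ∈ σ → y ∈ σ → d x y ℕ.≤ r
  ; singleton = λ { v (here refl) (here refl) →
                    ℕ.≤-trans (ℕ.≤-reflexive (IsMetric.≈⇒0 isMetric refl)) ℕ.z≤n }
  ; face      = λ σ⊆τ diam≤r x∈σ y∈σ → diam≤r (σ⊆τ x∈σ) (σ⊆τ y∈σ)
  }

manhattan : ∀ {n} → Vec ℤ n → Vec ℤ n → ℕ
manhattan x y = sum (zipWith (λ a b → ℤ.∣ a ℤ.- b ∣) x y)

manhattan-isMetric : ∀ n → IsMetric _≡_ (manhattan {n})
manhattan-isMetric n = record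
  { isSemiMetric = record
    { isQuasiSemiMetric = record
      { isPreMetric = record
        { isProtoMetric = record
          { isPartialOrder  = ℕ.≤-isPartialOrder
          ; ≈-isEquivalence = isEquivalence
          ; cong            = cong₂ manhattan
          ; nonNegative     = ℕ.z≤n
          }
        ; ≈⇒0 = λ { {x} refl → self x }
        }
      ; 0⇒≈ = λ {x} {y} → indiscernible x y
      }
    ; sym = symmetric
    }
  ; triangle = triangle
  }
  where
  self : ∀ {n} (x : Vec ℤ n) → manhattan x x ≡ 0
  self []      = refl
  self (a ∷ x) = cong₂ ℕ._+_ (cong ℤ.∣_∣ (ℤ.+-inverseʳ a)) (self x)

  indiscernible : ∀ {n} (x y : Vec ℤ n) → manhattan x y ≡ 0 → x ≡ y
  indiscernible []      []      _ = refl
  indiscernible (a ∷ x) (b ∷ y) h = cong₂ _∷_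
    (ℤ.i-j≡0⇒i≡j a b (ℤ.∣i∣≡0⇒i≡0 (ℕ.m+n≡0⇒m≡0 _ h)))
    (indiscernible x y (ℕ.m+n≡0⇒n≡0 ℤ.∣ a ℤ.- b ∣ h))

  symmetric : ∀ {n} (x y : Vec ℤ n) → manhattan x y ≡ manhattan y x
  symmetric []      []      = refl
  symmetric (a ∷ x) (b ∷ y) = cong₂ ℕ._+_ (ℤ.∣i-j∣≡∣j-i∣ a b) (symmetric x y)

  triangle : ∀ {n} (x y z : Vec ℤ n) → manhattan x z ℕ.≤ manhattan x y ℕ.+ manhattan y z
  triangle []      []      []      = ℕ.z≤n
  triangle (a ∷ x) (b ∷ y) (c ∷ z) = ℕ.≤-trans
    (ℕ.+-mono-≤ step (triangle x y z))
    (ℕ.≤-reflexive (shuffle ℤ.∣ a ℤ.- b ∣ ℤ.∣ b ℤ.- c ∣ (manhattan x y) (manhattan y z)))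
    where
    open import Data.Nat.Solver
    split : ∀ a b c → a ℤ.- c ≡ (a ℤ.- b) ℤ.+ (b ℤ.- c)
    split = solve 3 (λ a b c → a :- c := (a :- b) :+ (b :- c)) refl where open ℤSolver.+-*-Solver
    step : ℤ.∣ a ℤ.- c ∣ ℕ.≤ ℤ.∣ a ℤ.- b ∣ ℕ.+ ℤ.∣ b ℤ.- c ∣
    step = ℕ.≤-trans (ℕ.≤-reflexive (cong ℤ.∣_∣ (split a b c))) (ℤ.∣i+j∣≤∣i∣+∣j∣ (a ℤ.- b) (b ℤ.- c))
    shuffle : ∀ p q s t → (p ℕ.+ q) ℕ.+ (s ℕ.+ t) ≡ (p ℕ.+ s) ℕ.+ (q ℕ.+ t)
    shuffle = solve 4 (λ p q s t → (p :+ q) :+ (s :+ t) := (p :+ s) :+ (q :+ t)) refl where open +-*-Solver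

{-# OPTIONS --safe #-}

-- Order ℤ⁶ by the ℓ₁-norm and then lexicographically, an order of type ω, and
-- remove the points from the complex in decreasing order. Around v let the
-- positive direction of a coordinate be the one decreasing it in absolute
-- value. A clique τ of smaller neighbours of v extends by a smaller point w
-- near v: since every member of τ gains at least as much as it loses relative
-- to v, while any two members overlap in at least half of their distance to
-- v, one can balance the sets of positive coordinates of the members, and w
-- makes one step in each coordinate of a suitable set T, corrected by at most
-- two steps in one other coordinate. The possible w are pairwise at distance
-- at most 10, so they form a simplex, and the weight of v can be distributed
-- over them by a partition of unity.
--
-- The distribution is a sequence of transfers of weight between vertices,
-- whose amounts are piecewise linear in the weights. Weights below a
-- threshold are first gathered at v, so that the carrier of the result can be
-- decided approximately. Running the eliminations for the vertex of rank j
-- during a time interval close to 2^(-4j), with gaps between the phases,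
-- gives a homotopy defined on the whole complex, because only finitely many
-- vertices matter near each point. It is continuous for coordinatewise
-- closeness, which induces the weak topology as the complex is locally finite.

module Submission where

open import Defs hiding (_<_; _≤_; _≈_; _+_; _-_; -_; ≤-refl; ≤-trans; ≈-refl; ≈-sym; ≈-trans; 0ℝ; 1ℝ; ∣_∣)
import Defs
open import Data.Nat.Base as ℕ using (ℕ; zero; suc; _≤_; _<_)
import Data.Nat.Properties as ℕ
open import Data.Nat.Tactic.RingSolver using (solve-∀)
open import Data.Integer.Base as ℤ using (ℤ; +_; -[1+_]; +[1+_]; +0)
import Data.Integer.Properties as ℤ
open import Data.Rational.Base as ℚ using (ℚ; 0ℚ; 1ℚ)
import Data.Rational.Properties as ℚ
import Data.Rational.Solver as ℚSolver
import Data.Rational.Unnormalised.Base as ℚᵘ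
import Data.Rational.Unnormalised.Properties as ℚᵘ
open import Algebra.Bundles using (AbelianGroup)
import Algebra.Solver.CommutativeMonoid
open import Data.Bool.Base using (Bool; true; false; _∧_; _∨_; if_then_else_)
open import Data.Empty using (⊥; ⊥-elim)
open import Data.Fin.Base as Fin using (Fin; zero; suc)
import Data.Fin.Properties as Fin
open import Data.List.Base using (List; []; _∷_; _++_; foldr; length; filter; deduplicate; map; upTo; cartesianProductWith)
open import Data.List.Membership.Propositional using (_∈_; _∉_; find; lose)
open import Data.List.Membership.Propositional.Properties
open import Data.List.Relation.Unary.All as All using (All; []; _∷_)
import Data.List.Relation.Unary.All.Properties as All
open import Data.List.Relation.Unary.AllPairs using ([]; _∷_)
open import Data.List.Relation.Unary.Any as Any using (here; there)
open import Data.List.Relation.Unary.Unique.Propositional using (Unique)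
open import Data.Maybe.Base using (Maybe; just; nothing)
open import Data.Product.Base using (∃; ∃-syntax; _×_; _,_; proj₁; proj₂)
open import Data.Sum.Base using (_⊎_; inj₁; inj₂; [_,_]′)
open import Data.Vec.Base using (Vec; []; _∷_; lookup; replicate; tabulate)
import Data.Vec.Properties as Vec
open import Function.Base using (_∘_)
open import Function.Metric.Nat.Structures using (IsMetric)
open import Level using (0ℓ; lift)
open import Relation.Binary.Bundles using (Poset)
open import Relation.Binary.Definitions using (DecidableEquality; tri<; tri≈; tri>)
open import Relation.Binary.PropositionalEquality using (_≡_; _≢_; refl; sym; trans; cong; cong₂; subst; subst₂; module ≡-Reasoning)
import Relation.Binary.Reasoning.PartialOrder
open import Relation.Nullary using (Dec; yes; no; ¬_; ¬?; contradiction; does)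
open import Relation.Nullary.Decidable using (map′)
open import Relation.Unary using (Pred; Decidable)

-- Real numbers

-- The relations of Defs unfold to statements about rationals; wrapping them
-- in records lets their arguments be inferred.

-- A point of the realization comes with a list of vertices forming a simplex around its support,
-- while it cannot be decided whether a real weight vanishes. Every map must therefore produce its
-- new simplex from approximate information. This shapes the formulas: each case distinction has
-- overlapping alternatives, and every threshold occurs twice, once as a cut-off in a formula and
-- once, at about half or double its value, in the test that chooses the simplex. The vertex w
-- depends on the clique τ, so v is not folded onto a single vertex. Its weight goes to those w that
-- are adjacent to all heavy neighbours, or back to the heavy neighbours when v itself is light. The
-- constant 10 is 6 + 4: the diagonal inward neighbour of v may take six steps, every other w stays
-- within distance 4 of v. That 4 is enough depends on the dimension: in the critical case the
-- positive coordinates of two members and the negative coordinates of one of them are three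
-- disjoint sets among six coordinates, and the first two have at least two elements each. There is
-- no last vertex with which to start, so the phases accumulate at time 0, where the homotopy is the
-- identity.

infix 4 _≼_ _≃_

record _≼_ (x y : ℝ) : Set where
  constructor ≼-in
  field ≼-out : x Defs.≤ y

record _≃_ (x y : ℝ) : Set where
  constructor _,≃_
  field
    ≃⇒≼ : x ≼ y
    ≃⇒≽ : y ≼ x

open _≼_
open _≃_

≃-in : ∀ {x y} → x Defs.≈ y → x ≃ y
≃-in (p , q) = ≼-in p ,≃ ≼-in q

≃-out : ∀ {x y} → x ≃ y → x Defs.≈ y
≃-out (p ,≃ q) = ≼-out p , ≼-out q

≼-refl : ∀ {x} → x ≼ x
≼-refl {x} = ≼-in (Defs.≤-refl {x})

≼-trans : ∀ {x y z} → x ≼ y → y ≼ z → x ≼ z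
≼-trans {x} {y} {z} (≼-in p) (≼-in q) = ≼-in (Defs.≤-trans {x} {y} {z} p q)

≃-refl : ∀ {x} → x ≃ x
≃-refl = ≼-refl ,≃ ≼-refl

≃-sym : ∀ {x y} → x ≃ y → y ≃ x
≃-sym (p ,≃ q) = q ,≃ p

≃-trans : ∀ {x y z} → x ≃ y → y ≃ z → x ≃ z
≃-trans (p ,≃ q) (p′ ,≃ q′) = ≼-trans p p′ ,≃ ≼-trans q′ q

≼-poset : Poset 0ℓ 0ℓ 0ℓ
≼-poset = record
  { Carrier = ℝ
  ; _≈_ = _≃_
  ; _≤_ = _≼_
  ; isPartialOrder = record
    { isPreorder = record
      { isEquivalence = record { refl = ≃-refl ; sym = ≃-sym ; trans = ≃-trans }
      ; reflexive = ≃⇒≼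
      ; trans = ≼-trans
      }
    ; antisym = _,≃_
    }
  }

module ≼-Reasoning = Relation.Binary.Reasoning.PartialOrder ≼-poset

private
  module ℚS = ℚSolver.+-*-Solver

  regroup₀ : ∀ y a b k → y ℚ.+ (k ℚ.+ b) ℚ.+ (k ℚ.+ k) ℚ.+ (a ℚ.+ k) ≡ y ℚ.+ (a ℚ.+ b) ℚ.+ ((k ℚ.+ k) ℚ.+ (k ℚ.+ k))
  regroup₀ = solve 4 (λ y a b k → y :+ (k :+ b) :+ (k :+ k) :+ (a :+ k) := y :+ (a :+ b) :+ ((k :+ k) :+ (k :+ k))) refl where open ℚS

  regroup₁ : ∀ x y m n → (x ℚ.+ (m ℚ.+ n)) ℚ.+ (y ℚ.+ (m ℚ.+ n)) ≡ (x ℚ.+ y) ℚ.+ ((m ℚ.+ m) ℚ.+ (n ℚ.+ n))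
  regroup₁ = solve 4 (λ x y m n → (x :+ (m :+ n)) :+ (y :+ (m :+ n)) := (x :+ y) :+ ((m :+ m) :+ (n :+ n))) refl where open ℚS

  regroup₂ : ∀ x y z d → (x ℚ.+ (d ℚ.+ d)) ℚ.+ y ℚ.+ (z ℚ.+ (d ℚ.+ d)) ≡ x ℚ.+ (y ℚ.+ z) ℚ.+ ((d ℚ.+ d) ℚ.+ (d ℚ.+ d))
  regroup₂ = solve 4 (λ x y z d → (x :+ (d :+ d)) :+ y :+ (z :+ (d :+ d)) := x :+ (y :+ z) :+ ((d :+ d) :+ (d :+ d))) refl where open ℚS

  regroup₃ : ∀ x y z d → (x ℚ.+ (d ℚ.+ d)) ℚ.+ (y ℚ.+ (z ℚ.+ (d ℚ.+ d))) ≡ (x ℚ.+ y ℚ.+ z) ℚ.+ ((d ℚ.+ d) ℚ.+ (d ℚ.+ d))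
  regroup₃ = solve 4 (λ x y z d → (x :+ (d :+ d)) :+ (y :+ (z :+ (d :+ d))) := (x :+ y :+ z) :+ ((d :+ d) :+ (d :+ d))) refl where open ℚS

  regroup₄ : ∀ y e → ℚ.- y ≡ ℚ.- (y ℚ.+ e) ℚ.+ e
  regroup₄ = solve 2 (λ y e → :- y := :- (y :+ e) :+ e) refl where open ℚS

  regroup₆ : ∀ x m k → x ℚ.+ (m ℚ.+ k) ≡ (x ℚ.+ k) ℚ.+ m
  regroup₆ = solve 3 (λ x m k → x :+ (m :+ k) := (x :+ k) :+ m) refl where open ℚS

  regroup₇ : ∀ a b → a ≡ b ℚ.- (b ℚ.- a)
  regroup₇ = solve 2 (λ a b → a := b :- (b :- a)) refl where open ℚS

  regroup₈ : ∀ x n k → (x ℚ.+ (k ℚ.+ n) ℚ.+ k) ℚ.- (k ℚ.+ k) ≡ x ℚ.+ n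
  regroup₈ = solve 3 (λ x n k → (x :+ (k :+ n) :+ k) :- (k :+ k) := x :+ n) refl where open ℚS

regular-≤ : ∀ x m n → seq x m ℚ.≤ seq x n ℚ.+ (inv m ℚ.+ inv n)
regular-≤ x m n = ∣p-q∣≤e⇒p≤q+e {seq x m} {seq x n} (regular x m n)

-- Regularity moves both sides to a common late index k. The resulting error, four times 1/(k+1),
-- disappears because k is arbitrary.
pointwise : ∀ {x y} → (∀ n → seq x n ℚ.≤ seq y n ℚ.+ (inv n ℚ.+ inv n)) → x ≼ y
pointwise {x} {y} h = ≼-in λ a b → p≤q+2inv⇒p≤q λ k′ → let k = double k′ in begin
  seq x a
    ≤⟨ regular-≤ x a k ⟩
  seq x k ℚ.+ (inv a ℚ.+ inv k)
    ≤⟨ ℚ.+-monoˡ-≤ (inv a ℚ.+ inv k) (h k) ⟩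
  seq y k ℚ.+ (inv k ℚ.+ inv k) ℚ.+ (inv a ℚ.+ inv k)
    ≤⟨ ℚ.+-monoˡ-≤ (inv a ℚ.+ inv k) (ℚ.+-monoˡ-≤ (inv k ℚ.+ inv k) (regular-≤ y k b)) ⟩
  seq y b ℚ.+ (inv k ℚ.+ inv b) ℚ.+ (inv k ℚ.+ inv k) ℚ.+ (inv a ℚ.+ inv k)
    ≡⟨ regroup₀ (seq y b) (inv a) (inv b) (inv k) ⟩
  seq y b ℚ.+ (inv a ℚ.+ inv b) ℚ.+ ((inv k ℚ.+ inv k) ℚ.+ (inv k ℚ.+ inv k))
    ≡⟨ cong (λ e → seq y b ℚ.+ (inv a ℚ.+ inv b) ℚ.+ (e ℚ.+ e)) (inv-double k′) ⟩
  seq y b ℚ.+ (inv a ℚ.+ inv b) ℚ.+ (inv k′ ℚ.+ inv k′) ∎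
  where open ℚ.≤-Reasoning

p≤p+q : ∀ {p q} → 0ℚ ℚ.≤ q → p ℚ.≤ p ℚ.+ q
p≤p+q {p} {q} 0≤q = subst (ℚ._≤ p ℚ.+ q) (ℚ.+-identityʳ p) (ℚ.+-monoʳ-≤ p 0≤q)

0≤inv : ∀ n → 0ℚ ℚ.≤ inv n
0≤inv n = ℚ.<⇒≤ (0<inv n)

0≤inv+inv : ∀ m n → 0ℚ ℚ.≤ inv m ℚ.+ inv n
0≤inv+inv m n = ℚ.+-mono-≤ (0≤inv m) (0≤inv n)

pointwise-≡ : ∀ {x y} → (∀ n → seq x n ≡ seq y n) → x ≃ y
pointwise-≡ {x} {y} h =
  pointwise {x} {y} (λ n → subst (λ z → seq x n ℚ.≤ z ℚ.+ (inv n ℚ.+ inv n)) (h n) (p≤p+q {seq x n} (0≤inv+inv n n))) ,≃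
  pointwise {y} {x} (λ n → subst (λ z → seq y n ℚ.≤ z ℚ.+ (inv n ℚ.+ inv n)) (sym (h n)) (p≤p+q {seq y n} (0≤inv+inv n n)))

inv-double≤inv : ∀ n → inv (double n) ℚ.≤ inv n
inv-double≤inv n = subst (inv (double n) ℚ.≤_) (inv-double n) (p≤p+q {inv (double n)} (0≤inv (double n)))

double-index : ∀ x n → seq x (double n) ℚ.≤ seq x n ℚ.+ (inv n ℚ.+ inv n)
double-index x n = ℚ.≤-trans (regular-≤ x (double n) n)
  (ℚ.+-monoʳ-≤ (seq x n) (ℚ.+-monoˡ-≤ (inv n) (inv-double≤inv n)))

double-index′ : ∀ x n → seq x n ℚ.≤ seq x (double n) ℚ.+ (inv n ℚ.+ inv n)
double-index′ x n = ℚ.≤-trans (regular-≤ x n (double n))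
  (ℚ.+-monoʳ-≤ (seq x (double n)) (ℚ.+-monoʳ-≤ (inv n) (inv-double≤inv n)))

private
  ⊔-close : ∀ {a b c d e} → a ℚ.≤ c ℚ.+ e → b ℚ.≤ d ℚ.+ e → a ℚ.⊔ b ℚ.≤ (c ℚ.⊔ d) ℚ.+ e
  ⊔-close {a} {b} {c} {d} {e} p q = ℚ.⊔-lub
    (ℚ.≤-trans p (ℚ.+-monoˡ-≤ e (ℚ.p≤p⊔q c d)))
    (ℚ.≤-trans q (ℚ.+-monoˡ-≤ e (ℚ.p≤q⊔p c d)))

  ⊓-close : ∀ {a b c d e} → a ℚ.≤ c ℚ.+ e → b ℚ.≤ d ℚ.+ e → a ℚ.⊓ b ℚ.≤ (c ℚ.⊓ d) ℚ.+ e
  ⊓-close {a} {b} {c} {d} {e} p q with ℚ.⊓-sel c d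
  ... | inj₁ eq = subst (λ z → a ℚ.⊓ b ℚ.≤ z ℚ.+ e) (sym eq) (ℚ.≤-trans (ℚ.p⊓q≤p a b) p)
  ... | inj₂ eq = subst (λ z → a ℚ.⊓ b ℚ.≤ z ℚ.+ e) (sym eq) (ℚ.≤-trans (ℚ.p⊓q≤q a b) q)

  regular′ : ∀ x m n → seq x n ℚ.≤ seq x m ℚ.+ (inv m ℚ.+ inv n)
  regular′ x m n = subst (λ e → seq x n ℚ.≤ seq x m ℚ.+ e) (ℚ.+-comm (inv n) (inv m))
    (regular-≤ x n m)

private
  neg-flip : ∀ x y e → x ℚ.≤ y ℚ.+ e → ℚ.- y ℚ.≤ ℚ.- x ℚ.+ e
  neg-flip x y e h = begin
    ℚ.- y                         ≡⟨ regroup₄ y e ⟩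
    ℚ.- (y ℚ.+ e) ℚ.+ e           ≤⟨ ℚ.+-monoˡ-≤ e (ℚ.neg-antimono-≤ h) ⟩
    ℚ.- x ℚ.+ e                   ∎
    where open ℚ.≤-Reasoning

infix 9 -_
infixl 7 _⊓_
infixl 6 _⊔_ _+_ _-_

-- Opacity keeps Agda from comparing reals by η-expansion.
opaque
  ⌜_⌝ : ℚ → ℝ
  ⌜_⌝ = fromℚ

  _+_ : ℝ → ℝ → ℝ
  _+_ = Defs._+_

  -_ : ℝ → ℝ
  -_ = Defs.-_

  _⊔_ : ℝ → ℝ → ℝ
  (x ⊔ y) .seq n = seq x n ℚ.⊔ seq y n
  (x ⊔ y) .regular m n = p≤q+e∧q≤p+e⇒∣p-q∣≤e {seq x m ℚ.⊔ seq y m} {seq x n ℚ.⊔ seq y n} {e}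
    (⊔-close {seq x m} {seq y m} {seq x n} {seq y n} {e} (regular-≤ x m n) (regular-≤ y m n))
    (⊔-close {seq x n} {seq y n} {seq x m} {seq y m} {e} (regular′ x m n) (regular′ y m n))
    where
    e : ℚ
    e = inv m ℚ.+ inv n

  _⊓_ : ℝ → ℝ → ℝ
  (x ⊓ y) .seq n = seq x n ℚ.⊓ seq y n
  (x ⊓ y) .regular m n = p≤q+e∧q≤p+e⇒∣p-q∣≤e {seq x m ℚ.⊓ seq y m} {seq x n ℚ.⊓ seq y n} {e}
    (⊓-close {seq x m} {seq y m} {seq x n} {seq y n} {e} (regular-≤ x m n) (regular-≤ y m n))
    (⊓-close {seq x n} {seq y n} {seq x m} {seq y m} {e} (regular′ x m n) (regular′ y m n))
    where
    e : ℚ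
    e = inv m ℚ.+ inv n

_-_ : ℝ → ℝ → ℝ
x - y = x + - y

0ℝ 1ℝ : ℝ
0ℝ = ⌜ 0ℚ ⌝
1ℝ = ⌜ 1ℚ ⌝

opaque
  unfolding ⌜_⌝ _+_ -_ _⊔_ _⊓_

  ⌜⌝≃fromℚ : ∀ q → ⌜ q ⌝ ≃ fromℚ q
  ⌜⌝≃fromℚ q = pointwise-≡ λ n → refl

  +≃Defs+ : ∀ x y → x + y ≃ x Defs.+ y
  +≃Defs+ x y = pointwise-≡ λ n → refl

  +-mono : ∀ {x x′ y y′} → x ≼ x′ → y ≼ y′ → x + y ≼ x′ + y′
  +-mono {x} {x′} {y} {y′} (≼-in p) (≼-in q) = ≼-in λ m n → let m′ = double m ; n′ = double n in begin
    seq x m′ ℚ.+ seq y m′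
      ≤⟨ ℚ.+-mono-≤ (p m′ n′) (q m′ n′) ⟩
    (seq x′ n′ ℚ.+ (inv m′ ℚ.+ inv n′)) ℚ.+ (seq y′ n′ ℚ.+ (inv m′ ℚ.+ inv n′))
      ≡⟨ regroup₁ (seq x′ n′) (seq y′ n′) (inv m′) (inv n′) ⟩
    (seq x′ n′ ℚ.+ seq y′ n′) ℚ.+ ((inv m′ ℚ.+ inv m′) ℚ.+ (inv n′ ℚ.+ inv n′))
      ≡⟨ cong₂ (λ a b → (seq x′ n′ ℚ.+ seq y′ n′) ℚ.+ (a ℚ.+ b)) (inv-double m) (inv-double n) ⟩
    (seq x′ n′ ℚ.+ seq y′ n′) ℚ.+ (inv m ℚ.+ inv n) ∎
    where open ℚ.≤-Reasoning

  +-comm : ∀ x y → x + y ≃ y + x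
  +-comm x y = pointwise-≡ λ n → ℚ.+-comm (seq x (double n)) (seq y (double n))

  +-identityʳ : ∀ x → x + 0ℝ ≃ x
  +-identityʳ x =
    pointwise (λ n → ℚ.≤-trans (ℚ.≤-reflexive (ℚ.+-identityʳ (seq x (double n)))) (double-index x n)) ,≃
    pointwise (λ n → ℚ.≤-trans (double-index′ x n)
      (ℚ.+-monoˡ-≤ (inv n ℚ.+ inv n) (ℚ.≤-reflexive (sym (ℚ.+-identityʳ (seq x (double n)))))))

  +-inverseʳ : ∀ x → x + - x ≃ 0ℝ
  +-inverseʳ x = pointwise-≡ λ n → ℚ.+-inverseʳ (seq x (double n))

  +-assoc : ∀ x y z → (x + y) + z ≃ x + (y + z)
  +-assoc x y z =
    pointwise (λ n → let d = double n ; e = double d in begin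
      seq x e ℚ.+ seq y e ℚ.+ seq z d
        ≤⟨ ℚ.+-mono-≤ (ℚ.+-monoˡ-≤ (seq y e) (double-index x d)) (double-index′ z d) ⟩
      (seq x d ℚ.+ (inv d ℚ.+ inv d)) ℚ.+ seq y e ℚ.+ (seq z e ℚ.+ (inv d ℚ.+ inv d))
        ≡⟨ regroup₂ (seq x d) (seq y e) (seq z e) (inv d) ⟩
      seq x d ℚ.+ (seq y e ℚ.+ seq z e) ℚ.+ ((inv d ℚ.+ inv d) ℚ.+ (inv d ℚ.+ inv d))
        ≡⟨ cong (λ i → seq x d ℚ.+ (seq y e ℚ.+ seq z e) ℚ.+ (i ℚ.+ i)) (inv-double n) ⟩
      seq x d ℚ.+ (seq y e ℚ.+ seq z e) ℚ.+ (inv n ℚ.+ inv n) ∎) ,≃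
    pointwise (λ n → let d = double n ; e = double d in begin
      seq x d ℚ.+ (seq y e ℚ.+ seq z e)
        ≤⟨ ℚ.+-mono-≤ (double-index′ x d) (ℚ.+-monoʳ-≤ (seq y e) (double-index z d)) ⟩
      (seq x e ℚ.+ (inv d ℚ.+ inv d)) ℚ.+ (seq y e ℚ.+ (seq z d ℚ.+ (inv d ℚ.+ inv d)))
        ≡⟨ regroup₃ (seq x e) (seq y e) (seq z d) (inv d) ⟩
      (seq x e ℚ.+ seq y e ℚ.+ seq z d) ℚ.+ ((inv d ℚ.+ inv d) ℚ.+ (inv d ℚ.+ inv d))
        ≡⟨ cong (λ i → (seq x e ℚ.+ seq y e ℚ.+ seq z d) ℚ.+ (i ℚ.+ i)) (inv-double n) ⟩
      (seq x e ℚ.+ seq y e ℚ.+ seq z d) ℚ.+ (inv n ℚ.+ inv n) ∎)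
    where open ℚ.≤-Reasoning

  x≼x⊔y : ∀ x y → x ≼ x ⊔ y
  x≼x⊔y x y = pointwise λ n → ℚ.≤-trans (ℚ.p≤p⊔q (seq x n) (seq y n)) (p≤p+q {seq x n ℚ.⊔ seq y n} (0≤inv+inv n n))

  y≼x⊔y : ∀ x y → y ≼ x ⊔ y
  y≼x⊔y x y = pointwise λ n → ℚ.≤-trans (ℚ.p≤q⊔p (seq x n) (seq y n)) (p≤p+q {seq x n ℚ.⊔ seq y n} (0≤inv+inv n n))

  ⊔-lub : ∀ {x y z} → x ≼ z → y ≼ z → x ⊔ y ≼ z
  ⊔-lub (≼-in p) (≼-in q) = ≼-in λ m n → ℚ.⊔-lub (p m n) (q m n)

  x⊓y≼x : ∀ x y → x ⊓ y ≼ x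
  x⊓y≼x x y = pointwise λ n → ℚ.≤-trans (ℚ.p⊓q≤p (seq x n) (seq y n)) (p≤p+q {seq x n} (0≤inv+inv n n))

  x⊓y≼y : ∀ x y → x ⊓ y ≼ y
  x⊓y≼y x y = pointwise λ n → ℚ.≤-trans (ℚ.p⊓q≤q (seq x n) (seq y n)) (p≤p+q {seq y n} (0≤inv+inv n n))

  ⊓-glb : ∀ {x y z} → z ≼ x → z ≼ y → z ≼ x ⊓ y
  ⊓-glb {x} {y} {z} (≼-in p) (≼-in q) = ≼-in λ m n →
    subst (ℚ._≤ (seq x n ℚ.⊓ seq y n) ℚ.+ (inv m ℚ.+ inv n)) (ℚ.⊓-idem (seq z m))
      (⊓-close {seq z m} {seq z m} {seq x n} {seq y n} {inv m ℚ.+ inv n} (p m n) (q m n))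

  ⌜⌝-mono : ∀ {p q} → p ℚ.≤ q → ⌜ p ⌝ ≼ ⌜ q ⌝
  ⌜⌝-mono {q = q} p≤q = pointwise λ n → ℚ.≤-trans p≤q (p≤p+q {q} (0≤inv+inv n n))

  ⌜⌝-cancel : ∀ {p q} → ⌜ p ⌝ ≼ ⌜ q ⌝ → p ℚ.≤ q
  ⌜⌝-cancel (≼-in h) = p≤q+2inv⇒p≤q λ k → h k k

  ⌜⌝-+ : ∀ p q → ⌜ p ℚ.+ q ⌝ ≃ ⌜ p ⌝ + ⌜ q ⌝
  ⌜⌝-+ p q = pointwise-≡ λ n → refl

  neg-anti : ∀ {x y} → x ≼ y → - y ≼ - x
  neg-anti {x} {y} (≼-in p) = ≼-in λ m n →
    neg-flip (seq x n) (seq y m) (inv m ℚ.+ inv n)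
      (subst (λ e → seq x n ℚ.≤ seq y m ℚ.+ e) (ℚ.+-comm (inv n) (inv m)) (p n m))

  -- Comparison with a gap, the constructive substitute for trichotomy.
  split : ∀ {a b} → a ℚ.< b → ∀ x → x ≼ ⌜ b ⌝ ⊎ ⌜ a ⌝ ≼ x
  split {a} {b} a<b x with archimedean (subst (ℚ._< b ℚ.- a) (ℚ.+-inverseʳ a) (ℚ.+-monoˡ-< (ℚ.- a) a<b))
  ... | k₀ , inv<b-a with seq x (double k₀) ℚ.+ inv (double k₀) ℚ.≤? b
  ...   | yes h = inj₁ (≼-in λ m n → begin
            seq x m                                    ≤⟨ regular-≤ x m k ⟩
            seq x k ℚ.+ (inv m ℚ.+ inv k)              ≡⟨ regroup₆ (seq x k) (inv m) (inv k) ⟩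
            (seq x k ℚ.+ inv k) ℚ.+ inv m              ≤⟨ ℚ.+-mono-≤ h (p≤p+q {inv m} (0≤inv n)) ⟩
            b ℚ.+ (inv m ℚ.+ inv n)                    ∎)
    where
    open ℚ.≤-Reasoning
    k : ℕ
    k = double k₀
  ...   | no h = inj₂ (≼-in λ m n → begin
            a                                          ≡⟨ regroup₇ a b ⟩
            b ℚ.- (b ℚ.- a)                            ≤⟨ ℚ.+-mono-≤ (ℚ.<⇒≤ (ℚ.≰⇒> h)) (ℚ.neg-antimono-≤ (ℚ.<⇒≤ inv<b-a)) ⟩
            (seq x k ℚ.+ inv k) ℚ.- inv k₀             ≡⟨ cong (λ e → (seq x k ℚ.+ inv k) ℚ.- e) (sym (inv-double k₀)) ⟩
            (seq x k ℚ.+ inv k) ℚ.- (inv k ℚ.+ inv k)  ≤⟨ ℚ.+-monoˡ-≤ (ℚ.- (inv k ℚ.+ inv k)) (ℚ.+-monoˡ-≤ (inv k) (regular-≤ x k n)) ⟩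
            (seq x n ℚ.+ (inv k ℚ.+ inv n) ℚ.+ inv k) ℚ.- (inv k ℚ.+ inv k)
                                                       ≡⟨ regroup₈ (seq x n) (inv n) (inv k) ⟩
            seq x n ℚ.+ inv n                          ≤⟨ ℚ.+-monoʳ-≤ (seq x n) 
                                                            (subst (ℚ._≤ inv m ℚ.+ inv n) (ℚ.+-identityˡ (inv n)) (ℚ.+-monoˡ-≤ (inv n) (0≤inv m))) ⟩
            seq x n ℚ.+ (inv m ℚ.+ inv n)              ∎)
    where
    open ℚ.≤-Reasoning
    k : ℕ
    k = double k₀

+-cong : ∀ {x x′ y y′} → x ≃ x′ → y ≃ y′ → x + y ≃ x′ + y′
+-cong (p ,≃ p′) (q ,≃ q′) = +-mono p q ,≃ +-mono p′ q′

neg-cong : ∀ {x y} → x ≃ y → - x ≃ - y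
neg-cong (p ,≃ q) = neg-anti q ,≃ neg-anti p

+-abelianGroup : AbelianGroup 0ℓ 0ℓ
+-abelianGroup = record
  { Carrier = ℝ
  ; _≈_ = _≃_
  ; _∙_ = _+_
  ; ε = 0ℝ
  ; _⁻¹ = -_
  ; isAbelianGroup = record
    { isGroup = record
      { isMonoid = record
        { isSemigroup = record
          { isMagma = record
            { isEquivalence = record { refl = ≃-refl ; sym = ≃-sym ; trans = ≃-trans }
            ; ∙-cong = +-cong
            }
          ; assoc = +-assoc
          }
        ; identity = (λ x → ≃-trans (+-comm 0ℝ x) (+-identityʳ x)) , +-identityʳ
        }
      ; inverse = (λ x → ≃-trans (+-comm (- x) x) (+-inverseʳ x)) , +-inverseʳ
      ; ⁻¹-cong = neg-cong
      }
    ; comm = +-comm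
    }
  }

module +-Solver = Algebra.Solver.CommutativeMonoid (AbelianGroup.commutativeMonoid +-abelianGroup)

+-identityˡ : ∀ x → 0ℝ + x ≃ x
+-identityˡ = AbelianGroup.identityˡ +-abelianGroup

+-monoˡ : ∀ {x y} z → x ≼ y → x + z ≼ y + z
+-monoˡ z p = +-mono p ≼-refl

+-monoʳ : ∀ {x y} z → x ≼ y → z + x ≼ z + y
+-monoʳ z p = +-mono ≼-refl p

x+y-y≃x : ∀ x y → (x + y) - y ≃ x
x+y-y≃x x y = ≃-trans (+-assoc x y (- y)) (≃-trans (+-cong ≃-refl (+-inverseʳ y)) (+-identityʳ x))

x-y+y≃x : ∀ x y → (x - y) + y ≃ x
x-y+y≃x x y = ≃-trans (+-assoc x (- y) y)
  (≃-trans (+-cong ≃-refl (AbelianGroup.inverseˡ +-abelianGroup y)) (+-identityʳ x))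

x≼y+z⇒x-z≼y : ∀ {x y z} → x ≼ y + z → x - z ≼ y
x≼y+z⇒x-z≼y {x} {y} {z} p = ≼-trans (+-monoˡ (- z) p) (≃⇒≼ (x+y-y≃x y z))

x-z≼y⇒x≼y+z : ∀ {x y z} → x - z ≼ y → x ≼ y + z
x-z≼y⇒x≼y+z {x} {y} {z} p = ≼-trans (≃⇒≽ (x-y+y≃x x z)) (+-monoˡ z p)

x+z≼y⇒x≼y-z : ∀ {x y z} → x + z ≼ y → x ≼ y - z
x+z≼y⇒x≼y-z {x} {y} {z} p = ≼-trans (≃⇒≽ (x+y-y≃x x z)) (+-monoˡ (- z) p)

x≼x+y : ∀ {x y} → 0ℝ ≼ y → x ≼ x + y
x≼x+y {x} p = ≼-trans (≃⇒≽ (+-identityʳ x)) (+-monoʳ x p)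

x-y≼x : ∀ {x y} → 0ℝ ≼ y → x - y ≼ x
x-y≼x p = x≼y+z⇒x-z≼y (x≼x+y p)

+-nonneg : ∀ {x y} → 0ℝ ≼ x → 0ℝ ≼ y → 0ℝ ≼ x + y
+-nonneg p q = ≼-trans p (x≼x+y q)

+-cancelˡ-≼ : ∀ z {x y} → z + x ≼ z + y → x ≼ y
+-cancelˡ-≼ z {x} {y} p = begin
  x            ≈⟨ x+y-y≃x x z ⟨
  (x + z) - z  ≈⟨ +-cong (+-comm x z) ≃-refl ⟩
  (z + x) - z  ≤⟨ +-monoˡ (- z) p ⟩
  (z + y) - z  ≈⟨ +-cong (+-comm z y) ≃-refl ⟩
  (y + z) - z  ≈⟨ x+y-y≃x y z ⟩
  y            ∎
  where open ≼-Reasoning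

inv-anti : ∀ {m n} → m ≤ n → inv n ℚ.≤ inv m
inv-anti {m} {n} m≤n = ℚ.toℚᵘ-cancel-≤ (begin
  ℚ.toℚᵘ (inv n)            ≃⟨ ℚ.toℚᵘ-fromℚᵘ (ℚᵘ.mkℚᵘ (ℤ.+ 1) n) ⟩
  ℚᵘ.mkℚᵘ (ℤ.+ 1) n         ≤⟨ ℚᵘ.*≤* (ℤ.*-monoˡ-≤-nonNeg (ℤ.+ 1) (ℤ.+≤+ (ℕ.s≤s m≤n))) ⟩
  ℚᵘ.mkℚᵘ (ℤ.+ 1) m         ≃⟨ ℚ.toℚᵘ-fromℚᵘ (ℚᵘ.mkℚᵘ (ℤ.+ 1) m) ⟨
  ℚ.toℚᵘ (inv m)            ∎)
  where open ℚᵘ.≤-Reasoning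

inv-anti-< : ∀ {m n} → m < n → inv n ℚ.< inv m
inv-anti-< {m} {n} m<n = ℚ.toℚᵘ-cancel-< (begin-strict
  ℚ.toℚᵘ (inv n)            ≃⟨ ℚ.toℚᵘ-fromℚᵘ (ℚᵘ.mkℚᵘ (ℤ.+ 1) n) ⟩
  ℚᵘ.mkℚᵘ (ℤ.+ 1) n         <⟨ ℚᵘ.*<* (ℤ.*-monoˡ-<-pos (ℤ.+ 1) (ℤ.+<+ (ℕ.s≤s m<n))) ⟩
  ℚᵘ.mkℚᵘ (ℤ.+ 1) m         ≃⟨ ℚ.toℚᵘ-fromℚᵘ (ℚᵘ.mkℚᵘ (ℤ.+ 1) m) ⟨
  ℚ.toℚᵘ (inv m)            ∎)
  where open ℚᵘ.≤-Reasoning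

-- Closeness

opaque
  ι : ℕ → ℝ
  ι k = ⌜ inv k ⌝

  ι-nonneg : ∀ k → 0ℝ ≼ ι k
  ι-nonneg k = ⌜⌝-mono (0≤inv k)

  ι-anti : ∀ {m n} → m ≤ n → ι n ≼ ι m
  ι-anti m≤n = ⌜⌝-mono (inv-anti m≤n)

  ι≼1 : ∀ k → ι k ≼ 1ℝ
  ι≼1 k = ⌜⌝-mono (inv-anti {0} {k} ℕ.z≤n)

  ι-positive : ∀ k → ¬ ι k ≼ 0ℝ
  ι-positive k p = ℚ.<-irrefl refl (ℚ.<-≤-trans (0<inv k) (⌜⌝-cancel p))

  ι-double : ∀ k → ι (double k) + ι (double k) ≃ ι k
  ι-double k = ≃-trans (≃-sym (⌜⌝-+ (inv (double k)) (inv (double k))))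
    (subst (λ q → ⌜ inv (double k) ℚ.+ inv (double k) ⌝ ≃ ⌜ q ⌝) (inv-double k) ≃-refl)

  split-ι : ∀ {m n} → m < n → ∀ x → x ≼ ι m ⊎ ι n ≼ x
  split-ι m<n = split (inv-anti-< m<n)

-- The bound 1/(k+1) on the distance, as two one-sided inequalities. In this form it passes through
-- sums, `⊓` and `⊔` without absolute values; `distance⇒close` and `close⇒distance` connect it to
-- the strict bounds that define the topologies.
record Close (k : ℕ) (x y : ℝ) : Set where
  constructor _,~_
  field
    close⇒≼ : x ≼ y + ι k
    close⇒≽ : y ≼ x + ι k

open Close

close-refl : ∀ {k x} → Close k x x
close-refl {k} = x≼x+y (ι-nonneg k) ,~ x≼x+y (ι-nonneg k)

close-sym : ∀ {k x y} → Close k x y → Close k y x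
close-sym (p ,~ q) = q ,~ p

close-weaken : ∀ {m n x y} → m ≤ n → Close n x y → Close m x y
close-weaken m≤n (p ,~ q) =
  ≼-trans p (+-monoʳ _ (ι-anti m≤n)) ,~ ≼-trans q (+-monoʳ _ (ι-anti m≤n))

≃⇒close : ∀ {k x y} → x ≃ y → Close k x y
≃⇒close {k} (p ,≃ q) = ≼-trans p (x≼x+y (ι-nonneg k)) ,~ ≼-trans q (x≼x+y (ι-nonneg k))

close-trans : ∀ {k x y z} → Close (double k) x y → Close (double k) y z → Close k x z
close-trans {k} (p ,~ q) (p′ ,~ q′) = half p p′ ,~ half q′ q
  where
  half : ∀ {x y z} → x ≼ y + ι (double k) → y ≼ z + ι (double k) → x ≼ z + ι k
  half {x} {y} {z} p q = begin
    x                                                      ≤⟨ p ⟩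
    y + ι (double k)                                 ≤⟨ +-monoˡ _ q ⟩
    (z + ι (double k)) + ι (double k)          ≈⟨ +-assoc _ _ _ ⟩
    z + (ι (double k) + ι (double k))          ≈⟨ +-cong ≃-refl (ι-double k) ⟩
    z + ι k                                          ∎
    where open ≼-Reasoning

close-resp : ∀ {k x x′ y y′} → x ≃ x′ → y ≃ y′ → Close k x y → Close k x′ y′
close-resp (a ,≃ b) (c ,≃ d) (p ,~ q) =
  ≼-trans b (≼-trans p (+-monoˡ _ c)) ,~ ≼-trans d (≼-trans q (+-monoˡ _ a))

close-+ : ∀ {k x x′ y y′} → Close (double k) x x′ → Close (double k) y y′ → Close k (x + y) (x′ + y′)
close-+ {k} (p ,~ q) (p′ ,~ q′) = half p p′ ,~ half q q′
  where
  half : ∀ {x x′ y y′} → x ≼ x′ + ι (double k) → y ≼ y′ + ι (double k) → x + y ≼ (x′ + y′) + ι k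
  half {x} {x′} {y} {y′} p q = begin
    x + y                                                     ≤⟨ +-mono p q ⟩
    (x′ + e) + (y′ + e)                                       ≈⟨ solve 4 (λ a b c d → (a ⊕ c) ⊕ (b ⊕ d) ⊜ (a ⊕ b) ⊕ (c ⊕ d)) ≃-refl x′ y′ e e ⟩
    (x′ + y′) + (e + e)                                       ≈⟨ +-cong ≃-refl (ι-double k) ⟩
    (x′ + y′) + ι k                                     ∎
    where
    open ≼-Reasoning
    open +-Solver
    e : ℝ
    e = ι (double k)

close-neg : ∀ {k x y} → Close k x y → Close k (- x) (- y)
close-neg {k} (p ,~ q) = half q ,~ half p
  where
  half : ∀ {x y} → x ≼ y + ι k → - y ≼ - x + ι k
  half {x} {y} p = x-z≼y⇒x≼y+z (begin
    - y - ι k    ≈⟨ ⁻¹-∙-comm y (ι k) ⟩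
    - (y + ι k)  ≤⟨ neg-anti p ⟩
    - x                ∎)
    where
    open ≼-Reasoning
    open import Algebra.Properties.AbelianGroup +-abelianGroup

close-- : ∀ {k x x′ y y′} → Close (double k) x x′ → Close (double k) y y′ → Close k (x - y) (x′ - y′)
close-- p q = close-+ p (close-neg q)

close-⊓ : ∀ {k x x′ y y′} → Close k x x′ → Close k y y′ → Close k (x ⊓ y) (x′ ⊓ y′)
close-⊓ {k} (p ,~ q) (p′ ,~ q′) = half p p′ ,~ half q q′
  where
  half : ∀ {x x′ y y′ e} → x ≼ x′ + e → y ≼ y′ + e → x ⊓ y ≼ (x′ ⊓ y′) + e
  half p q = x-z≼y⇒x≼y+z (⊓-glb
    (x≼y+z⇒x-z≼y (≼-trans (x⊓y≼x _ _) p)) (x≼y+z⇒x-z≼y (≼-trans (x⊓y≼y _ _) q)))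

close-⊔ : ∀ {k x x′ y y′} → Close k x x′ → Close k y y′ → Close k (x ⊔ y) (x′ ⊔ y′)
close-⊔ {k} (p ,~ q) (p′ ,~ q′) = half p p′ ,~ half q q′
  where
  half : ∀ {x x′ y y′ e} → x ≼ x′ + e → y ≼ y′ + e → x ⊔ y ≼ (x′ ⊔ y′) + e
  half p q = ⊔-lub (≼-trans p (+-monoˡ _ (x≼x⊔y _ _))) (≼-trans q (+-monoˡ _ (y≼x⊔y _ _)))

private
  regroup₉ : ∀ y d n k → y ℚ.+ (d ℚ.+ n) ℚ.+ k ℚ.+ (n ℚ.+ k) ≡ y ℚ.+ (n ℚ.+ n) ℚ.+ (k ℚ.+ (d ℚ.+ k))
  regroup₉ = solve 4 (λ y d n k → y :+ (d :+ n) :+ k :+ (n :+ k) := y :+ (n :+ n) :+ (k :+ (d :+ k))) refl where open ℚS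

  close-limit-ℚ : ∀ {x y₁ y₂ d n k} → x ℚ.≤ y₁ ℚ.+ k ℚ.+ (n ℚ.+ k) → y₁ ℚ.≤ y₂ ℚ.+ (d ℚ.+ n) → 0ℚ ℚ.≤ k → d ℚ.≤ k →
    x ℚ.≤ y₂ ℚ.+ (n ℚ.+ n) ℚ.+ ((k ℚ.+ k) ℚ.+ (k ℚ.+ k))
  close-limit-ℚ {x} {y₁} {y₂} {d} {n} {k} p q 0≤k d≤k = begin
    x                                                   ≤⟨ p ⟩
    y₁ ℚ.+ k ℚ.+ (n ℚ.+ k)                              ≤⟨ ℚ.+-monoˡ-≤ (n ℚ.+ k) (ℚ.+-monoˡ-≤ k q) ⟩
    y₂ ℚ.+ (d ℚ.+ n) ℚ.+ k ℚ.+ (n ℚ.+ k)                ≡⟨ regroup₉ y₂ d n k ⟩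
    y₂ ℚ.+ (n ℚ.+ n) ℚ.+ (k ℚ.+ (d ℚ.+ k))              ≤⟨ ℚ.+-monoʳ-≤ (y₂ ℚ.+ (n ℚ.+ n)) (ℚ.+-mono-≤ (p≤p+q {k} 0≤k) (ℚ.+-monoˡ-≤ k d≤k)) ⟩
    y₂ ℚ.+ (n ℚ.+ n) ℚ.+ ((k ℚ.+ k) ℚ.+ (k ℚ.+ k))      ∎
    where open ℚ.≤-Reasoning

opaque
  unfolding ⌜_⌝ _+_ ι

  ≼-limit : ∀ {x y} → (∀ k → x ≼ y + ι k) → x ≼ y
  ≼-limit {x} {y} h = pointwise λ n → p≤q+2inv⇒p≤q λ k′ →
    subst (λ e → seq x n ℚ.≤ seq y n ℚ.+ (inv n ℚ.+ inv n) ℚ.+ (e ℚ.+ e)) (inv-double k′)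
      (close-limit-ℚ {seq x n} {seq y (double (double k′))} {seq y n} {inv (double (double k′))} {inv n} {inv (double k′)}
        (≼-out (h (double k′)) n (double k′)) (regular-≤ y (double (double k′)) n)
        (0≤inv (double k′)) (inv-double≤inv (double k′)))

close-limit : ∀ {x y} → (∀ k → Close k x y) → x ≃ y
close-limit h = ≼-limit (λ k → close⇒≼ (h k)) ,≃ ≼-limit (λ k → close⇒≽ (h k))

private
  distance⇒≤ : ∀ {x₁ x₂ y₁ y₂ i m d n a e} → ℚ.∣ x₁ ℚ.- y₁ ∣ ℚ.+ (m ℚ.+ n) ℚ.< i → x₂ ℚ.≤ x₁ ℚ.+ (a ℚ.+ d) →
    y₁ ℚ.≤ y₂ ℚ.+ (d ℚ.+ e) → d ℚ.+ d ≡ m → e ℚ.≤ a → 0ℚ ℚ.≤ n → x₂ ℚ.≤ y₂ ℚ.+ i ℚ.+ (a ℚ.+ a)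
  distance⇒≤ {x₁} {x₂} {y₁} {y₂} {i} {m} {d} {n} {a} {e} h p q refl e≤a 0≤n = begin
    x₂                                          ≤⟨ p ⟩
    x₁ ℚ.+ (a ℚ.+ d)                            ≤⟨ ℚ.+-monoˡ-≤ (a ℚ.+ d) (∣p-q∣≤e⇒p≤q+e {x₁} {y₁} ℚ.≤-refl) ⟩
    y₁ ℚ.+ δ ℚ.+ (a ℚ.+ d)                      ≤⟨ ℚ.+-monoˡ-≤ (a ℚ.+ d) (ℚ.+-monoˡ-≤ δ q) ⟩
    y₂ ℚ.+ (d ℚ.+ e) ℚ.+ δ ℚ.+ (a ℚ.+ d)        ≤⟨ p≤p+q {y₂ ℚ.+ (d ℚ.+ e) ℚ.+ δ ℚ.+ (a ℚ.+ d)} 0≤n ⟩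
    y₂ ℚ.+ (d ℚ.+ e) ℚ.+ δ ℚ.+ (a ℚ.+ d) ℚ.+ n  ≡⟨ regroup y₂ d e δ a n ⟩
    y₂ ℚ.+ (δ ℚ.+ ((d ℚ.+ d) ℚ.+ n)) ℚ.+ (a ℚ.+ e) ≤⟨ ℚ.+-mono-≤ (ℚ.+-monoʳ-≤ y₂ (ℚ.<⇒≤ h)) (ℚ.+-monoʳ-≤ a e≤a) ⟩
    y₂ ℚ.+ i ℚ.+ (a ℚ.+ a)                      ∎
    where
    open ℚ.≤-Reasoning
    δ = ℚ.∣ x₁ ℚ.- y₁ ∣
    regroup : ∀ y d e δ a n → y ℚ.+ (d ℚ.+ e) ℚ.+ δ ℚ.+ (a ℚ.+ d) ℚ.+ n ≡ y ℚ.+ (δ ℚ.+ ((d ℚ.+ d) ℚ.+ n)) ℚ.+ (a ℚ.+ e)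
    regroup = solve 6 (λ y d e δ a n → y :+ (d :+ e) :+ δ :+ (a :+ d) :+ n := y :+ (δ :+ ((d :+ d) :+ n)) :+ (a :+ e)) refl where open ℚS

opaque
  unfolding ⌜_⌝ _+_ ι

  distance⇒close : ∀ {k x y} → Defs.∣ x Defs.- y ∣ Defs.< fromℚ (inv k) → Close k x y
  distance⇒close {k} {x} {y} (m , n , h) = half x y h ,~
    half y x (subst (λ e → e ℚ.+ (inv m ℚ.+ inv n) ℚ.< inv k) (∣p-q∣-sym (seq x (double m)) (seq y (double m))) h)
    where
    half : ∀ x y → ℚ.∣ seq x (double m) ℚ.- seq y (double m) ∣ ℚ.+ (inv m ℚ.+ inv n) ℚ.< inv k → x ≼ y + ι k
    half x y h = pointwise λ a → distance⇒≤ {seq x (double m)} {seq x a} {seq y (double m)} {seq y (double a)} {inv k}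
      {inv m} {inv (double m)} {inv n} {inv a} {inv (double a)} h (regular-≤ x a (double m))
      (regular-≤ y (double m) (double a)) (inv-double m) (inv-double≤inv a) (0≤inv n)

  -- Closeness bounds the difference of the rational approximations by three times 1/(k+1), and the
  -- strict order on reals asks for two more. Three doublings provide eight.
  close⇒distance : ∀ {ε} → 0ℚ ℚ.< ε → ∃[ k ] (∀ {x y} → Close k x y → Defs.∣ x Defs.- y ∣ Defs.< fromℚ ε)
  close⇒distance {ε} 0<ε with archimedean 0<ε
  ... | k₀ , inv<ε = k , λ {x} {y} (≼-in p ,~ ≼-in q) → k , k ,
    ℚ.≤-<-trans (bound {seq x (double k)} {seq y (double k)} (p (double k) k) (q (double k) k)) inv<ε
    where
    k₁ k₂ k : ℕ
    k₁ = double k₀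
    k₂ = double k₁
    k  = double k₂
    bound : ∀ {a b} → a ℚ.≤ (b ℚ.+ inv k) ℚ.+ (inv (double k) ℚ.+ inv k) → b ℚ.≤ (a ℚ.+ inv k) ℚ.+ (inv (double k) ℚ.+ inv k) →
            ℚ.∣ a ℚ.- b ∣ ℚ.+ (inv k ℚ.+ inv k) ℚ.≤ inv k₀
    bound {a} {b} p q = go (inv-double≤inv k) (0≤inv k) (inv-double k₂) (inv-double k₁) (inv-double k₀) p q
      where
      go : ∀ {a b d i j l e} → d ℚ.≤ i → 0ℚ ℚ.≤ i → i ℚ.+ i ≡ j → j ℚ.+ j ≡ l → l ℚ.+ l ≡ e →
           a ℚ.≤ (b ℚ.+ i) ℚ.+ (d ℚ.+ i) → b ℚ.≤ (a ℚ.+ i) ℚ.+ (d ℚ.+ i) →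
           ℚ.∣ a ℚ.- b ∣ ℚ.+ (i ℚ.+ i) ℚ.≤ e
      go {a} {b} {d} {i} d≤i 0≤i refl refl refl p q = begin
        ℚ.∣ a ℚ.- b ∣ ℚ.+ (i ℚ.+ i)
          ≤⟨ ℚ.+-monoˡ-≤ (i ℚ.+ i) (p≤q+e∧q≤p+e⇒∣p-q∣≤e {a} {b} {i ℚ.+ (d ℚ.+ i)}
               (subst (a ℚ.≤_) (ℚ.+-assoc b i (d ℚ.+ i)) p) (subst (b ℚ.≤_) (ℚ.+-assoc a i (d ℚ.+ i)) q)) ⟩
        (i ℚ.+ (d ℚ.+ i)) ℚ.+ (i ℚ.+ i)
          ≤⟨ ℚ.+-monoˡ-≤ (i ℚ.+ i) (ℚ.+-mono-≤ (p≤p+q {i} 0≤i) (ℚ.+-monoˡ-≤ i d≤i)) ⟩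
        ((i ℚ.+ i) ℚ.+ (i ℚ.+ i)) ℚ.+ (i ℚ.+ i)
          ≤⟨ ℚ.+-monoʳ-≤ ((i ℚ.+ i) ℚ.+ (i ℚ.+ i)) (p≤p+q {i ℚ.+ i} (ℚ.+-mono-≤ 0≤i 0≤i)) ⟩
        ((i ℚ.+ i) ℚ.+ (i ℚ.+ i)) ℚ.+ ((i ℚ.+ i) ℚ.+ (i ℚ.+ i)) ∎
        where open ℚ.≤-Reasoning

-- Natural multiples

infixr 8 _·_

opaque
  _·_ : ℕ → ℝ → ℝ
  zero  · x = 0ℝ
  suc n · x = x + n · x

  ·-mono : ∀ n {x y} → x ≼ y → n · x ≼ n · y
  ·-mono zero    p = ≼-refl
  ·-mono (suc n) p = +-mono p (·-mono n p)

  ·-nonneg : ∀ n {x} → 0ℝ ≼ x → 0ℝ ≼ n · x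
  ·-nonneg zero    p = ≼-refl
  ·-nonneg (suc n) p = +-nonneg p (·-nonneg n p)

  ·-zero : ∀ n {x} → x ≃ 0ℝ → n · x ≃ 0ℝ
  ·-zero zero    p = ≃-refl
  ·-zero (suc n) p = ≃-trans (+-cong p (·-zero n p)) (+-identityʳ 0ℝ)

  close-· : ∀ n k → ∃[ m ] (∀ {x y} → Close m x y → Close k (n · x) (n · y))
  close-· zero    k = 0 , λ _ → close-refl
  close-· (suc n) k = let (m , h) = close-· n (double k) in
    double k ℕ.⊔ m , λ c → close-+ (close-weaken (ℕ.m≤m⊔n (double k) m) c) (h (close-weaken (ℕ.m≤n⊔m (double k) m) c))

opaque
  unfolding ι _·_

  ·-inv : ∀ k → suc k · ι k ≃ 1ℝ
  ·-inv k = subst (λ q → suc k · ι k ≃ ⌜ q ⌝)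
    (ℚ.toℚᵘ-injective (ℚᵘ.≃-trans (nsum (suc k)) (ℚᵘ.*≡* (trans (ℤ.*-identityʳ (ℤ.+ suc k)) (sym (ℤ.*-identityˡ (ℤ.+ suc k)))))))
    (multiple (suc k))
    where
    n×inv : ℕ → ℚ
    n×inv zero    = 0ℚ
    n×inv (suc n) = inv k ℚ.+ n×inv n
    multiple : ∀ n → n · ⌜ inv k ⌝ ≃ ⌜ n×inv n ⌝
    multiple zero    = ≃-refl
    multiple (suc n) = ≃-trans (+-cong ≃-refl (multiple n)) (≃-sym (⌜⌝-+ (inv k) (n×inv n)))
    nsum : ∀ n → ℚ.toℚᵘ (n×inv n) ℚᵘ.≃ ℚᵘ.mkℚᵘ (ℤ.+ n) k
    nsum zero    = ℚᵘ.*≡* refl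
    nsum (suc n) = begin
      ℚ.toℚᵘ (inv k ℚ.+ n×inv n)                      ≈⟨ ℚ.toℚᵘ-homo-+ (inv k) (n×inv n) ⟩
      ℚ.toℚᵘ (inv k) ℚᵘ.+ ℚ.toℚᵘ (n×inv n)            ≈⟨ ℚᵘ.+-cong (ℚ.toℚᵘ-fromℚᵘ (ℚᵘ.mkℚᵘ (ℤ.+ 1) k)) (nsum n) ⟩
      ℚᵘ.mkℚᵘ (ℤ.+ 1) k ℚᵘ.+ ℚᵘ.mkℚᵘ (ℤ.+ n) k        ≈⟨ ℚᵘ.*≡* (lemma (ℤ.+ n) (ℤ.+ suc k)) ⟩
      ℚᵘ.mkℚᵘ (ℤ.+ suc n) k                           ∎
      where
      open import Relation.Binary.Reasoning.Setoid ℚᵘ.≃-setoid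
      open import Data.Integer.Solver
      lemma : ∀ n k → (ℤ.+ 1 ℤ.* k ℤ.+ n ℤ.* k) ℤ.* k ≡ (ℤ.+ 1 ℤ.+ n) ℤ.* (k ℤ.* k)
      lemma = solve 2 (λ n k → (con (ℤ.+ 1) :* k :+ n :* k) :* k := (con (ℤ.+ 1) :+ n) :* (k :* k)) refl
        where open +-*-Solver

ι≼⇒1≼ : ∀ k {x} → ι k ≼ x → 1ℝ ≼ suc k · x
ι≼⇒1≼ k p = ≼-trans (≃⇒≽ (·-inv k)) (·-mono (suc k) p)

-- Finite sums

module Sums {V : Set} where

  ∑ : List V → (V → ℝ) → ℝ
  ∑ []      f = 0ℝ
  ∑ (a ∷ l) f = f a + ∑ l f

  ∑-foldr : ∀ l f → ∑ l f ≃ foldr (λ v s → f v Defs.+ s) Defs.0ℝ l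
  ∑-foldr []      f = ⌜⌝≃fromℚ 0ℚ
  ∑-foldr (a ∷ l) f = ≃-trans (+-cong ≃-refl (∑-foldr l f)) (+≃Defs+ (f a) _)

  ∑-zero : ∀ l {f} → (∀ {v} → v ∈ l → f v ≃ 0ℝ) → ∑ l f ≃ 0ℝ
  ∑-zero []      h = ≃-refl
  ∑-zero (a ∷ l) h = ≃-trans (+-cong (h (here refl)) (∑-zero l (λ v∈l → h (there v∈l)))) (+-identityʳ 0ℝ)

  ∑-nonneg : ∀ l {f} → (∀ v → 0ℝ ≼ f v) → 0ℝ ≼ ∑ l f
  ∑-nonneg []      h = ≼-refl
  ∑-nonneg (a ∷ l) h = +-nonneg (h a) (∑-nonneg l h)

  ∑-distrib-+ : ∀ l f g → ∑ l (λ v → f v + g v) ≃ ∑ l f + ∑ l g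
  ∑-distrib-+ []      f g = ≃-sym (+-identityʳ 0ℝ)
  ∑-distrib-+ (a ∷ l) f g = ≃-trans (+-cong ≃-refl (∑-distrib-+ l f g))
    (solve 4 (λ a b c d → (a ⊕ b) ⊕ (c ⊕ d) ⊜ (a ⊕ c) ⊕ (b ⊕ d)) ≃-refl (f a) (g a) (∑ l f) (∑ l g))
    where open +-Solver

  ∑-neg : ∀ l f → ∑ l (λ v → - f v) ≃ - ∑ l f
  ∑-neg []      f = ≃-sym ε⁻¹≈ε
    where open import Algebra.Properties.Group (AbelianGroup.group +-abelianGroup)
  ∑-neg (a ∷ l) f = ≃-trans (+-cong ≃-refl (∑-neg l f)) (⁻¹-∙-comm (f a) (∑ l f))
    where open import Algebra.Properties.AbelianGroup +-abelianGroup

  ≼∑ : ∀ {l f v} → (∀ v → 0ℝ ≼ f v) → v ∈ l → f v ≼ ∑ l f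
  ≼∑ {a ∷ l} h (here refl) = x≼x+y (∑-nonneg l h)
  ≼∑ {a ∷ l} h (there v∈l) = ≼-trans (≼∑ h v∈l) (≼-trans (≃⇒≽ (+-identityˡ _)) (+-monoˡ _ (h a)))

  ∑-++-∷ : ∀ l a l′ f → ∑ (l ++ a ∷ l′) f ≃ f a + ∑ (l ++ l′) f
  ∑-++-∷ []      a l′ f = ≃-refl
  ∑-++-∷ (b ∷ l) a l′ f = ≃-trans (+-cong ≃-refl (∑-++-∷ l a l′ f))
    (solve 3 (λ a b c → b ⊕ (a ⊕ c) ⊜ a ⊕ (b ⊕ c)) ≃-refl (f a) (f b) (∑ (l ++ l′) f))
    where open +-Solver

  unique-++-∷ : ∀ (l : List V) {a l′} → Unique (l ++ a ∷ l′) → Unique (l ++ l′) × a ∉ l ++ l′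
  unique-++-∷ []      (a≢ ∷ u) = u , All.All¬⇒¬Any a≢
  unique-++-∷ (b ∷ l) {a} {l′} (b≢ ∷ u) with unique-++-∷ l u
  ... | u′ , a∉ = (All.++⁺ (All.++⁻ˡ l b≢) (All.tail (All.++⁻ʳ l b≢)) ∷ u′) ,
    λ { (here refl) → All.head (All.++⁻ʳ l b≢) refl ; (there a∈) → a∉ a∈ }

  module _ (_≟_ : DecidableEquality V) where

    open import Data.List.Membership.DecPropositional _≟_ using (_∈?_)

    -- Makes the total weight independent of the list chosen around the support. Each entry of `l`
    -- is either a zero term or is cut out of `l′`, where uniqueness guarantees that it does not
    -- occur again.
    ∑-support : ∀ {l l′ f} → Unique l → Unique l′ → (∀ {v} → v ∈ l → v ∉ l′ → f v ≃ 0ℝ) →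
                (∀ {v} → v ∈ l′ → v ∉ l → f v ≃ 0ℝ) → ∑ l f ≃ ∑ l′ f
    ∑-support {[]}    {l′} {f} _ u′ h h′ = ≃-sym (∑-zero l′ (λ v∈l′ → h′ v∈l′ (λ ())))
    ∑-support {a ∷ l} {l′} {f} (a≢ ∷ u) u′ h h′ with a ∈? l′
    ... | no a∉l′ = ≃-trans (+-cong (h (here refl) a∉l′) (∑-support u u′ (λ v∈l → h (there v∈l)) inner)) (+-identityˡ _)
      where
      inner : ∀ {v} → v ∈ l′ → v ∉ l → f v ≃ 0ℝ
      inner v∈l′ v∉l = h′ v∈l′ λ { (here refl) → a∉l′ v∈l′ ; (there v∈l) → v∉l v∈l }
    ... | yes a∈l′ with ∈-∃++ a∈l′
    ...   | l₁ , l₂ , refl =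
      ≃-trans (+-cong ≃-refl (∑-support u (proj₁ (unique-++-∷ l₁ u′)) left right)) (≃-sym (∑-++-∷ l₁ a l₂ f))
      where
      drop : ∀ {v} → v ∈ l₁ ++ l₂ → v ∈ l₁ ++ a ∷ l₂
      drop v∈ with ∈-++⁻ l₁ v∈
      ... | inj₁ v∈l₁ = ∈-++⁺ˡ v∈l₁
      ... | inj₂ v∈l₂ = ∈-++⁺ʳ l₁ (there v∈l₂)
      undrop : ∀ {v} → v ≢ a → v ∈ l₁ ++ a ∷ l₂ → v ∈ l₁ ++ l₂
      undrop v≢a v∈ with ∈-++⁻ l₁ v∈
      ... | inj₁ v∈l₁         = ∈-++⁺ˡ v∈l₁
      ... | inj₂ (here v≡a)   = contradiction v≡a v≢a
      ... | inj₂ (there v∈l₂) = ∈-++⁺ʳ l₁ v∈l₂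
      left : ∀ {v} → v ∈ l → v ∉ l₁ ++ l₂ → f v ≃ 0ℝ
      left v∈l v∉ = h (there v∈l) (λ v∈ → v∉ (undrop (λ { refl → All.All¬⇒¬Any a≢ v∈l }) v∈))
      right : ∀ {v} → v ∈ l₁ ++ l₂ → v ∉ l → f v ≃ 0ℝ
      right v∈ v∉l = h′ (drop v∈) λ { (here refl) → proj₂ (unique-++-∷ l₁ u′) v∈ ; (there v∈l) → v∉l v∈l }

    opaque
      unfolding _·_

      -- A constructive pigeonhole principle: each term is only compared with the gap between `ι n`
      -- and `ι m`, so the two outcomes may overlap.
      some-large : ∀ {m n} → m < n → ∀ l f → ∑ l f ≼ length l · ι m ⊎ ∃[ v ] v ∈ l × ι n ≼ f v
      some-large m<n []      f = inj₁ ≼-refl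
      some-large m<n (a ∷ l) f with split-ι m<n (f a) | some-large m<n l f
      ... | inj₂ large | _                        = inj₂ (a , here refl , large)
      ... | inj₁ _     | inj₂ (v , v∈l , large)   = inj₂ (v , there v∈l , large)
      ... | inj₁ small | inj₁ smalls              = inj₁ (+-mono small smalls)

-- Moving mass between vertices

module Moves {V : Set} (_≟_ : DecidableEquality V) where

  open Sums {V}
  open import Data.List.Membership.DecPropositional _≟_ using (_∈?_)

  Weights : Set
  Weights = V → ℝ

  Off : List V → Weights → Set
  Off l x = ∀ {v} → v ∉ l → x v ≃ 0ℝ

  dirac : V → ℝ → Weights
  dirac w m z with z ≟ w
  ... | yes _ = m
  ... | no  _ = 0ℝ

  dirac-≡ : ∀ w m → dirac w m w ≃ m
  dirac-≡ w m with w ≟ w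
  ... | yes _   = ≃-refl
  ... | no  w≢w = contradiction refl w≢w

  dirac-≢ : ∀ {w m z} → z ≢ w → dirac w m z ≃ 0ℝ
  dirac-≢ {w} {m} {z} z≢w with z ≟ w
  ... | yes z≡w = contradiction z≡w z≢w
  ... | no  _   = ≃-refl

  dirac-zero : ∀ {w m} z → (z ≡ w → m ≃ 0ℝ) → dirac w m z ≃ 0ℝ
  dirac-zero {w} z h with z ≟ w
  ... | yes z≡w = h z≡w
  ... | no  _   = ≃-refl

  dirac-nonneg : ∀ {w m} z → 0ℝ ≼ m → 0ℝ ≼ dirac w m z
  dirac-nonneg {w} z h with z ≟ w
  ... | yes _ = h
  ... | no  _ = ≼-refl

  ∑-dirac : ∀ {l w m} → Unique l → w ∈ l → ∑ l (dirac w m) ≃ m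
  ∑-dirac {l} {w} {m} u w∈l = ≃-trans
    (∑-support _≟_ u ([] ∷ []) (λ _ v∉ → dirac-≢ (λ v≡w → v∉ (here v≡w)))
      (λ { (here refl) w∉l → contradiction w∈l w∉l }))
    (≃-trans (+-identityʳ _) (dirac-≡ w m))

  -0≃0 : - 0ℝ ≃ 0ℝ
  -0≃0 = ≃-trans (≃-sym (+-identityˡ (- 0ℝ))) (+-inverseʳ 0ℝ)

  opaque
    move : V → V → ℝ → Weights → Weights
    move u w m x z = (x z + dirac w m z) - dirac u m z

    ∑-move : ∀ {l u w m x} → Unique l → u ∈ l → w ∈ l → ∑ l (move u w m x) ≃ ∑ l x
    ∑-move {l} {u} {w} {m} {x} uniq u∈l w∈l = begin-equality
      ∑ l (move u w m x)                                          ≈⟨ ∑-distrib-+ l (λ z → x z + dirac w m z) (λ z → - dirac u m z) ⟩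
      ∑ l (λ z → x z + dirac w m z) + ∑ l (λ z → - dirac u m z)   ≈⟨ +-cong (∑-distrib-+ l x (dirac w m)) (∑-neg l (dirac u m)) ⟩
      (∑ l x + ∑ l (dirac w m)) - ∑ l (dirac u m)                 ≈⟨ +-cong (+-cong ≃-refl (∑-dirac uniq w∈l)) (neg-cong (∑-dirac uniq u∈l)) ⟩
      (∑ l x + m) - m                                             ≈⟨ x+y-y≃x (∑ l x) m ⟩
      ∑ l x                                                       ∎
      where open ≼-Reasoning

    move-nonneg : ∀ {u w m x} → 0ℝ ≼ m → m ≼ x u → (∀ z → 0ℝ ≼ x z) → ∀ z → 0ℝ ≼ move u w m x z
    move-nonneg {u} {w} {m} {x} 0≼m m≼x 0≼x z with z ≟ u
    ... | yes refl = x+z≼y⇒x≼y-z (≼-trans (≃⇒≼ (+-identityˡ m)) (≼-trans m≼x (x≼x+y (dirac-nonneg z 0≼m))))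
    ... | no  z≢u  = x+z≼y⇒x≼y-z (≼-trans (≃⇒≼ (+-identityˡ 0ℝ)) (+-nonneg (0≼x z) (dirac-nonneg z 0≼m)))

    move-trivial : ∀ {u w m x} → m ≃ 0ℝ → ∀ z → move u w m x z ≃ x z
    move-trivial {u} {w} {m} {x} m≃0 z = ≃-trans
      (+-cong (≃-trans (+-cong ≃-refl (dirac-zero z (λ _ → m≃0))) (+-identityʳ _))
              (≃-trans (neg-cong (dirac-zero z (λ _ → m≃0))) -0≃0))
      (+-identityʳ _)

    move-source : ∀ {u w m x} → u ≢ w → move u w m x u ≃ x u - m
    move-source {u} {w} {m} u≢w = +-cong (≃-trans (+-cong ≃-refl (dirac-≢ u≢w)) (+-identityʳ _)) (neg-cong (dirac-≡ u m))

    move-other : ∀ {u w m x z} → z ≢ u → z ≢ w → move u w m x z ≃ x z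
    move-other z≢u z≢w = ≃-trans (+-cong (≃-trans (+-cong ≃-refl (dirac-≢ z≢w)) (+-identityʳ _))
      (≃-trans (neg-cong (dirac-≢ z≢u)) -0≃0)) (+-identityʳ _)

    -- Moves never create support except at their target. At the source the amount is bounded by a
    -- weight that is zero.
    move-zero : ∀ {u w m x z} → 0ℝ ≼ m → m ≼ x u → x z ≃ 0ℝ → (z ≡ w → m ≃ 0ℝ) → move u w m x z ≃ 0ℝ
    move-zero {u} {w} {m} {x} {z} 0≼m m≼x x≃0 h = ≃-trans
      (+-cong (≃-trans (+-cong x≃0 (dirac-zero z h)) (+-identityʳ 0ℝ))
              (≃-trans (neg-cong (dirac-zero z (λ { refl → ≼-trans m≼x (≃⇒≼ x≃0) ,≃ 0≼m }))) -0≃0))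
      (+-identityʳ 0ℝ)

  -- A point without its simplex. Single moves may leave the complex, so the simplex is tracked
  -- separately through `Off` and recovered only after a whole step.
  record Distribution (x : Weights) : Set where
    field
      nonneg  : ∀ v → 0ℝ ≼ x v
      support : List V
      unique  : Unique support
      off     : Off support x
      total   : ∑ support x ≃ 1ℝ

  module _ {x : Weights} (X : Distribution x) where
    open Distribution X

    ∑≃1 : ∀ {l} → Unique l → Off l x → ∑ l x ≃ 1ℝ
    ∑≃1 u off′ = ≃-trans (∑-support _≟_ u unique (λ _ → off) (λ _ → off′)) total

    x≼1 : ∀ v → x v ≼ 1ℝ
    x≼1 v with v ∈? support
    ... | yes v∈ = ≼-trans (≼∑ nonneg v∈) (≃⇒≼ total)
    ... | no  v∉ = ≼-trans (≃⇒≼ (off v∉)) (≼-trans (∑-nonneg support nonneg) (≃⇒≼ total))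

  add : V → List V → List V
  add v l with v ∈? l
  ... | yes _ = l
  ... | no  _ = v ∷ l

  add-unique : ∀ v {l} → Unique l → Unique (add v l)
  add-unique v {l} u with v ∈? l
  ... | yes _  = u
  ... | no v∉l = All.¬Any⇒All¬ l v∉l ∷ u

  ∈-add : ∀ v l → v ∈ add v l
  ∈-add v l with v ∈? l
  ... | yes v∈l = v∈l
  ... | no  _   = here refl

  ⊆-add : ∀ v {l z} → z ∈ l → z ∈ add v l
  ⊆-add v {l} z∈l with v ∈? l
  ... | yes _ = z∈l
  ... | no  _ = there z∈l

  move-distribution : ∀ {u w m x} → 0ℝ ≼ m → m ≼ x u → Distribution x → Distribution (move u w m x)
  move-distribution {u} {w} {m} {x} 0≼m m≼x X = record
    { nonneg  = move-nonneg 0≼m m≼x nonneg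
    ; support = l
    ; unique  = uniq
    ; off     = λ v∉l → move-zero 0≼m m≼x (off (λ v∈ → v∉l (⊆-add u (⊆-add w v∈))))
                  (λ { refl → contradiction (⊆-add u (∈-add w support)) v∉l })
    ; total   = ≃-trans (∑-move uniq (∈-add u (add w support)) (⊆-add u (∈-add w support)))
                  (∑≃1 X uniq (λ v∉l → off (λ v∈ → v∉l (⊆-add u (⊆-add w v∈)))))
    }
    where
    open Distribution X
    l : List V
    l = add u (add w support)
    uniq : Unique l
    uniq = add-unique u (add-unique w unique)

  CloseState : ℕ → Weights × ℝ → Weights × ℝ → Set
  CloseState k (x , s) (y , t) = (∀ v → Close k (x v) (y v)) × Close k s t

  closeState-weaken : ∀ {m n p q} → m ≤ n → CloseState n p q → CloseState m p q
  closeState-weaken m≤n (h , c) = (λ v → close-weaken m≤n (h v)) , close-weaken m≤n c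

  -- Uniform continuity in the sup distance. The modulus depends neither on the state nor, in `UCʷ`,
  -- on the vertex, so it survives arbitrary composition of moves.
  UC : (Weights × ℝ → ℝ) → Set
  UC F = ∀ k → ∃[ m ] (∀ {p q} → CloseState m p q → Close k (F p) (F q))

  UCʷ : (Weights × ℝ → Weights) → Set
  UCʷ G = ∀ k → ∃[ m ] (∀ {p q} → CloseState m p q → ∀ v → Close k (G p v) (G q v))

  uc-const : ∀ c → UC (λ _ → c)
  uc-const c k = 0 , λ _ → close-refl

  uc-time : UC proj₂
  uc-time k = k , proj₂

  uc-at : ∀ {G} → UCʷ G → ∀ v → UC (λ p → G p v)
  uc-at uc v k = let (m , h) = uc k in m , λ c → h c v

  uc-weights : UCʷ proj₁
  uc-weights k = k , proj₁

  uc-combine : ∀ {_∙_ : ℝ → ℝ → ℝ} (f : ℕ → ℕ) →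
    (∀ {k x x′ y y′} → Close (f k) x x′ → Close (f k) y y′ → Close k (x ∙ y) (x′ ∙ y′)) →
    ∀ {F G} → UC F → UC G → UC (λ p → F p ∙ G p)
  uc-combine f close uF uG k = let (m , h) = uF (f k) ; (n , h′) = uG (f k) in
    m ℕ.⊔ n , λ c → close (h (closeState-weaken (ℕ.m≤m⊔n m n) c)) (h′ (closeState-weaken (ℕ.m≤n⊔m m n) c))

  uc-- : ∀ {F G} → UC F → UC G → UC (λ p → F p - G p)
  uc-- = uc-combine double close--

  uc-⊓ : ∀ {F G} → UC F → UC G → UC (λ p → F p ⊓ G p)
  uc-⊓ = uc-combine (λ k → k) close-⊓

  uc-⊔ : ∀ {F G} → UC F → UC G → UC (λ p → F p ⊔ G p)
  uc-⊔ = uc-combine (λ k → k) close-⊔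

  uc-· : ∀ n {F} → UC F → UC (λ p → n · F p)
  uc-· n uF k = let (m , h) = close-· n k ; (m′ , h′) = uF m in m′ , λ c → h (h′ c)

  close-dirac : ∀ {k m m′} w → Close k m m′ → ∀ z → Close k (dirac w m z) (dirac w m′ z)
  close-dirac w c z with z ≟ w
  ... | yes _ = c
  ... | no  _ = close-refl

  opaque
    unfolding move

    uc-move : ∀ {F G} u w → UC F → UCʷ G → UCʷ (λ p → move u w (F p) (G p))
    uc-move u w uF uG k = let (m , h) = uF (double (double k)) ; (n , h′) = uG (double (double k)) in
      m ℕ.⊔ n , λ c z → let d = h (closeState-weaken (ℕ.m≤m⊔n m n) c) ; d′ = h′ (closeState-weaken (ℕ.m≤n⊔m m n) c) in
        close-- (close-+ (d′ z) (close-dirac w d z)) (close-weaken (double-≤ (double k)) (close-dirac u d z))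
      where
      double-≤ : ∀ n → n ≤ double n
      double-≤ n = ℕ.m≤n⇒m≤1+n (ℕ.m≤m+n n n)

  uc-compose : ∀ {F G} → UCʷ F → UCʷ G → UCʷ (λ p → F (G p , proj₂ p))
  uc-compose uF uG k = let (m , h) = uF k ; (n , h′) = uG m in
    m ℕ.⊔ n , λ c → h (h′ (closeState-weaken (ℕ.m≤n⊔m m n) c) , close-weaken (ℕ.m≤m⊔n m n) (proj₂ c))

-- Positive parts, minima and estimates for the thresholds

posPart : ℝ → ℝ
posPart x = x ⊔ 0ℝ

posPart-nonneg : ∀ x → 0ℝ ≼ posPart x
posPart-nonneg x = y≼x⊔y x 0ℝ

posPart-zero : ∀ {x y} → x ≼ y → posPart (x - y) ≃ 0ℝ
posPart-zero {x} {y} x≼y = ⊔-lub (x≼y+z⇒x-z≼y (≼-trans x≼y (≃⇒≽ (+-identityˡ y)))) ≼-refl ,≃ posPart-nonneg _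

≼posPart- : ∀ {x y z} → x + y ≼ z → x ≼ posPart (z - y)
≼posPart- p = ≼-trans (x+z≼y⇒x≼y-z p) (x≼x⊔y _ _)

⊓-nonneg : ∀ {x y} → 0ℝ ≼ x → 0ℝ ≼ y → 0ℝ ≼ x ⊓ y
⊓-nonneg = ⊓-glb

⊓-zeroˡ : ∀ {x y} → x ≃ 0ℝ → 0ℝ ≼ y → x ⊓ y ≃ 0ℝ
⊓-zeroˡ (p ,≃ q) 0≼y = ≼-trans (x⊓y≼x _ _) p ,≃ ⊓-glb q 0≼y

⊓-zeroʳ : ∀ {x y} → 0ℝ ≼ x → y ≃ 0ℝ → x ⊓ y ≃ 0ℝ
⊓-zeroʳ 0≼x (p ,≃ q) = ≼-trans (x⊓y≼y _ _) p ,≃ ⊓-glb 0≼x q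

x≃y⇒x-y≃0 : ∀ {x y} → x ≃ y → x - y ≃ 0ℝ
x≃y⇒x-y≃0 {x} {y} p = ≃-trans (+-cong p ≃-refl) (+-inverseʳ y)

≤-double : ∀ n → n ≤ double n
≤-double n = ℕ.m≤n⇒m≤1+n (ℕ.m≤m+n n n)

<-double : ∀ n → n < double n
<-double n = ℕ.s≤s (ℕ.m≤m+n n n)

double-mono : ∀ {m n} → m ≤ n → double m ≤ double n
double-mono m≤n = ℕ.s≤s (ℕ.+-mono-≤ m≤n m≤n)

opaque
  unfolding _·_

  ·-double : ∀ n k → n · ι (double k) + n · ι (double k) ≃ n · ι k
  ·-double zero    k = +-identityʳ 0ℝ
  ·-double (suc n) k = ≃-trans (solve 2 (λ a b → (a ⊕ b) ⊕ (a ⊕ b) ⊜ (a ⊕ a) ⊕ (b ⊕ b)) ≃-refl (ι (double k)) (n · ι (double k)))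
    (+-cong (ι-double k) (·-double n k))
    where open +-Solver

  -- n/(2n+2) + 1/2 < 1
  too-small : ∀ n → ¬ 1ℝ ≼ ι 1 + n · ι (double n)
  too-small n p = ι-positive n (+-cancelˡ-≼ (1ℝ + 1ℝ) (begin
    (1ℝ + 1ℝ) + ι n                  ≈⟨ +-cong ≃-refl (ι-double n) ⟨
    (1ℝ + 1ℝ) + (e + e)                    ≤⟨ +-monoˡ (e + e) (+-mono p p) ⟩
    ((h + m) + (h + m)) + (e + e)          ≈⟨ solve 3 (λ h m e → ((h ⊕ m) ⊕ (h ⊕ m)) ⊕ (e ⊕ e) ⊜ (h ⊕ h) ⊕ ((e ⊕ m) ⊕ (e ⊕ m))) ≃-refl h m e ⟩
    (h + h) + ((e + m) + (e + m))          ≈⟨ +-cong (ι-double 0) (≃-trans (·-double (suc n) n) (·-inv n)) ⟩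
    ι 0 + 1ℝ                         ≤⟨ +-monoˡ 1ℝ (ι≼1 0) ⟩
    1ℝ + 1ℝ                                ≈⟨ +-identityʳ _ ⟨
    (1ℝ + 1ℝ) + 0ℝ                         ∎))
    where
    open ≼-Reasoning
    open +-Solver
    h m e : ℝ
    h = ι 1
    m = n · ι (double n)
    e = ι (double n)

-- Pushing vertices down

-- The combinatorial input. Ranks embed the vertices into ℕ with possible gaps, hence the partial
-- `unrank`; `nbrs` expresses local finiteness. In `W-dominates` the dominating vertex may vary with
-- the clique, and `W-clique` compensates for this.
record Elimination {V : Set} (d : V → V → ℕ) (r : ℕ) : Set where
  field
    _≟_         : DecidableEquality V
    nbrs        : V → List V
    ∈-nbrs      : ∀ {u v} → d u v ≤ r → u ∈ nbrs v
    rank        : V → ℕ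
    unrank      : ℕ → Maybe V
    unrank-rank : ∀ v → unrank (rank v) ≡ just v
    rank-unrank : ∀ {j v} → unrank j ≡ just v → rank v ≡ j
    base        : V
    rank-base   : rank base ≡ 0
    W           : V → List V
    W-rank      : ∀ {v w} → w ∈ W v → rank w < rank v
    W-near      : ∀ {v w} → w ∈ W v → d w v ≤ r
    W-clique    : ∀ {v w w′} → w ∈ W v → w′ ∈ W v → d w w′ ≤ r
    W-dominates : ∀ {v} (τ : List V) → rank v ≢ 0 →
                  (∀ {u u′} → u ∈ τ → u′ ∈ τ → d u u′ ≤ r) →
                  (∀ {u} → u ∈ τ → rank u < rank v × d u v ≤ r) →
                  ∃[ w ] w ∈ W v × (∀ {u} → u ∈ τ → d u w ≤ r)

module Push {V : Set} {d : V → V → ℕ} (isMetric : IsMetric _≡_ d) (r : ℕ) (E : Elimination d r) where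

  open Elimination E
  open SimplicialComplex (VR isMetric r) using (Simplex)
  open Sums {V}
  open Moves _≟_
  open import Data.List.Membership.DecPropositional _≟_ using (_∈?_)
  open import Data.List.Relation.Unary.Unique.DecPropositional.Properties _≟_ using (deduplicate-!)

  d-sym : ∀ {u v} → d u v ≤ r → d v u ≤ r
  d-sym {u} {v} = subst (_≤ r) (IsMetric.sym isMetric u v)

  d-refl : ∀ v → d v v ≤ r
  d-refl v = ℕ.≤-trans (ℕ.≤-reflexive (IsMetric.≈⇒0 isMetric refl)) ℕ.z≤n

  rank-injective : ∀ {u v} → rank u ≡ rank v → u ≡ v
  rank-injective {u} {v} eq with trans (sym (unrank-rank u)) (trans (cong unrank eq) (unrank-rank v))
  ... | refl = refl

  Target : Set
  Target = V × (Weights × ℝ → ℝ)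

  module At (v : V) (cap₁ cap₂ : ℝ → ℝ) (cap₁-nonneg : ∀ t → 0ℝ ≼ cap₁ t) (cap₂-nonneg : ∀ t → 0ℝ ≼ cap₂ t) where

    N : List V
    N = deduplicate _≟_ (filter (λ u → ¬? (u ≟ v)) (nbrs v))

    N-unique : Unique N
    N-unique = deduplicate-! (filter (λ u → ¬? (u ≟ v)) (nbrs v))

    ∈N : ∀ {u} → u ≢ v → d u v ≤ r → u ∈ N
    ∈N u≢v near = ∈-deduplicate⁺ _≟_ (∈-filter⁺ (λ u → ¬? (u ≟ v)) (∈-nbrs near) u≢v)

    N≢v : ∀ {u} → u ∈ N → u ≢ v
    N≢v u∈N = proj₂ (∈-filter⁻ (λ u → ¬? (u ≟ v)) {xs = nbrs v} (∈-deduplicate⁻ _≟_ _ u∈N))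

    W≢v : ∀ {w} → w ∈ W v → w ≢ v
    W≢v w∈W refl = ℕ.<-irrefl refl (W-rank w∈W)

    -- With m neighbours, `ι J`, `ι L`, `c` and `h` are 1/(2m+2), 1/(4m+4), 1/(16m+16) and
    -- 1/(32m+32). If v carries at most one half, some neighbour has weight at least `ι L`, which
    -- leaves room above the threshold `c`; the constants 7 and 15 below stand for 1/8 and 1/16.
    J L K : ℕ
    J = double (length N)
    L = double J
    K = double (double L)

    c h : ℝ
    c = ι K
    h = ι (double K)

    -- The factor `x v` stops the gathering where v is absent, so that the step is the identity
    -- there; `cap₁` switches the gathering on in time.
    θ : Weights × ℝ → ℝ
    θ (x , t) = x v ⊓ (c ⊓ cap₁ t)

    gather : ℝ → List V → Weights → Weights
    gather e []      x = x
    gather e (u ∷ l) x = gather e l (move u v (x u ⊓ e) x)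

    -- Positive only if every vertex not adjacent to w has weight below h.
    clear : V → List V → Weights → ℝ
    clear w []      x = 1ℝ
    clear w (u ∷ l) x with d u w ℕ.≤? r
    ... | yes _ = clear w l x
    ... | no  _ = posPart (h - x u) ⊓ clear w l x

    -- Unnormalized partition functions. `φ w` is positive only if v weighs more than 1/8 and no
    -- heavy neighbour obstructs w, `ψ u` only if u itself is above the threshold. At a simplex with
    -- v on top, one of them is at least `h` (see `full-target`), and the factor in `amount` is
    -- 1/`h`.
    φ ψ : V → Weights → ℝ
    φ w x = posPart (x v - ι 7) ⊓ clear w N x
    ψ u x = posPart (x u - c)

    amount : (Weights → ℝ) → Weights × ℝ → ℝ
    amount f (x , t) = cap₂ t ⊓ suc (double K) · f x

    targets : List Target
    targets = map (λ w → w , amount (φ w)) (W v) ++ map (λ u → u , amount (ψ u)) N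

    -- The amounts are read off the state `p` before gathering, whereas the weight taken is whatever
    -- is still left at v; no normalization by division is required.
    spread : List Target → Weights × ℝ → Weights → Weights
    spread []            p y = y
    spread ((w , f) ∷ l) p y = spread l p (move v w (y v ⊓ f p) y)

    opaque
      step : Weights × ℝ → Weights
      step p = spread targets p (gather (θ p) N (proj₁ p))

    clear-nonneg : ∀ w l x → 0ℝ ≼ clear w l x
    clear-nonneg w []      x = ≼-trans (ι-nonneg 0) (ι≼1 0)
    clear-nonneg w (u ∷ l) x with d u w ℕ.≤? r
    ... | yes _ = clear-nonneg w l x
    ... | no  _ = ⊓-nonneg (posPart-nonneg _) (clear-nonneg w l x)

    φ-nonneg : ∀ w x → 0ℝ ≼ φ w x
    φ-nonneg w x = ⊓-nonneg (posPart-nonneg _) (clear-nonneg w N x)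

    amount-nonneg : ∀ f → (∀ x → 0ℝ ≼ f x) → ∀ p → 0ℝ ≼ amount f p
    amount-nonneg f 0≼f (x , t) = ⊓-nonneg (cap₂-nonneg t) (·-nonneg (suc (double K)) (0≼f x))

    amount-zero : ∀ f → (∀ x → 0ℝ ≼ f x) → ∀ {x t} → f x ≃ 0ℝ → amount f (x , t) ≃ 0ℝ
    amount-zero f 0≼f {x} {t} p = ⊓-zeroʳ (cap₂-nonneg t) (·-zero (suc (double K)) p)

    targets-case : ∀ {w f} (P : Target → Set) → (∀ {w} → w ∈ W v → P (w , amount (φ w))) →
                   (∀ {u} → u ∈ N → P (u , amount (ψ u))) → (w , f) ∈ targets → P (w , f)
    targets-case P pW pN m with ∈-++⁻ (map (λ w → w , amount (φ w)) (W v)) m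
    ... | inj₁ m₁ with ∈-map⁻ (λ w → w , amount (φ w)) m₁
    ...   | w , w∈W , refl = pW w∈W
    targets-case P pW pN m | inj₂ m₂ with ∈-map⁻ (λ u → u , amount (ψ u)) m₂
    ...   | u , u∈N , refl = pN u∈N

    target-nonneg : ∀ {w f} → (w , f) ∈ targets → ∀ p → 0ℝ ≼ f p
    target-nonneg = targets-case (λ (w , f) → ∀ p → 0ℝ ≼ f p)
      (λ {w} _ → amount-nonneg (φ w) (φ-nonneg w)) (λ {u} _ → amount-nonneg (ψ u) (λ _ → posPart-nonneg _))

    target≢v : ∀ {w f} → (w , f) ∈ targets → w ≢ v
    target≢v = targets-case (λ (w , f) → w ≢ v) W≢v N≢v

    θ-nonneg : ∀ {x t} → 0ℝ ≼ x v → 0ℝ ≼ θ (x , t)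
    θ-nonneg {x} {t} 0≼x = ⊓-nonneg 0≼x (⊓-nonneg (ι-nonneg K) (cap₁-nonneg t))

    gather-distribution : ∀ {e} → 0ℝ ≼ e → ∀ l {x} → Distribution x → Distribution (gather e l x)
    gather-distribution 0≼e []      X = X
    gather-distribution 0≼e (u ∷ l) X = gather-distribution 0≼e l
      (move-distribution (⊓-nonneg (Distribution.nonneg X u) 0≼e) (x⊓y≼x _ _) X)

    gather-trivial : ∀ {e} → e ≃ 0ℝ → ∀ l {x} → (∀ z → 0ℝ ≼ x z) → ∀ z → gather e l x z ≃ x z
    gather-trivial e≃0 []      0≼x z = ≃-refl
    gather-trivial e≃0 (u ∷ l) {x} 0≼x z = ≃-trans
      (gather-trivial e≃0 l (move-nonneg (⊓-nonneg (0≼x u) (≃⇒≽ e≃0)) (x⊓y≼x _ _) 0≼x) z)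
      (move-trivial (⊓-zeroʳ (0≼x u) e≃0) z)

    gather-zero : ∀ {e} → 0ℝ ≼ e → ∀ l {x z} → (∀ z → 0ℝ ≼ x z) → z ≢ v → x z ≃ 0ℝ → gather e l x z ≃ 0ℝ
    gather-zero 0≼e []      0≼x z≢v x≃0 = x≃0
    gather-zero 0≼e (u ∷ l) 0≼x z≢v x≃0 =
      gather-zero 0≼e l (move-nonneg 0≼m (x⊓y≼x _ _) 0≼x) z≢v
        (move-zero 0≼m (x⊓y≼x _ _) x≃0 (λ z≡v → contradiction z≡v z≢v))
      where 0≼m = ⊓-nonneg (0≼x u) 0≼e

    -- When the turn of z comes, its whole weight is at most e and leaves. Later moves only feed v,
    -- so z stays empty.
    gather-kills : ∀ {e} → 0ℝ ≼ e → ∀ {l x z} → (∀ z → 0ℝ ≼ x z) → z ≢ v → z ∈ l → x z ≼ e → gather e l x z ≃ 0ℝ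
    gather-kills {e} 0≼e {u ∷ l} {x} {z} 0≼x z≢v z∈ x≼e with z ≟ u
    ... | yes refl = gather-zero 0≼e l (move-nonneg (⊓-nonneg (0≼x z) 0≼e) (x⊓y≼x _ _) 0≼x) z≢v
      (≃-trans (move-source z≢v) (x≃y⇒x-y≃0 (⊓-glb ≼-refl x≼e ,≃ x⊓y≼x _ _)))
    ... | no z≢u with z∈
    ...   | here z≡u  = contradiction z≡u z≢u
    ...   | there z∈l = gather-kills 0≼e (move-nonneg (⊓-nonneg (0≼x u) 0≼e) (x⊓y≼x _ _) 0≼x) z≢v z∈l
      (≼-trans (≃⇒≼ (move-other z≢u z≢v)) x≼e)

    Nonneg : List Target → Weights × ℝ → Set
    Nonneg l p = ∀ {w f} → (w , f) ∈ l → 0ℝ ≼ f p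

    spread-distribution : ∀ l {p y} → Nonneg l p → Distribution y → Distribution (spread l p y)
    spread-distribution []            0≼f Y = Y
    spread-distribution ((w , f) ∷ l) 0≼f Y = spread-distribution l (λ m → 0≼f (there m))
      (move-distribution (⊓-nonneg (Distribution.nonneg Y v) (0≼f (here refl))) (x⊓y≼x _ _) Y)

    spread-trivial : ∀ l {p y} → Nonneg l p → (∀ z → 0ℝ ≼ y z) →
                     y v ≃ 0ℝ ⊎ (∀ {w f} → (w , f) ∈ l → f p ≃ 0ℝ) → ∀ z → spread l p y z ≃ y z
    spread-trivial []            0≼f 0≼y triv z = ≃-refl
    spread-trivial ((w , f) ∷ l) {p} {y} 0≼f 0≼y triv z = ≃-trans
      (spread-trivial l (λ m → 0≼f (there m)) (move-nonneg (⊓-nonneg (0≼y v) (0≼f (here refl))) (x⊓y≼x _ _) 0≼y) (next triv) z)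
      (move-trivial (m≃0 triv) z)
      where
      m≃0 : y v ≃ 0ℝ ⊎ (∀ {w′ f′} → (w′ , f′) ∈ (w , f) ∷ l → f′ p ≃ 0ℝ) → y v ⊓ f p ≃ 0ℝ
      m≃0 (inj₁ y≃0) = ⊓-zeroˡ y≃0 (0≼f (here refl))
      m≃0 (inj₂ f≃0) = ⊓-zeroʳ (0≼y v) (f≃0 (here refl))
      next : y v ≃ 0ℝ ⊎ (∀ {w′ f′} → (w′ , f′) ∈ (w , f) ∷ l → f′ p ≃ 0ℝ) →
             move v w (y v ⊓ f p) y v ≃ 0ℝ ⊎ (∀ {w′ f′} → (w′ , f′) ∈ l → f′ p ≃ 0ℝ)
      next (inj₁ y≃0) = inj₁ (≃-trans (move-trivial (m≃0 (inj₁ y≃0)) v) y≃0)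
      next (inj₂ f≃0) = inj₂ (λ m → f≃0 (there m))

    spread-off : ∀ l {p y ρ} → Nonneg l p → (∀ z → 0ℝ ≼ y z) → Off ρ y →
                 (∀ {w f} → (w , f) ∈ l → w ∈ ρ ⊎ f p ≃ 0ℝ) → Off ρ (spread l p y)
    spread-off []            0≼f 0≼y off ok = off
    spread-off ((w , f) ∷ l) {p} {y} {ρ} 0≼f 0≼y off ok = spread-off l (λ m → 0≼f (there m)) (move-nonneg 0≼m (x⊓y≼x _ _) 0≼y)
      (λ {z} z∉ρ → move-zero 0≼m (x⊓y≼x _ _) (off z∉ρ) (λ { refl → m≃0 z∉ρ (ok (here refl)) }))
      (λ m → ok (there m))
      where
      0≼m = ⊓-nonneg (0≼y v) (0≼f (here refl))
      m≃0 : w ∉ ρ → w ∈ ρ ⊎ f p ≃ 0ℝ → y v ⊓ f p ≃ 0ℝ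
      m≃0 w∉ (inj₁ w∈)  = contradiction w∈ w∉
      m≃0 w∉ (inj₂ f≃0) = ⊓-zeroʳ (0≼y v) f≃0

    -- A single amount of at least 1 exceeds any weight that v can have. Earlier targets only reduce
    -- the weight of v, later ones find nothing to take.
    spread-empties : ∀ {l p y w f} → Nonneg l p → (∀ {w f} → (w , f) ∈ l → w ≢ v) → Distribution y →
                     (w , f) ∈ l → 1ℝ ≼ f p → spread l p y v ≃ 0ℝ
    spread-empties {(w , f) ∷ l} {p} {y} 0≼f l≢v Y (here refl) 1≼f = ≃-trans
      (spread-trivial l (λ m → 0≼f (there m)) (move-nonneg (⊓-nonneg (nonneg v) (0≼f (here refl))) (x⊓y≼x _ _) nonneg) (inj₁ empty) v) empty
      where
      open Distribution Y
      empty : move v w (y v ⊓ f p) y v ≃ 0ℝ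
      empty = ≃-trans (move-source (λ v≡w → l≢v (here refl) (sym v≡w)))
        (x≃y⇒x-y≃0 (⊓-glb ≼-refl (≼-trans (x≼1 Y v) 1≼f) ,≃ x⊓y≼x _ _))
    spread-empties {(w , f) ∷ l} 0≼f l≢v Y (there m) 1≼f = spread-empties (λ m → 0≼f (there m)) (λ m → l≢v (there m))
      (move-distribution (⊓-nonneg (Distribution.nonneg Y v) (0≼f (here refl))) (x⊓y≼x _ _) Y) m 1≼f

    opaque
      unfolding step

      step-distribution : ∀ {x t} → Distribution x → Distribution (step (x , t))
      step-distribution {x} {t} X = spread-distribution targets (λ m → target-nonneg m (x , t))
        (gather-distribution (θ-nonneg {x} {t} (Distribution.nonneg X v)) N X)

      step-trivial : ∀ {x t} → Distribution x → θ (x , t) ≃ 0ℝ →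
                     x v ≃ 0ℝ ⊎ cap₂ t ≃ 0ℝ → ∀ z → step (x , t) z ≃ x z
      step-trivial {x} {t} X θ≃0 triv z = ≃-trans
        (spread-trivial targets (λ m → target-nonneg m (x , t)) (Distribution.nonneg (gather-distribution (≃⇒≽ θ≃0) N X)) (why triv) z)
        (gathered z)
        where
        open Distribution X
        gathered : ∀ z → gather (θ (x , t)) N x z ≃ x z
        gathered = gather-trivial θ≃0 N nonneg
        why : x v ≃ 0ℝ ⊎ cap₂ t ≃ 0ℝ → gather (θ (x , t)) N x v ≃ 0ℝ ⊎ (∀ {w f} → (w , f) ∈ targets → f (x , t) ≃ 0ℝ)
        why (inj₁ x≃0)   = inj₁ (≃-trans (gathered v) x≃0)
        why (inj₂ cap≃0) = inj₂ (targets-case (λ (w , f) → f (x , t) ≃ 0ℝ)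
          (λ {w} _ → ⊓-zeroˡ cap≃0 (·-nonneg (suc (double K)) (φ-nonneg w x)))
          (λ {u} _ → ⊓-zeroˡ cap≃0 (·-nonneg (suc (double K)) (posPart-nonneg (x u - c)))))

    step-absent : ∀ {x t} → Distribution x → x v ≃ 0ℝ → ∀ z → step (x , t) z ≃ x z
    step-absent {x} {t} X x≃0 = step-trivial X (⊓-zeroˡ x≃0 (⊓-nonneg (ι-nonneg K) (cap₁-nonneg t))) (inj₁ x≃0)

    step-idle : ∀ {x t} → Distribution x → cap₁ t ≃ 0ℝ → cap₂ t ≃ 0ℝ → ∀ z → step (x , t) z ≃ x z
    step-idle {x} {t} X cap₁≃0 cap₂≃0 =
      step-trivial X (⊓-zeroʳ (Distribution.nonneg X v) (⊓-zeroʳ (ι-nonneg K) cap₁≃0)) (inj₂ cap₂≃0)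

    module OnSimplex {x : Weights} (t : ℝ) (X : Distribution x) {σ : List V} (simplex : Simplex σ) (off : Off σ x)
             (v∈σ : v ∈ σ) (rank≤ : ∀ {u} → u ∈ σ → rank u ≤ rank v) where
      open Distribution X using (nonneg)

      0≼θ : 0ℝ ≼ θ (x , t)
      0≼θ = θ-nonneg {x} {t} (nonneg v)

      near : ∀ {u} → u ∈ σ → d u v ≤ r
      near u∈σ = simplex u∈σ v∈σ

      y : Weights
      y = gather (θ (x , t)) N x

      Y : Distribution y
      Y = gather-distribution 0≼θ N X

      y-off : Off σ y
      y-off z∉σ = gather-zero 0≼θ N nonneg (λ { refl → z∉σ v∈σ }) (off z∉σ)

      ψ-zero : ∀ {u} → x u ≼ c → amount (ψ u) (x , t) ≃ 0ℝ
      ψ-zero {u} x≼c = amount-zero (ψ u) (λ _ → posPart-nonneg _) {x} {t} (posPart-zero x≼c)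

      ψ-off : ∀ {u} → u ∉ σ → amount (ψ u) (x , t) ≃ 0ℝ
      ψ-off u∉σ = ψ-zero (≼-trans (≃⇒≼ (off u∉σ)) (ι-nonneg K))

      opaque
        unfolding step

        spread-from : ∀ {ρ} → Off ρ y → (∀ {w f} → (w , f) ∈ targets → w ∈ ρ ⊎ f (x , t) ≃ 0ℝ) → Off ρ (step (x , t))
        spread-from = spread-off targets (λ m → target-nonneg m (x , t)) (Distribution.nonneg Y)

        step-empties : ∀ {w f} → (w , f) ∈ targets → 1ℝ ≼ f (x , t) → step (x , t) v ≃ 0ℝ
        step-empties = spread-empties (λ m → target-nonneg m (x , t)) target≢v Y

      stage₁ : cap₂ t ≃ 0ℝ → Off σ (step (x , t))
      stage₁ cap≃0 = spread-from y-off (targets-case (λ (w , f) → w ∈ σ ⊎ f (x , t) ≃ 0ℝ)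
        (λ {w} _ → inj₂ (⊓-zeroˡ cap≃0 (·-nonneg (suc (double K)) (φ-nonneg w x))))
        (λ {u} _ → inj₂ (⊓-zeroˡ cap≃0 (·-nonneg (suc (double K)) (posPart-nonneg (x u - c))))))

      -- Stands in for the undecidable selection of the members with weight at least `c`: those kept
      -- certainly weigh at least `h`, those dropped at most `c`.
      keep : ∀ l → ∃[ l′ ] (∀ {u} → u ∈ l′ → u ∈ l × h ≼ x u) × (∀ {u} → u ∈ l → u ∈ l′ ⊎ x u ≼ c)
      keep []      = [] , (λ ()) , (λ ())
      keep (a ∷ l) with keep l | split-ι (<-double K) (x a)
      ... | l′ , sub , cov | inj₁ small = l′ , (λ u∈ → there (proj₁ (sub u∈)) , proj₂ (sub u∈)) ,
        λ { (here refl) → inj₂ small ; (there u∈) → cov u∈ }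
      ... | l′ , sub , cov | inj₂ large = a ∷ l′ ,
        (λ { (here refl) → here refl , large ; (there u∈) → there (proj₁ (sub u∈)) , proj₂ (sub u∈) }) ,
        λ { (here refl) → inj₁ (here refl) ; (there u∈) → [ inj₁ ∘ there , inj₂ ]′ (cov u∈) }

      clear-zero : ∀ {w u} l → u ∈ l → ¬ d u w ≤ r → h ≼ x u → clear w l x ≃ 0ℝ
      clear-zero {w} {u} (a ∷ l) (here refl) far large with d u w ℕ.≤? r
      ... | yes close = contradiction close far
      ... | no  _     = ⊓-zeroˡ (posPart-zero large) (clear-nonneg w l x)
      clear-zero {w} (a ∷ l) (there u∈l) far large with d a w ℕ.≤? r
      ... | yes _ = clear-zero l u∈l far large
      ... | no  _ = ⊓-zeroʳ (posPart-nonneg _) (clear-zero l u∈l far large)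

      Stage : Set
      Stage = ∃[ ρ ] Simplex ρ × (∀ {u} → u ∈ ρ → rank u ≤ rank v) × Off ρ (step (x , t))

      -- With v this light all `φ` vanish, and `ψ` vanishes outside σ, so weight only circulates
      -- within σ.
      small-case : x v ≼ ι 7 → Stage
      small-case s≼ = σ , simplex , rank≤ , spread-from y-off (targets-case (λ (w , f) → w ∈ σ ⊎ f (x , t) ≃ 0ℝ)
        (λ {w} _ → inj₂ (amount-zero (φ w) (φ-nonneg w) {x} {t} (⊓-zeroˡ (posPart-zero s≼) (clear-nonneg w N x))))
        N-case)
        where
        N-case : ∀ {u} → u ∈ N → u ∈ σ ⊎ amount (ψ u) (x , t) ≃ 0ℝ
        N-case {u} _ with u ∈? σ
        ... | yes u∈σ = inj₁ u∈σ
        ... | no  u∉σ = inj₂ (ψ-off u∉σ)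

      -- Now `θ` reaches `c`, so the members of σ dropped by `keep` have been emptied. A vertex of
      -- `W v` that misses some kept vertex meets a weight of at least `h` there and gets nothing.
      -- What remains is v, the kept vertices and the elements of `W v` adjacent to all of them.
      large-case : 1ℝ ≼ cap₁ t → ι 15 ≼ x v → Stage
      large-case 1≼cap ≼s = ρ , ρ-simplex , ρ-rank , spread-from y-offρ (targets-case (λ (w , f) → w ∈ ρ ⊎ f (x , t) ≃ 0ℝ) W-case N-case)
        where
        σ′ : List V
        σ′ = proj₁ (keep σ)
        σ′⊆ : ∀ {u} → u ∈ σ′ → u ∈ σ × h ≼ x u
        σ′⊆ = proj₁ (proj₂ (keep σ))
        covers : ∀ {u} → u ∈ σ → u ∈ σ′ ⊎ x u ≼ c
        covers = proj₂ (proj₂ (keep σ))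
        good? = λ w → All.all? (λ u → d u w ℕ.≤? r) σ′
        G ρ : List V
        G = filter good? (W v)
        ρ = v ∷ σ′ ++ G
        data Kind (u : V) : Set where
          top  : u ≡ v → Kind u
          kept : u ∈ σ′ → Kind u
          new  : u ∈ W v → All (λ z → d z u ≤ r) σ′ → Kind u
        kind : ∀ {u} → u ∈ ρ → Kind u
        kind (here u≡v) = top u≡v
        kind (there u∈) with ∈-++⁻ σ′ u∈
        ... | inj₁ u∈σ′ = kept u∈σ′
        ... | inj₂ u∈G  = let (u∈W , good) = ∈-filter⁻ good? {xs = W v} u∈G in new u∈W good
        ρ-simplex : Simplex ρ
        ρ-simplex a∈ b∈ = adj (kind a∈) (kind b∈)
          where
          adj : ∀ {a b} → Kind a → Kind b → d a b ≤ r
          adj (top refl)  (top refl)  = d-refl v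
          adj (top refl)  (kept b∈)   = d-sym (near (proj₁ (σ′⊆ b∈)))
          adj (top refl)  (new b∈ _)  = d-sym (W-near b∈)
          adj (kept a∈)   (top refl)  = near (proj₁ (σ′⊆ a∈))
          adj (kept a∈)   (kept b∈)   = simplex (proj₁ (σ′⊆ a∈)) (proj₁ (σ′⊆ b∈))
          adj (kept a∈)   (new _ g)   = All.lookup g a∈
          adj (new a∈ _)  (top refl)  = W-near a∈
          adj (new _ g)   (kept b∈)   = d-sym (All.lookup g b∈)
          adj (new a∈ _)  (new b∈ _)  = W-clique a∈ b∈
        ρ-rank : ∀ {u} → u ∈ ρ → rank u ≤ rank v
        ρ-rank u∈ with kind u∈
        ... | top refl  = ℕ.≤-refl
        ... | kept u∈σ′ = rank≤ (proj₁ (σ′⊆ u∈σ′))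
        ... | new u∈W _ = ℕ.<⇒≤ (W-rank u∈W)
        c≼θ : c ≼ θ (x , t)
        c≼θ = ⊓-glb (≼-trans (ι-anti 15≤K) ≼s) (⊓-glb ≼-refl (≼-trans (ι≼1 K) 1≼cap))
          where
          15≤K : 15 ≤ K
          15≤K = double-mono {7} (double-mono {3} (double-mono {1} (double-mono {0} (ℕ.z≤n {length N}))))
        y-offρ : Off ρ y
        y-offρ {z} z∉ρ with z ∈? σ
        ... | no  z∉σ = y-off z∉σ
        ... | yes z∈σ with covers z∈σ
        ...   | inj₁ z∈σ′ = contradiction (there (∈-++⁺ˡ z∈σ′)) z∉ρ
        ...   | inj₂ small = gather-kills 0≼θ nonneg z≢v (∈N z≢v (near z∈σ)) (≼-trans small c≼θ)
          where
          z≢v : z ≢ v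
          z≢v refl = z∉ρ (here refl)
        W-case : ∀ {w} → w ∈ W v → w ∈ ρ ⊎ amount (φ w) (x , t) ≃ 0ℝ
        W-case {w} w∈W with good? w
        ... | yes good = inj₁ (there (∈-++⁺ʳ σ′ (∈-filter⁺ good? w∈W good)))
        ... | no  bad with find (All.¬All⇒Any¬ (λ u → d u w ℕ.≤? r) σ′ bad)
        ...   | u , u∈σ′ , far = inj₂ (amount-zero (φ w) (φ-nonneg w) {x} {t}
                  (⊓-zeroʳ (posPart-nonneg _) (clear-zero N (∈N u≢v (near (proj₁ (σ′⊆ u∈σ′)))) far (proj₂ (σ′⊆ u∈σ′)))))
          where
          u≢v : u ≢ v
          u≢v refl = far (d-sym (W-near w∈W))
        N-case : ∀ {u} → u ∈ N → u ∈ ρ ⊎ amount (ψ u) (x , t) ≃ 0ℝ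
        N-case {u} _ with u ∈? σ
        ... | no  u∉σ = inj₂ (ψ-off u∉σ)
        ... | yes u∈σ with covers u∈σ
        ...   | inj₁ u∈σ′  = inj₁ (there (∈-++⁺ˡ u∈σ′))
        ...   | inj₂ small = inj₂ (ψ-zero small)

      stage₂ : 1ℝ ≼ cap₁ t → Stage
      -- Either alternative may be taken for weights between 1/16 and 1/8, since both arguments are
      -- valid there.
      stage₂ 1≼cap with split-ι {7} {15} (ℕ.m≤m+n 8 7) (x v)
      ... | inj₁ small = small-case small
      ... | inj₂ large = large-case 1≼cap large

      amount-full : ∀ f → 1ℝ ≼ cap₂ t → h ≼ f x → 1ℝ ≼ amount f (x , t)
      amount-full f 1≼cap h≼f = ⊓-glb 1≼cap (ι≼⇒1≼ (double K) h≼f)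

      h≼c : h ≼ c
      h≼c = ι-anti (≤-double K)

      clear-large : ∀ {w} l → (∀ {u} → u ∈ l → ¬ d u w ≤ r → x u ≃ 0ℝ) → h ≼ clear w l x
      clear-large {w} []      vanish = ι≼1 (double K)
      clear-large {w} (u ∷ l) vanish with d u w ℕ.≤? r
      ... | yes _   = clear-large l (λ m → vanish (there m))
      ... | no  far = ⊓-glb (≼posPart- (≼-trans (+-monoʳ h (≃⇒≼ (vanish (here refl) far))) (≃⇒≼ (+-identityʳ h))))
        (clear-large l (λ m → vanish (there m)))

      -- If v weighs at least 1/4, a vertex dominating the rest of σ has nothing to obstruct it and
      -- `φ` is at least `h`. If v weighs at most 1/2, the neighbours share the rest, one of them
      -- has at least `ι L`, and `2c` is below that, so its `ψ` is at least `c`.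
      full-target : rank v ≢ 0 → 1ℝ ≼ cap₂ t → ∃[ w ] ∃[ f ] (w , f) ∈ targets × 1ℝ ≼ f (x , t)
      full-target rank≢0 1≼cap with split-ι {1} {3} (ℕ.m≤m+n 2 1) (x v)
      ... | inj₂ large with W-dominates τ rank≢0 τ-clique τ-below
        where
        τ : List V
        τ = filter (λ u → ¬? (u ≟ v)) σ
        τ⊆ : ∀ {u} → u ∈ τ → u ∈ σ × u ≢ v
        τ⊆ = ∈-filter⁻ (λ u → ¬? (u ≟ v)) {xs = σ}
        τ-clique : ∀ {u u′} → u ∈ τ → u′ ∈ τ → d u u′ ≤ r
        τ-clique u∈ u′∈ = simplex (proj₁ (τ⊆ u∈)) (proj₁ (τ⊆ u′∈))
        τ-below : ∀ {u} → u ∈ τ → rank u < rank v × d u v ≤ r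
        τ-below u∈ = ℕ.≤∧≢⇒< (rank≤ (proj₁ (τ⊆ u∈))) (λ eq → proj₂ (τ⊆ u∈) (rank-injective eq)) , near (proj₁ (τ⊆ u∈))
      ...   | w , w∈W , dom = w , amount (φ w) , ∈-++⁺ˡ (∈-map⁺ (λ w → w , amount (φ w)) w∈W) ,
        amount-full (φ w) 1≼cap (⊓-glb
          (≼posPart- (≼-trans (+-monoˡ (ι 7) (ι-anti 7≤2K)) (≼-trans (≃⇒≼ (ι-double 3)) large)))
          (clear-large N vanish))
        where
        7≤2K : 7 ≤ double K
        7≤2K = ℕ.≤-trans (double-mono {3} (double-mono {1} (double-mono {0} (ℕ.z≤n {J})))) (≤-double K)
        vanish : ∀ {u} → u ∈ N → ¬ d u w ≤ r → x u ≃ 0ℝ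
        vanish u∈N far = off λ u∈σ → far (dom (∈-filter⁺ (λ u → ¬? (u ≟ v)) u∈σ (N≢v u∈N)))
      full-target rank≢0 1≼cap | inj₁ small with some-large _≟_ (<-double J) N x
      ... | inj₁ smalls = contradiction (≼-trans (≃⇒≽ sum≃1) (+-mono small smalls)) (too-small (length N))
        where
        sum≃1 : ∑ (v ∷ N) x ≃ 1ℝ
        sum≃1 = ∑≃1 X (All.¬Any⇒All¬ N (λ v∈N → N≢v v∈N refl) ∷ N-unique) off′
          where
          off′ : Off (v ∷ N) x
          off′ {z} z∉ = off λ z∈σ → z∉ (there (∈N (λ { refl → z∉ (here refl) }) (near z∈σ)))
      ... | inj₂ (u , u∈N , large) = u , amount (ψ u) , ∈-++⁺ʳ (map (λ w → w , amount (φ w)) (W v)) (∈-map⁺ (λ u → u , amount (ψ u)) u∈N) ,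
        amount-full (ψ u) 1≼cap (≼-trans h≼c (≼posPart-
          (≼-trans (≃⇒≼ (ι-double (double L))) (≼-trans (ι-anti (≤-double L)) large))))

      done : rank v ≢ 0 → 1ℝ ≼ cap₁ t → 1ℝ ≼ cap₂ t →
             ∃[ ρ ] Simplex ρ × (∀ {u} → u ∈ ρ → rank u < rank v) × Off ρ (step (x , t))
      done rank≢0 1≼cap₁ 1≼cap₂ with stage₂ 1≼cap₁ | full-target rank≢0 1≼cap₂
      ... | ρ , ρ-simplex , ρ-rank , ρ-off | w , f , m , 1≼f =
        filter (λ u → ¬? (u ≟ v)) ρ ,
        (λ a∈ b∈ → ρ-simplex (proj₁ (⊆ρ a∈)) (proj₁ (⊆ρ b∈))) ,
        (λ u∈ → ℕ.≤∧≢⇒< (ρ-rank (proj₁ (⊆ρ u∈))) (λ eq → proj₂ (⊆ρ u∈) (rank-injective eq))) ,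
        off′
        where
        ⊆ρ : ∀ {u} → u ∈ filter (λ u → ¬? (u ≟ v)) ρ → u ∈ ρ × u ≢ v
        ⊆ρ = ∈-filter⁻ (λ u → ¬? (u ≟ v)) {xs = ρ}
        off′ : Off (filter (λ u → ¬? (u ≟ v)) ρ) (step (x , t))
        off′ {z} z∉ with z ≟ v
        ... | yes refl = step-empties m 1≼f
        ... | no z≢v   = ρ-off (λ z∈ρ → z∉ (∈-filter⁺ (λ u → ¬? (u ≟ v)) z∈ρ z≢v))

-- Dyadic times

opaque
  exponent : ℕ → ℕ
  exponent zero    = 0
  exponent (suc k) = double (exponent k)

  -- dyadic k = 2 ^ - k
  dyadic : ℕ → ℝ
  dyadic k = ι (exponent k)

  dyadic-anti : ∀ {m n} → m ≤ n → dyadic n ≼ dyadic m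
  dyadic-anti {m} m≤n = go (ℕ.≤⇒≤′ m≤n)
    where
    go : ∀ {n} → m ℕ.≤′ n → dyadic n ≼ dyadic m
    go (ℕ.≤′-reflexive refl) = ≼-refl
    go (ℕ.≤′-step {n} m≤n)   = ≼-trans (ι-anti (≤-double (exponent n))) (go m≤n)

  dyadic-nonneg : ∀ k → 0ℝ ≼ dyadic k
  dyadic-nonneg k = ι-nonneg (exponent k)

  dyadic≼1 : ∀ k → dyadic k ≼ 1ℝ
  dyadic≼1 k = ι≼1 (exponent k)

  -- Vanishes up to time 2^-(k+1), is at least 1 from time 2^-k on, and has slope 2^(k+1) in
  -- between. It is not cut off at 1 because it only enters minima with bounded quantities.
  ramp : ℕ → ℝ → ℝ
  ramp k t = suc (exponent (suc k)) · posPart (t - dyadic (suc k))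

  ramp-nonneg : ∀ k t → 0ℝ ≼ ramp k t
  ramp-nonneg k t = ·-nonneg (suc (exponent (suc k))) (posPart-nonneg _)

  ramp-zero : ∀ k {t} → t ≼ dyadic (suc k) → ramp k t ≃ 0ℝ
  ramp-zero k p = ·-zero (suc (exponent (suc k))) (posPart-zero p)

  ramp-full : ∀ k {t} → dyadic k ≼ t → 1ℝ ≼ ramp k t
  ramp-full k p = ι≼⇒1≼ (exponent (suc k)) (≼posPart- (≼-trans (≃⇒≼ (ι-double (exponent k))) p))

  split-dyadic : ∀ k t → t ≼ dyadic k ⊎ dyadic (suc k) ≼ t
  split-dyadic k = split-ι (<-double (exponent k))

-- The vertex of rank j is eliminated between the times dyadic (3 + 4 j) and dyadic (4 j).
4×_ : ℕ → ℕ
4× zero  = 0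
4× suc j = 4 ℕ.+ 4× j

-- The homotopy on weights: successive eliminations in dyadic time

module Flow {V : Set} {d : V → V → ℕ} (isMetric : IsMetric _≡_ d) (r : ℕ) (E : Elimination d r) where

  open Elimination E
  open SimplicialComplex (VR isMetric r) using (Simplex)
  open Sums {V}
  open Moves _≟_
  open Push isMetric r E
  open import Data.List.Membership.DecPropositional _≟_ using (_∈?_)

  uc-posPart : ∀ {F} → UC F → UC (λ p → posPart (F p))
  uc-posPart uF = uc-⊔ uF (uc-const 0ℝ)

  opaque
    unfolding ramp

    uc-ramp : ∀ k → UC (λ p → ramp k (proj₂ p))
    uc-ramp k = uc-· (suc (exponent (suc k))) (uc-posPart (uc-- uc-time (uc-const (dyadic (suc k)))))

  module Step (v : V) (k₁ k₂ : ℕ) where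

    open At v (ramp k₁) (ramp k₂) (ramp-nonneg k₁) (ramp-nonneg k₂) public

    uc-gather : ∀ {F G} → UC F → UCʷ G → ∀ l → UCʷ (λ p → gather (F p) l (G p))
    uc-gather uF uG []      = uG
    uc-gather uF uG (u ∷ l) = uc-gather uF (uc-move u v (uc-⊓ (uc-at uG u) uF) uG) l

    uc-spread : ∀ {G} → UCʷ G → ∀ l → (∀ {w f} → (w , f) ∈ l → UC f) → UCʷ (λ p → spread l p (G p))
    uc-spread uG []            uf = uG
    uc-spread uG ((w , f) ∷ l) uf =
      uc-spread (uc-move v w (uc-⊓ (uc-at uG v) (uf (here refl))) uG) l (λ m → uf (there m))

    uc-clear : ∀ w l → UC (λ p → clear w l (proj₁ p))
    uc-clear w []      = uc-const 1ℝ
    uc-clear w (u ∷ l) with d u w ℕ.≤? r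
    ... | yes _ = uc-clear w l
    ... | no  _ = uc-⊓ (uc-posPart (uc-- (uc-const h) (uc-at uc-weights u))) (uc-clear w l)

    uc-amount : ∀ f → UC (λ p → f (proj₁ p)) → UC (amount f)
    uc-amount f uf = uc-⊓ (uc-ramp k₂) (uc-· (suc (double K)) uf)

    uc-targets : ∀ {w f} → (w , f) ∈ targets → UC f
    uc-targets = targets-case (λ (w , f) → UC f)
      (λ {w} _ → uc-amount (φ w) (uc-⊓ (uc-posPart (uc-- (uc-at uc-weights v) (uc-const (ι 7)))) (uc-clear w N)))
      (λ {u} _ → uc-amount (ψ u) (uc-posPart (uc-- (uc-at uc-weights u) (uc-const c))))

    opaque
      unfolding step

      uc-step : UCʷ step
      uc-step = uc-spread (uc-gather (uc-⊓ (uc-at uc-weights v) (uc-⊓ (uc-const c) (uc-ramp k₁))) uc-weights N)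
        targets uc-targets

  -- Gathering is switched on between 2^-(4j+3) and 2^-(4j+2), spreading between 2^-(4j+1) and
  -- 2^-(4j), and rank j - 1 starts at 2^-(4j-1). The pauses in between allow the stage to be
  -- determined from an approximate time.
  eliminate : ℕ → Maybe V → Weights × ℝ → Weights
  eliminate j nothing  = proj₁
  eliminate j (just v) = Step.step v (2 ℕ.+ 4× j) (4× j)

  -- Ranks n, ..., 1 in this order, which is also their order in time. Rank 0 is kept as the
  -- basepoint.
  evolve : ℕ → Weights × ℝ → Weights
  evolve zero    p = proj₁ p
  evolve (suc j) p = evolve j (eliminate (suc j) (unrank (suc j)) p , proj₂ p)

  uc-evolve : ∀ n → UCʷ (evolve n)
  uc-evolve zero    = uc-weights
  uc-evolve (suc j) = uc-compose {evolve j} (uc-evolve j) (uc-eliminate (unrank (suc j)))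
    where
    uc-eliminate : ∀ m → UCʷ (eliminate (suc j) m)
    uc-eliminate nothing  = uc-weights
    uc-eliminate (just v) = Step.uc-step v (2 ℕ.+ 4× suc j) (4× suc j)

  -- Pointwise equal weights are close at every precision, so uniform continuity already gives
  -- extensionality.
  evolve-cong : ∀ n {x y} t → (∀ z → x z ≃ y z) → ∀ z → evolve n (x , t) z ≃ evolve n (y , t) z
  evolve-cong n t x≃y z = close-limit λ k → proj₂ (uc-evolve n k) ((λ v → ≃⇒close (x≃y v)) , close-refl) z

  eliminate-distribution : ∀ j m {x t} → Distribution x → Distribution (eliminate j m (x , t))
  eliminate-distribution j nothing  X = X
  eliminate-distribution j (just v) {t = t} X = Step.step-distribution v (2 ℕ.+ 4× j) (4× j) {t = t} X

  evolve-distribution : ∀ n {x t} → Distribution x → Distribution (evolve n (x , t))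
  evolve-distribution zero    X = X
  evolve-distribution (suc j) X = evolve-distribution j (eliminate-distribution (suc j) (unrank (suc j)) X)

  eliminate-idle : ∀ j m {x t} → Distribution x → t ≼ dyadic (3 ℕ.+ 4× j) → ∀ z → eliminate j m (x , t) z ≃ x z
  eliminate-idle j nothing  X early z = ≃-refl
  eliminate-idle j (just v) {t = t} X early = Step.step-idle v (2 ℕ.+ 4× j) (4× j) {t = t} X
    (ramp-zero (2 ℕ.+ 4× j) early) (ramp-zero (4× j) (≼-trans early (dyadic-anti (ℕ.m≤n+m (suc (4× j)) 2))))

  evolve-idle : ∀ n {x t} → Distribution x → t ≼ dyadic (3 ℕ.+ 4× n) → ∀ z → evolve n (x , t) z ≃ x z
  evolve-idle zero    X early z = ≃-refl
  evolve-idle (suc j) X early z = ≃-trans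
    (evolve-idle j (eliminate-distribution (suc j) (unrank (suc j)) X)
      (≼-trans early (dyadic-anti (ℕ.m≤n+m (3 ℕ.+ 4× j) 4))) z)
    (eliminate-idle (suc j) (unrank (suc j)) X early z)

  eliminate-absent : ∀ j m {x t} → Distribution x → (∀ {v} → m ≡ just v → x v ≃ 0ℝ) →
                     ∀ z → eliminate j m (x , t) z ≃ x z
  eliminate-absent j nothing  X absent z = ≃-refl
  eliminate-absent j (just v) {t = t} X absent = Step.step-absent v (2 ℕ.+ 4× j) (4× j) {t = t} X (absent refl)

  RankAtMost : ℕ → List V → Set
  RankAtMost n σ = ∀ {u} → u ∈ σ → rank u ≤ n

  -- The additional eliminations come first and concern vertices of rank above n, which are absent
  -- from σ; each is the identity on x.
  evolve-stable : ∀ {n m x t σ} → Distribution x → Off σ x → RankAtMost n σ → n ≤ m →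
                  ∀ z → evolve m (x , t) z ≃ evolve n (x , t) z
  evolve-stable {n} {m} {x} {t} {σ} X off rank≤ n≤m = go (ℕ.≤⇒≤′ n≤m)
    where
    go : ∀ {m} → n ℕ.≤′ m → ∀ z → evolve m (x , t) z ≃ evolve n (x , t) z
    go (ℕ.≤′-reflexive refl) z = ≃-refl
    go (ℕ.≤′-step {m} n≤m)   z = ≃-trans
      (evolve-cong m t (eliminate-absent (suc m) (unrank (suc m)) {t = t} X
        (λ eq → off (λ v∈σ → ℕ.<⇒≱ (ℕ.s≤s (ℕ.≤′⇒≤ n≤m)) (subst (_≤ n) (rank-unrank eq) (rank≤ v∈σ))))) z)
      (go n≤m z)

  off-cong : ∀ {σ x y} → (∀ z → y z ≃ x z) → Off σ x → Off σ y
  off-cong y≃x off z∉σ = ≃-trans (y≃x _) (off z∉σ)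

  private
    drop-rank : ∀ {j σ} → RankAtMost (suc j) σ → (∀ {u} → u ∈ σ → rank u ≢ suc j) → RankAtMost j σ
    drop-rank rank≤ rank≢ u∈σ = ℕ.≤-pred (ℕ.≤∧≢⇒< (rank≤ u∈σ) (rank≢ u∈σ))

  Supported : ℕ → Weights → Set
  Supported n x = ∃[ σ ] Simplex σ × RankAtMost n σ × Off σ x

  module _ {j x} (t : ℝ) (X : Distribution x) {σ : List V} (simplex : Simplex σ) (rank≤ : RankAtMost (suc j) σ) (off : Off σ x) where

    -- Whether the vertex occurs in the list σ is decidable, although whether it has weight is not.
    -- If it does not occur, its elimination changes nothing and σ already has smaller ranks.
    present? : (∃[ v ] unrank (suc j) ≡ just v × v ∈ σ) ⊎ Supported j (eliminate (suc j) (unrank (suc j)) (x , t))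
    present? with unrank (suc j) in eq
    ... | nothing = inj₂ (σ , simplex , drop-rank rank≤ no-rank , off)
      where
      no-rank : ∀ {u} → u ∈ σ → rank u ≢ suc j
      no-rank {u} _ rank≡ with trans (sym (unrank-rank u)) (trans (cong unrank rank≡) eq)
      ... | ()
    ... | just v with v ∈? σ
    ...   | yes v∈σ = inj₁ (v , refl , v∈σ)
    ...   | no  v∉σ = inj₂ (σ , simplex , drop-rank rank≤ no-rank ,
              off-cong {σ} (Step.step-absent v (2 ℕ.+ 4× suc j) (4× suc j) {t = t} X (off v∉σ)) off)
      where
      no-rank : ∀ {u} → u ∈ σ → rank u ≢ suc j
      no-rank u∈σ rank≡ = v∉σ (subst (_∈ σ) (rank-injective (trans rank≡ (sym (rank-unrank eq)))) u∈σ)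

    private
      below : ∀ {v} → unrank (suc j) ≡ just v → ∀ {u} → u ∈ σ → rank u ≤ rank v
      below eq u∈σ = ℕ.≤-trans (rank≤ u∈σ) (ℕ.≤-reflexive (sym (rank-unrank eq)))

    private
      Next : Weights
      Next = eliminate (suc j) (unrank (suc j)) (x , t)

      transport : ∀ {v} → unrank (suc j) ≡ just v → ∀ {ρ} → Off ρ (eliminate (suc j) (just v) (x , t)) → Off ρ Next
      transport eq {ρ} = subst (λ m → Off ρ (eliminate (suc j) m (x , t))) (sym eq)

    eliminate-done : dyadic (4× suc j) ≼ t → Supported j Next
    eliminate-done late = [ present , (λ supported → supported) ]′ present?
      where
      present : (∃[ v ] unrank (suc j) ≡ just v × v ∈ σ) → Supported j Next
      present (v , eq , v∈σ) =
        let (ρ , ρ-simplex , ρ-rank , ρ-off) = Step.OnSimplex.done v (2 ℕ.+ 4× suc j) (4× suc j) t X {σ} simplex off v∈σ (below eq)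
              (λ rank≡0 → ℕ.0≢1+n (trans (sym rank≡0) (rank-unrank eq)))
              (ramp-full (2 ℕ.+ 4× suc j) (≼-trans (dyadic-anti (ℕ.m≤n+m (4× suc j) 2)) late)) (ramp-full (4× suc j) late)
        in ρ , ρ-simplex , (λ u∈ → ℕ.≤-pred (ℕ.≤-trans (ρ-rank u∈) (ℕ.≤-reflexive (rank-unrank eq)))) , transport eq {ρ} ρ-off

    -- Either the time is before the phases of all smaller ranks, and any simplex will do because
    -- nothing more happens, or this elimination is complete and the induction on the rank can go
    -- on.
    eliminate-outcome : (t ≼ dyadic (3 ℕ.+ 4× j) × ∃[ ρ ] Simplex ρ × Off ρ Next) ⊎ Supported j Next
    eliminate-outcome = [ present , inj₂ ]′ present?
      where
      present : (∃[ v ] unrank (suc j) ≡ just v × v ∈ σ) → (t ≼ dyadic (3 ℕ.+ 4× j) × ∃[ ρ ] Simplex ρ × Off ρ Next) ⊎ Supported j Next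
      present (v , eq , v∈σ) = 
        [ first , [ second , (λ late → inj₂ (eliminate-done late)) ]′ ∘ middle-or-late ]′ (split-dyadic (1 ℕ.+ 4× suc j) t)
        where
        Early : Set
        Early = dyadic (2 ℕ.+ 4× suc j) ≼ t × t ≼ dyadic (3 ℕ.+ 4× j)
        middle-or-late : dyadic (2 ℕ.+ 4× suc j) ≼ t → Early ⊎ dyadic (4× suc j) ≼ t
        middle-or-late middle = [ (λ early → inj₁ (middle , early)) , inj₂ ]′ (split-dyadic (3 ℕ.+ 4× j) t)
        first : t ≼ dyadic (1 ℕ.+ 4× suc j) → (t ≼ dyadic (3 ℕ.+ 4× j) × ∃[ ρ ] Simplex ρ × Off ρ Next) ⊎ Supported j Next
        first early = inj₁ (≼-trans early (dyadic-anti (ℕ.m≤n+m (3 ℕ.+ 4× j) 2)) , σ , simplex ,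
          transport eq {σ} (Step.OnSimplex.stage₁ v (2 ℕ.+ 4× suc j) (4× suc j) t X {σ} simplex off v∈σ (below eq)
            (ramp-zero (4× suc j) early)))
        second : Early → (t ≼ dyadic (3 ℕ.+ 4× j) × ∃[ ρ ] Simplex ρ × Off ρ Next) ⊎ Supported j Next
        second (middle , early) =
          let (ρ , ρ-simplex , _ , ρ-off) =
                Step.OnSimplex.stage₂ v (2 ℕ.+ 4× suc j) (4× suc j) t X {σ} simplex off v∈σ (below eq)
                (ramp-full (2 ℕ.+ 4× suc j) middle)
          in inj₁ (early , ρ , ρ-simplex , transport eq {ρ} ρ-off)

  evolve-simplex : ∀ n {x} t → Distribution x → Supported n x → ∃[ ρ ] Simplex ρ × Off ρ (evolve n (x , t))
  evolve-simplex zero    t X (σ , simplex , _ , off) = σ , simplex , off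
  evolve-simplex (suc j) {x} t X (σ , simplex , rank≤ , off) = go (eliminate-outcome t X {σ} simplex rank≤ off)
    where
    Next : Weights
    Next = eliminate (suc j) (unrank (suc j)) (x , t)
    go : (t ≼ dyadic (3 ℕ.+ 4× j) × ∃[ ρ ] Simplex ρ × Off ρ Next) ⊎ Supported j Next → ∃[ ρ ] Simplex ρ × Off ρ (evolve (suc j) (x , t))
    go (inj₁ (early , ρ , ρ-simplex , ρ-off)) = ρ , ρ-simplex ,
      off-cong {ρ} (evolve-idle j (eliminate-distribution (suc j) (unrank (suc j)) X) early) ρ-off
    go (inj₂ supported) = evolve-simplex j t (eliminate-distribution (suc j) (unrank (suc j)) X) supported

  evolve-end : ∀ n {x t} → Distribution x → Supported n x → 1ℝ ≼ t → Supported 0 (evolve n (x , t))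
  evolve-end zero    X supported late = supported
  evolve-end (suc j) {x} {t} X (σ , simplex , rank≤ , off) late =
    evolve-end j (eliminate-distribution (suc j) (unrank (suc j)) X)
      (eliminate-done t X {σ} simplex rank≤ off (≼-trans (dyadic≼1 (4× suc j)) late)) late

-- The realization

x+ιk≼y+ιm : ∀ {k m x y y′} → x + ι k ≼ y + ι m → y ≼ y′ + ι (double k) → x + ι (double k) ≼ y′ + ι m
x+ιk≼y+ιm {k} {m} {x} {y} {y′} p q = +-cancelˡ-≼ (ι (double k)) (begin
  e + (x + e)        ≈⟨ solve 2 (λ e x → e ⊕ (x ⊕ e) ⊜ x ⊕ (e ⊕ e)) ≃-refl e x ⟩
  x + (e + e)        ≈⟨ +-cong ≃-refl (ι-double k) ⟩
  x + ι k            ≤⟨ p ⟩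
  y + ι m            ≤⟨ +-monoˡ (ι m) q ⟩
  (y′ + e) + ι m     ≈⟨ solve 3 (λ y e m → (y ⊕ e) ⊕ m ⊜ e ⊕ (y ⊕ m)) ≃-refl y′ e (ι m) ⟩
  e + (y′ + ι m)     ∎)
  where
  open ≼-Reasoning
  open +-Solver
  e : ℝ
  e = ι (double k)

-- The distance of x and y is at most 1/(m+1) - 1/(k+1).
record Inside (m k : ℕ) (x y : ℝ) : Set where
  field
    inside≼ : x + ι k ≼ y + ι m
    inside≽ : y + ι k ≼ x + ι m

open Inside

inside-centre : ∀ {m x} → Inside m m x x
inside-centre = record { inside≼ = ≼-refl ; inside≽ = ≼-refl }

inside⇒close : ∀ {m k x y} → Inside m k x y → Close m x y
inside⇒close {m} {k} i = ≼-trans (x≼x+y (ι-nonneg k)) (inside≼ i) ,~ ≼-trans (x≼x+y (ι-nonneg k)) (inside≽ i)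

-- Half of the slack pays for the change from y to y′ and the other half remains. This is the
-- openness of balls and intervals.
inside-shift : ∀ {m k x y y′} → Inside m k x y → Close (double k) y y′ → Inside m (double k) x y′
inside-shift {m} {k} {x} {y} {y′} i c = record
  { inside≼ = x+ιk≼y+ιm (inside≼ i) (close⇒≼ c)
  ; inside≽ = begin
      y′ + ι (double k)                         ≤⟨ +-monoˡ (ι (double k)) (close⇒≽ c) ⟩
      (y + ι (double k)) + ι (double k)         ≈⟨ +-assoc _ _ _ ⟩
      y + (ι (double k) + ι (double k))         ≈⟨ +-cong ≃-refl (ι-double k) ⟩
      y + ι k                                   ≤⟨ inside≽ i ⟩
      x + ι m                                   ∎
  }
  where open ≼-Reasoning

ι-double-positive : ∀ k {x} → ι k ≼ x → ¬ x ≼ ι (double k)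
ι-double-positive k p q = ι-positive (double k) (+-cancelˡ-≼ (ι (double k))
  (≼-trans (≃⇒≼ (ι-double k)) (≼-trans p (≼-trans q (≃⇒≽ (+-identityʳ _))))))

opaque
  unfolding _·_

  n/n+1<1 : ∀ n → ¬ 1ℝ ≼ n · ι n
  n/n+1<1 n p = ι-positive n (+-cancelˡ-≼ 1ℝ (begin
    1ℝ + ι n          ≤⟨ +-monoˡ (ι n) p ⟩
    n · ι n + ι n     ≈⟨ +-comm _ _ ⟩
    ι n + n · ι n     ≈⟨ ·-inv n ⟩
    1ℝ                ≈⟨ +-identityʳ 1ℝ ⟨
    1ℝ + 0ℝ           ∎))
    where open ≼-Reasoning

-- There are finitely many sublists of `l`, so their bounds have a maximum. The induction changes
-- `P`, since a sublist of `a ∷ l` either keeps a or drops it.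
uniform-filter : ∀ {A : Set} (P : List A → ℕ → Set) → (∀ {l m n} → m ≤ n → P l m → P l n) → (∀ l → ∃ (P l)) →
                 ∀ l → ∃[ k ] (∀ {Q : Pred A 0ℓ} (Q? : Decidable Q) → P (filter Q? l) k)
uniform-filter P mono all []      = let (k , p) = all [] in k , λ _ → p
uniform-filter P mono all (a ∷ l) =
  let (m , p) = uniform-filter P mono all l
      (n , q) = uniform-filter (λ l → P (a ∷ l)) mono (λ l → all (a ∷ l)) l
  in m ℕ.⊔ n , both m n p q
  where
  both : ∀ m n → (∀ {Q : Pred _ 0ℓ} (Q? : Decidable Q) → P (filter Q? l) m) → (∀ {Q : Pred _ 0ℓ} (Q? : Decidable Q) → P (a ∷ filter Q? l) n) →
         ∀ {Q : Pred _ 0ℓ} (Q? : Decidable Q) → P (filter Q? (a ∷ l)) (m ℕ.⊔ n)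
  both m n p q Q? with Q? a
  ... | yes _ = mono (ℕ.m≤n⊔m m n) (q Q?)
  ... | no  _ = mono (ℕ.m≤m⊔n m n) (p Q?)

module Realization {V : Set} {d : V → V → ℕ} (isMetric : IsMetric _≡_ d) (r : ℕ) (E : Elimination d r) where

  K : SimplicialComplex
  K = VR isMetric r

  open Elimination E
  open SimplicialComplex K using (Simplex)
  open Sums {V}
  open Moves _≟_
  open Push isMetric r E using (d-refl; rank-injective)
  open Flow isMetric r E
  open import Data.List.Membership.DecPropositional _≟_ using (_∈?_)
  open import Data.List.Relation.Unary.Unique.DecPropositional.Properties _≟_ using (deduplicate-!)

  open Point {K} using (coord; carrier; isSimplex)

  cell⇒off : ∀ {σ x} → VanishesOff K σ x → Off σ x
  cell⇒off vanishes v∉σ = ≃-trans (≃-in (vanishes v∉σ)) (≃-sym (⌜⌝≃fromℚ 0ℚ))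

  off⇒cell : ∀ {σ x} → Off σ x → VanishesOff K σ x
  off⇒cell off v∉σ = ≃-out (≃-trans (off v∉σ) (⌜⌝≃fromℚ 0ℚ))

  off-carrier : ∀ x → Off (carrier x) (coord x)
  off-carrier x = cell⇒off {carrier x} {coord x} (Point.supported x)

  distribution : ∀ x → Distribution (coord x)
  distribution x = record
    { nonneg  = λ v → ≼-trans (≃⇒≼ (⌜⌝≃fromℚ 0ℚ)) (≼-in (Point.nonNegative x v))
    ; support = carrier x
    ; unique  = Point.unique x
    ; off     = off-carrier x
    ; total   = ≃-trans (∑-foldr (carrier x) (coord x)) (≃-trans (≃-in (Point.total x)) (≃-sym (⌜⌝≃fromℚ 1ℚ)))
    }

  point : ∀ {x} → Distribution x → ∀ {ρ} → Simplex ρ → Off ρ x → Point K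
  point {x} X {ρ} simplex off = record
    { coord       = x
    ; nonNegative = λ v → ≼-out (≼-trans (≃⇒≽ (⌜⌝≃fromℚ 0ℚ)) (Distribution.nonneg X v))
    ; carrier     = ρ′
    ; isSimplex   = λ a∈ b∈ → simplex (∈-deduplicate⁻ _≟_ ρ a∈) (∈-deduplicate⁻ _≟_ ρ b∈)
    ; unique      = deduplicate-! ρ
    ; supported   = off⇒cell {ρ′} {x} off′
    ; total       = ≃-out (≃-trans (≃-sym (∑-foldr ρ′ x)) (≃-trans (∑≃1 X (deduplicate-! ρ) off′) (⌜⌝≃fromℚ 1ℚ)))
    }
    where
    ρ′ : List V
    ρ′ = deduplicate _≟_ ρ
    off′ : Off ρ′ x
    off′ v∉ = off (λ v∈ → v∉ (∈-deduplicate⁺ _≟_ v∈))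

  CloseTo : ℕ → Point K → Point K → Set
  CloseTo k x y = ∀ v → Close k (coord x v) (coord y v)

  open-in-cell : ∀ {A : Pred (Point K) 0ℓ} → Space.Open (realization K) A → ∀ {σ} → Simplex σ → ∀ x → Off σ (coord x) → A x →
                 ∃[ k ] (∀ y → Off σ (coord y) → CloseTo k x y → A y)
  open-in-cell (lift A-open) {σ} simplex x off a =
    let (ε , 0<ε , ball) = A-open σ simplex x (off⇒cell {σ} {coord x} off) a
        (k , close⇒dist) = close⇒distance 0<ε
    in k , λ y off′ close → ball y (off⇒cell {σ} {coord y} off′) (λ {v} _ → close⇒dist (close v))

  opaque
    -- With n entries in the carrier, not all weights can be at most 1/(n+1), since they add up to
    -- 1.
    heavy-vertex : ∀ x → ∃[ v ] v ∈ carrier x × ι (suc (length (carrier x))) ≼ coord x v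
    heavy-vertex x = [ (λ light → contradiction (≼-trans (≃⇒≽ (Distribution.total (distribution x))) light) (n/n+1<1 (length (carrier x)))) ,
      (λ heavy → heavy) ]′ (some-large _≟_ (ℕ.n<1+n (length (carrier x))) (carrier x) (coord x))

  close-zero : ∀ {k x y} → Close k x y → y ≃ 0ℝ → x ≼ ι k
  close-zero c y≃0 = ≼-trans (close⇒≼ c) (≃⇒≼ (≃-trans (+-cong y≃0 ≃-refl) (+-identityˡ _)))

  zero-close : ∀ {k m} → 0ℝ ≼ m → m ≼ ι k → Close k m 0ℝ
  zero-close {k} 0≼m m≼ι = ≼-trans m≼ι (≃⇒≽ (+-identityˡ _)) ,~ ≼-trans 0≼m (x≼x+y (ι-nonneg k))

  small-move : ∀ {k u w m x} → 0ℝ ≼ m → m ≼ ι (double (double k)) → ∀ z → Close k (move u w m x z) (x z)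
  small-move {k} {u} {w} {m} {x} 0≼m m≼ι z = close-resp ≃-refl (move-trivial ≃-refl z) (close-move z)
    where
    opaque
      unfolding move
      close-move : ∀ z → Close k (move u w m x z) (move u w 0ℝ x z)
      close-move z = let c = zero-close 0≼m m≼ι in
        close-- (close-+ close-refl (close-dirac w c z)) (close-weaken (≤-double (double k)) (close-dirac u c z))

  module Local (v₀ : V) where

    open Step v₀ 0 0 using (gather; gather-distribution; gather-kills; gather-zero)

    0≼1 : 0ℝ ≼ 1ℝ
    0≼1 = ≼-trans (ι-nonneg 0) (ι≼1 0)

    -- Gathering with bound 1 takes the entire weight of the listed vertices. The change is small if
    -- these weights are, and a move onto v₀ never increases the weights still to be taken.
    gather-close : ∀ l k → ∃[ j ] (∀ {x} → (∀ z → 0ℝ ≼ x z) → (∀ {u} → u ∈ l → u ≢ v₀ × x u ≼ ι j) → ∀ z → Close k (gather 1ℝ l x z) (x z))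
    gather-close []      k = 0 , λ _ _ _ → close-refl
    gather-close (u ∷ l) k =
      let (j , h) = gather-close l (double k) ; i = double (double (double k)) in
      i ℕ.⊔ j , λ {x} 0≼x small z →
        let 0≼m = ⊓-nonneg (0≼x u) 0≼1
            m≼ι = ≼-trans (x⊓y≼x _ _) (≼-trans (proj₂ (small (here refl))) (ι-anti (ℕ.m≤m⊔n i j)))
        in close-trans
          (h (move-nonneg 0≼m (x⊓y≼x _ _) 0≼x)
            (λ {u′} u′∈ → let (u′≢v₀ , small′) = small (there u′∈) in
              u′≢v₀ , ≼-trans (decrease 0≼m u′≢v₀) (≼-trans small′ (ι-anti (ℕ.m≤n⊔m i j)))) z)
          (small-move 0≼m m≼ι z)
      where
      decrease : ∀ {x m z} → 0ℝ ≼ m → z ≢ v₀ → move u v₀ m x z ≼ x z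
      decrease {x} {m} {z} 0≼m z≢v₀ with z ≟ u
      ... | yes refl = ≼-trans (≃⇒≼ (move-source z≢v₀)) (x-y≼x 0≼m)
      ... | no  z≢u  = ≃⇒≼ (move-other z≢u z≢v₀)

    module _ {A : Pred (Point K) 0ℓ} (A-open : Space.Open (realization K) A) (x : Point K) (a : A x) (v₀∈ : v₀ ∈ carrier x) where

      Uniform : List V → ℕ → Set
      Uniform ρ k = Simplex ρ → v₀ ∈ ρ → ∀ y → Off ρ (coord y) → CloseTo k x y → A y

      uniform-mono : ∀ {ρ m n} → m ≤ n → Uniform ρ m → Uniform ρ n
      uniform-mono m≤n h simplex v₀∈ρ y off close = h simplex v₀∈ρ y off (λ v → close-weaken m≤n (close v))

      module _ {ρ : List V} (ρ-simplex : Simplex ρ) (v₀∈ρ : v₀ ∈ ρ) where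

        private
          X : Distribution (coord x)
          X = distribution x
          open Distribution X using (nonneg)

        outside : List V
        outside = filter (λ u → ¬? (u ∈? ρ)) (carrier x)

        ∈outside : ∀ {u} → u ∈ outside → u ∈ carrier x × u ∉ ρ
        ∈outside = ∈-filter⁻ (λ u → ¬? (u ∈? ρ)) {xs = carrier x}

        outside≢v₀ : ∀ {u} → u ∈ outside → u ≢ v₀
        outside≢v₀ u∈ refl = proj₂ (∈outside u∈) v₀∈ρ

        x′ : Weights
        x′ = gather 1ℝ outside (coord x)

        X′ : Distribution x′
        X′ = gather-distribution 0≼1 outside X

        x′-off-carrier : Off (carrier x) x′
        x′-off-carrier z∉ = gather-zero 0≼1 outside nonneg (λ { refl → z∉ v₀∈ }) (off-carrier x z∉)

        x′-off-ρ : Off ρ x′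
        x′-off-ρ {z} z∉ρ with z ∈? carrier x
        ... | no  z∉ = x′-off-carrier z∉
        ... | yes z∈ = gather-kills 0≼1 nonneg (λ { refl → z∉ρ v₀∈ρ }) (∈-filter⁺ (λ u → ¬? (u ∈? ρ)) z∈ z∉ρ) (x≼1 X z)

        -- Close to x, a point of the cell ρ can be compared with the
        -- projection of x to that cell, which lies in the cell of x as well.
        projected : A (point X′ (isSimplex x) x′-off-carrier) → ∃[ k ] (∀ y → Off ρ (coord y) → CloseTo k x y → A y)
        projected a′ =
          let (k , h) = open-in-cell A-open ρ-simplex (point X′ (isSimplex x) x′-off-carrier) x′-off-ρ a′
              (j , g) = gather-close outside (double k)
          in j ℕ.⊔ double k , λ y off close → h y off (λ v → close-trans
               (g nonneg (λ u∈ → outside≢v₀ u∈ , close-zero (close-weaken (ℕ.m≤m⊔n j (double k)) (close _)) (off (proj₂ (∈outside u∈)))) v)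
               (close-weaken (ℕ.m≤n⊔m j (double k)) (close v)))

        all-small? : ∀ j l → (∀ {u} → u ∈ l → coord x u ≼ ι j) ⊎ (∃[ u ] u ∈ l × ι (suc j) ≼ coord x u)
        all-small? j []      = inj₁ (λ ())
        all-small? j (u ∷ l) with split-ι (ℕ.n<1+n j) (coord x u) | all-small? j l
        ... | inj₂ large | _                     = inj₂ (u , here refl , large)
        ... | inj₁ _     | inj₂ (u′ , u′∈ , large) = inj₂ (u′ , there u′∈ , large)
        ... | inj₁ small | inj₁ smalls           = inj₁ λ { (here refl) → small ; (there u∈) → smalls u∈ }

        InBall : ℕ → Set
        InBall k = ∀ y → Off ρ (coord y) → CloseTo k x y → A y

        -- The difficulty is that x need not lie in the cell ρ. If some weight of x outside ρ is
        -- definitely positive, no point of that cell is close to x. Otherwise those weights are so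
        -- small that projecting x onto ρ stays within A, and openness in ρ at the projection
        -- applies.
        uniform-simplex : ∃ InBall
        uniform-simplex = from-cell (open-in-cell A-open (isSimplex x) x (off-carrier x) a)
          where
          from-cell : ∃[ k ] (∀ y → Off (carrier x) (coord y) → CloseTo k x y → A y) → ∃ InBall
          from-cell (k , h) = from-size (gather-close outside k)
            where
            from-size : ∃[ j ] (∀ {x} → (∀ z → 0ℝ ≼ x z) → (∀ {u} → u ∈ outside → u ≢ v₀ × x u ≼ ι j) →
                                ∀ z → Close k (gather 1ℝ outside x z) (x z)) → ∃ InBall
            from-size (j , g) = [ small , large ]′ (all-small? j outside)
              where
              small : (∀ {u} → u ∈ outside → coord x u ≼ ι j) → ∃ InBall
              small ≼ι = projected (h (point X′ (isSimplex x) x′-off-carrier) x′-off-carrier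
                (λ v → close-sym (g nonneg (λ u∈ → outside≢v₀ u∈ , ≼ι u∈) v)))
              large : ∃[ u ] u ∈ outside × ι (suc j) ≼ coord x u → ∃ InBall
              large (u , u∈ , ι≼) = double (suc j) , λ y off close →
                contradiction (close-zero (close u) (off (proj₂ (∈outside u∈)))) (ι-double-positive (suc j) ι≼)

      simplex? : ∀ ρ → Dec (Simplex ρ)
      simplex? ρ = map′ (λ h a∈ b∈ → All.lookup (All.lookup h a∈) b∈) (λ h → All.tabulate λ a∈ → All.tabulate λ b∈ → h a∈ b∈)
        (All.all? (λ a → All.all? (λ b → d a b ℕ.≤? r) ρ) ρ)

      uniform : ∀ ρ → ∃ (Uniform ρ)
      uniform ρ = go (simplex? ρ) (v₀ ∈? ρ)
        where
        weaken : ∃[ k ] (∀ y → Off ρ (coord y) → CloseTo k x y → A y) → ∃ (Uniform ρ)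
        weaken (k , h) = k , λ _ _ → h
        go : Dec (Simplex ρ) → Dec (v₀ ∈ ρ) → ∃ (Uniform ρ)
        go (no ¬simplex) _          = 0 , λ simplex → ⊥-elim (¬simplex simplex)
        go (yes _)       (no v₀∉ρ)  = 0 , λ _ v₀∈ρ → contradiction v₀∈ρ v₀∉ρ
        go (yes simplex) (yes v₀∈ρ) = weaken (uniform-simplex {ρ} simplex v₀∈ρ)

  module _ (x : Point K) where

    v₀ : V
    v₀ = proj₁ (heavy-vertex x)

    κ : ℕ
    κ = double (suc (length (carrier x)))

    -- A point whose carrier omits v₀ has weight 0 there, while x has at least `2 · ι κ`.
    carrier-near : ∀ y → CloseTo κ x y → v₀ ∈ carrier y
    carrier-near y close with v₀ ∈? carrier y
    ... | yes v₀∈ = v₀∈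
    ... | no  v₀∉ = contradiction (close-zero (close v₀) (off-carrier y v₀∉))
                      (ι-double-positive (suc (length (carrier x))) (proj₂ (proj₂ (heavy-vertex x))))

    carrier⊆nbrs : ∀ y → CloseTo κ x y → ∀ {u} → u ∈ carrier y → u ∈ nbrs v₀
    carrier⊆nbrs y close u∈ = ∈-nbrs (isSimplex y u∈ (carrier-near y close))

  -- Local finiteness makes the weak topology coincide with the metric one.
  open⇒ball : ∀ {A : Pred (Point K) 0ℓ} → Space.Open (realization K) A → ∀ x → A x → ∃[ k ] (∀ y → CloseTo k x y → A y)
  open⇒ball A-open x a =
    -- All points near x have carriers within the finite list `nbrs (v₀ x)`, so only its sublists
    -- occur as cells, and one radius serves them all.
    let (k , h) = uniform-filter (Local.Uniform (v₀ x) A-open x a v₀∈) (λ {ρ} → Local.uniform-mono (v₀ x) A-open x a v₀∈ {ρ})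
                    (Local.uniform (v₀ x) A-open x a v₀∈) (nbrs (v₀ x))
    in k ℕ.⊔ κ x , λ y close →
      let near = λ v → close-weaken (ℕ.m≤n⊔m k (κ x)) (close v)
          ρ = filter (_∈? carrier y) (nbrs (v₀ x))
          ρ⊆ : ∀ {u} → u ∈ ρ → u ∈ carrier y
          ρ⊆ u∈ = proj₂ (∈-filter⁻ (_∈? carrier y) {xs = nbrs (v₀ x)} u∈)
          ⊆ρ : ∀ {u} → u ∈ carrier y → u ∈ ρ
          ⊆ρ u∈ = ∈-filter⁺ (_∈? carrier y) (carrier⊆nbrs x y near u∈) u∈
      in h (_∈? carrier y) (λ a∈ b∈ → isSimplex y (ρ⊆ a∈) (ρ⊆ b∈)) (⊆ρ (carrier-near x y near)) y
           (λ v∉ → off-carrier y (λ v∈ → v∉ (⊆ρ v∈))) (λ v → close-weaken (ℕ.m≤m⊔n k (κ x)) (close v))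
    where
    v₀∈ : v₀ x ∈ carrier x
    v₀∈ = proj₁ (proj₂ (heavy-vertex x))

  -- A strict inequality with one slack common to all vertices; the common slack makes the set open.
  Ball : ℕ → Point K → Pred (Point K) 0ℓ
  Ball m x y = ∃[ k ] (∀ v → Inside m k (coord x v) (coord y v))

  ball-open : ∀ m x → Space.Open (realization K) (Ball m x)
  ball-open m x = lift λ σ simplex y cell (k , inside) → inv (double k) , 0<inv (double k) , λ y′ cell′ dist →
    double k , λ v → inside-shift (inside v) (close σ y cell y′ cell′ k dist v)
    where
    close : ∀ σ y → Cell K σ y → ∀ y′ → Cell K σ y′ → ∀ k →
            (∀ {v} → v ∈ σ → Defs.∣ coord y v Defs.- coord y′ v ∣ Defs.< fromℚ (inv (double k))) → CloseTo (double k) y y′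
    close σ y cell y′ cell′ k dist v with v ∈? σ
    ... | yes v∈ = distance⇒close (dist v∈)
    ... | no  v∉ = ≃⇒close (≃-trans (cell⇒off {σ} {coord y} cell v∉) (≃-sym (cell⇒off {σ} {coord y′} cell′ v∉)))

  Interval : ℕ → UnitInterval → Pred UnitInterval 0ℓ
  Interval m s t = ∃[ k ] Inside m k (value s) (value t)

  interval-open : ∀ m s → Space.Open 𝕀 (Interval m s)
  interval-open m s = lift λ t (k , inside) → inv (double k) , 0<inv (double k) , λ t′ dist →
    double k , inside-shift inside (distance⇒close dist)

  maxRank : List V → ℕ
  maxRank []      = 0
  maxRank (u ∷ l) = rank u ℕ.⊔ maxRank l

  rank≤maxRank : ∀ {l} → RankAtMost (maxRank l) l
  rank≤maxRank {u ∷ l} (here refl) = ℕ.m≤m⊔n (rank u) (maxRank l)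
  rank≤maxRank {u ∷ l} (there v∈)  = ℕ.≤-trans (rank≤maxRank v∈) (ℕ.m≤n⊔m (rank u) (maxRank l))

  supported : ∀ x → Supported (maxRank (carrier x)) (coord x)
  supported x = carrier x , isSimplex x , rank≤maxRank , off-carrier x

  flow : Point K × UnitInterval → Point K
  flow (x , s) = let (ρ , simplex , off) = evolve-simplex (maxRank (carrier x)) (value s) (distribution x) (supported x) in
    point (evolve-distribution (maxRank (carrier x)) (distribution x)) {ρ} simplex off

  -- `flow` takes its number of eliminations from the carrier, which equal points need not share. By
  -- stability any larger number gives the same weights, here through the maximum of both.
  flow-evolve : ∀ x s {n} → RankAtMost n (carrier x) → ∀ z → coord (flow (x , s)) z ≃ evolve n (coord x , value s) z
  flow-evolve x s {n} rank≤ z = ≃-trans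
    (≃-sym (evolve-stable {σ = carrier x} (distribution x) (off-carrier x) rank≤maxRank (ℕ.m≤m⊔n (maxRank (carrier x)) n) z))
    (evolve-stable {σ = carrier x} (distribution x) (off-carrier x) rank≤ (ℕ.m≤n⊔m (maxRank (carrier x)) n) z)

  -- Near x all carriers lie in `nbrs (v₀ x)`. Hence one fixed `evolve n` describes the flow on a
  -- neighbourhood, and its uniform continuity can be used.
  flow-close : ∀ x s k → ∃[ m ] (∀ y t → CloseTo m x y → Close m (value s) (value t) → CloseTo k (flow (x , s)) (flow (y , t)))
  flow-close x s k =
    let n = maxRank (nbrs (v₀ x)) ; (m , h) = uc-evolve n k in
    m ℕ.⊔ κ x , λ y t close close′ z → close-resp
      (≃-sym (flow-evolve x s {n} (bounded x (λ _ → close-refl)) z))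
      (≃-sym (flow-evolve y t {n} (bounded y (λ v → close-weaken (ℕ.m≤n⊔m m (κ x)) (close v))) z))
      (h ((λ v → close-weaken (ℕ.m≤m⊔n m (κ x)) (close v)) , close-weaken (ℕ.m≤m⊔n m (κ x)) close′) z)
    where
    bounded : ∀ y → CloseTo (κ x) x y → RankAtMost (maxRank (nbrs (v₀ x))) (carrier y)
    bounded y close u∈ = rank≤maxRank (carrier⊆nbrs x y close u∈)

  flow-map : ContinuousMap (realization K ×ₛ 𝕀) (realization K)
  flow-map = record
    { func = record
      { to   = flow
      -- Equal arguments are close at every precision, hence so are their images.
      ; cong = λ { {x , s} {y , t} (x≋y , s≈t) v → ≃-out (close-limit λ k →
          proj₂ (flow-close x s k) y t (λ v → ≃⇒close (≃-in (x≋y v))) (≃⇒close (≃-in s≈t)) v) }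
      }
    ; continuous = λ A-open {x} {s} a →
        let (k , ball) = open⇒ball A-open (flow (x , s)) a
            (m , close) = flow-close x s k
        in Ball m x , Interval m s , ball-open m x , interval-open m s ,
           (m , λ v → inside-centre) , (m , inside-centre) ,
           λ {y} {t} (_ , inside) (_ , inside′) → ball (flow (y , t)) (close y t (λ v → inside⇒close (inside v)) (inside⇒close inside′))
    }

  basepoint : Point K
  basepoint = point {dirac base 1ℝ} D {base ∷ []} (SimplicialComplex.singleton K base) off
    where
    off : Off (base ∷ []) (dirac base 1ℝ)
    off v∉ = dirac-≢ (λ v≡base → v∉ (here v≡base))
    D : Distribution (dirac base 1ℝ)
    D = record
      { nonneg  = λ v → dirac-nonneg v (≼-trans (ι-nonneg 0) (ι≼1 0))
      ; support = base ∷ []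
      ; unique  = [] ∷ []
      ; off     = off
      ; total   = ≃-trans (+-identityʳ _) (dirac-≡ base 1ℝ)
      }

  contractible : Contractible (realization K)
  contractible = record
    { basepoint          = basepoint
    ; homotopy           = flow-map
    ; starts-at-identity = λ x v → ≃-out (evolve-idle (maxRank (carrier x)) (distribution x)
        (≼-trans (≃⇒≽ (⌜⌝≃fromℚ 0ℚ)) (dyadic-nonneg _)) v)
    ; ends-at-basepoint  = λ x v → ≃-out (end x v)
    }
    where
    end : ∀ x v → coord (flow (x , i1)) v ≃ dirac base 1ℝ v
    end x = only-base (evolve-distribution (maxRank (carrier x)) (distribution x))
      (evolve-end (maxRank (carrier x)) (distribution x) (supported x) (≃⇒≼ (⌜⌝≃fromℚ 1ℚ)))
      where
      only-base : ∀ {y} → Distribution y → Supported 0 y → ∀ v → y v ≃ dirac base 1ℝ v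
      only-base {y} Y (σ , _ , rank≤0 , off) v = go (v ≟ base)
        where
        off-base : Off (base ∷ []) y
        off-base v∉ = off λ v∈ → v∉ (here (rank-injective (trans (ℕ.n≤0⇒n≡0 (rank≤0 v∈)) (sym rank-base))))
        go : Dec (v ≡ base) → y v ≃ dirac base 1ℝ v
        go (yes refl) = ≃-trans (≃-sym (+-identityʳ _)) (≃-trans (∑≃1 Y ([] ∷ []) off-base) (≃-sym (dirac-≡ base 1ℝ)))
        go (no v≢base) = ≃-trans (off-base (λ { (here v≡base) → v≢base v≡base })) (≃-sym (dirac-≢ v≢base))

-- Linear arithmetic

opaque
  -- Checks a certificate for linear arithmetic: the hypotheses are added up to `L ≤ R`, `Z` is the
  -- part to cancel and `m` the slack, and the two identities are left to the ring solver.
  linear : ∀ {L R} X Y Z m → L ≤ R → L ≡ X ℕ.+ Z ℕ.+ m → R ≡ Y ℕ.+ Z → X ≤ Y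
  linear X Y Z m L≤R refl refl = ℕ.+-cancelʳ-≤ Z X Y (ℕ.≤-trans (ℕ.m≤m+n (X ℕ.+ Z) m) L≤R)

  absurd : ∀ {L R} m → L ≤ R → L ≡ suc (R ℕ.+ m) → ⊥
  absurd {R = R} m L≤R refl = ℕ.<⇒≱ (ℕ.s≤s (ℕ.m≤m+n R m)) L≤R

-- Sums over Fin n

⟦_⟧ : Bool → ℕ
⟦ true  ⟧ = 1
⟦ false ⟧ = 0

Sum : ∀ {n} → (Fin n → ℕ) → ℕ
Sum {zero}  f = 0
Sum {suc n} f = f zero ℕ.+ Sum (f ∘ suc)

Sum-mono : ∀ {n} {f g : Fin n → ℕ} → (∀ i → f i ≤ g i) → Sum f ≤ Sum g
Sum-mono {zero}  h = ℕ.z≤n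
Sum-mono {suc n} h = ℕ.+-mono-≤ (h zero) (Sum-mono (h ∘ suc))

Sum-cong : ∀ {n} {f g : Fin n → ℕ} → (∀ i → f i ≡ g i) → Sum f ≡ Sum g
Sum-cong {zero}  h = refl
Sum-cong {suc n} h = cong₂ ℕ._+_ (h zero) (Sum-cong (h ∘ suc))

Sum-+ : ∀ {n} (f g : Fin n → ℕ) → Sum (λ i → f i ℕ.+ g i) ≡ Sum f ℕ.+ Sum g
Sum-+ {zero}  f g = refl
Sum-+ {suc n} f g = trans (cong (f zero ℕ.+ g zero ℕ.+_) (Sum-+ (f ∘ suc) (g ∘ suc))) (shuffle (f zero) (g zero) _ _)
  where
  shuffle : ∀ a b c d → a ℕ.+ b ℕ.+ (c ℕ.+ d) ≡ a ℕ.+ c ℕ.+ (b ℕ.+ d)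
  shuffle = solve-∀

≤Sum : ∀ {n} (f : Fin n → ℕ) i → f i ≤ Sum f
≤Sum f zero    = ℕ.m≤m+n (f zero) _
≤Sum f (suc i) = ℕ.≤-trans (≤Sum (f ∘ suc) i) (ℕ.m≤n+m _ (f zero))

Sum-zero : ∀ {n} (f : Fin n → ℕ) → (∀ i → f i ≡ 0) → Sum f ≡ 0
Sum-zero {zero}  f h = refl
Sum-zero {suc n} f h = cong₂ ℕ._+_ (h zero) (Sum-zero (f ∘ suc) (h ∘ suc))

Sum-zero⁻ : ∀ {n} (f : Fin n → ℕ) → Sum f ≡ 0 → ∀ i → f i ≡ 0
Sum-zero⁻ f eq i = ℕ.n≤0⇒n≡0 (ℕ.≤-trans (≤Sum f i) (ℕ.≤-reflexive eq))

Sum-witness : ∀ {n} (f : Fin n → ℕ) → Sum f ≢ 0 → ∃[ i ] f i ≢ 0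
Sum-witness {zero}  f h = contradiction refl h
Sum-witness {suc n} f h with f zero ℕ.≟ 0
... | no  f≢0 = zero , f≢0
... | yes f≡0 = let (i , f≢0) = Sum-witness (f ∘ suc) (λ eq → h (cong₂ ℕ._+_ f≡0 eq)) in suc i , f≢0

two≤Sum : ∀ {n} (f : Fin n → ℕ) {i j} → i ≢ j → f i ℕ.+ f j ≤ Sum f
two≤Sum f {zero}  {zero}  i≢j = contradiction refl i≢j
two≤Sum f {zero}  {suc j} i≢j = ℕ.+-monoʳ-≤ (f zero) (≤Sum (f ∘ suc) j)
two≤Sum f {suc i} {zero}  i≢j = subst (_≤ Sum f) (ℕ.+-comm (f zero) (f (suc i))) (ℕ.+-monoʳ-≤ (f zero) (≤Sum (f ∘ suc) i))
two≤Sum f {suc i} {suc j} i≢j = ℕ.≤-trans (two≤Sum (f ∘ suc) (i≢j ∘ cong suc)) (ℕ.m≤n+m _ (f zero))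

Sum≤n : ∀ {n} (f : Fin n → ℕ) → (∀ i → f i ≤ 1) → Sum f ≤ n
Sum≤n {zero}  f h = ℕ.z≤n
Sum≤n {suc n} f h = ℕ.+-mono-≤ (h zero) (Sum≤n (f ∘ suc) (h ∘ suc))

Sum≡n : ∀ {n} (f : Fin n → ℕ) → (∀ i → f i ≤ 1) → n ≤ Sum f → ∀ i → 1 ≤ f i
Sum≡n {suc n} f h n≤ zero    = ℕ.+-cancelʳ-≤ n 1 (f zero) (ℕ.≤-trans n≤ (ℕ.+-monoʳ-≤ (f zero) (Sum≤n (f ∘ suc) (h ∘ suc))))
Sum≡n {suc n} f h n≤ (suc i) = Sum≡n (f ∘ suc) (h ∘ suc) (ℕ.≤-pred (ℕ.≤-trans n≤ (ℕ.+-monoˡ-≤ _ (h zero)))) i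

at : ∀ {n} → Fin n → ℕ → Fin n → ℕ
at j k i = if does (i Fin.≟ j) then k else 0

Sum-at : ∀ {n} (j : Fin n) k → Sum (at j k) ≡ k
Sum-at {suc n} zero k = trans (cong (k ℕ.+_) (Sum-zero {n} (λ _ → 0) (λ _ → refl))) (ℕ.+-identityʳ k)
Sum-at (suc j) k = trans (Sum-cong (λ i → shift i)) (Sum-at j k)
  where
  shift : ∀ i → at (suc j) k (suc i) ≡ at j k i
  shift i with i Fin.≟ j
  ... | yes _ = refl
  ... | no  _ = refl

-- Integers with a marked positive direction

sameSign : ℤ → ℤ → Bool
sameSign +[1+ _ ] +[1+ _ ] = true
sameSign -[1+ _ ] -[1+ _ ] = true
sameSign _        _        = false

positive : Bool → ℤ → Bool
positive true +[1+ _ ] = true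
positive _    _        = false

positive-0 : ∀ s → positive s +0 ≡ false
positive-0 true  = refl
positive-0 false = refl

-- For a displacement a from a coordinate of v, `loss` measures motion that increases the absolute
-- value. `gain` only bounds the decrease from above, because a long positive displacement passes
-- beyond 0.
gain loss : Bool → ℤ → ℕ
gain s a = if positive s a then ℤ.∣ a ∣ else 0
loss s a = if positive s a then 0 else ℤ.∣ a ∣

distance : ℤ → ℤ → ℕ
distance a c = ℤ.∣ a ℤ.- c ∣

distance-sym : ∀ a c → distance a c ≡ distance c a
distance-sym = ℤ.∣i-j∣≡∣j-i∣

∣c∣≤ : ∀ a c → ℤ.∣ c ∣ ≤ distance a c ℕ.+ ℤ.∣ a ∣
∣c∣≤ a c = subst₂ _≤_ (cong ℤ.∣_∣ (lemma a c)) (ℕ.+-comm ℤ.∣ a ∣ _) (ℤ.∣i-j∣≤∣i∣+∣j∣ a (a ℤ.- c))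
  where
  open import Data.Integer.Solver
  open +-*-Solver
  lemma : ∀ a c → a ℤ.- (a ℤ.- c) ≡ c
  lemma = solve 2 (λ a c → a :- (a :- c) := c) refl

∣a∣≤ : ∀ a c → ℤ.∣ a ∣ ≤ distance a c ℕ.+ ℤ.∣ c ∣
∣a∣≤ a c = subst (λ e → ℤ.∣ a ∣ ≤ e ℕ.+ ℤ.∣ c ∣) (distance-sym c a) (∣c∣≤ c a)

distance-opposite : ∀ a c → sameSign a c ≡ false → distance a c ≡ ℤ.∣ a ∣ ℕ.+ ℤ.∣ c ∣
distance-opposite +0 c eq = trans (cong ℤ.∣_∣ (ℤ.+-identityˡ (ℤ.- c))) (ℤ.∣-i∣≡∣i∣ c)
distance-opposite +[1+ m ] +0 eq = refl
distance-opposite +[1+ m ] -[1+ n ] eq = refl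
distance-opposite -[1+ m ] +0 eq = cong suc (sym (ℕ.+-identityʳ m))
distance-opposite -[1+ m ] +[1+ n ] eq = cong suc (sym (ℕ.+-suc m n))

toward : ℕ → ℤ → ℤ
toward k +[1+ _ ] = + k
toward k -[1+ _ ] = ℤ.- (+ k)
toward k +0       = +0

∣toward∣≤ : ∀ k a → ℤ.∣ toward k a ∣ ≤ k
∣toward∣≤ k +[1+ _ ] = ℕ.≤-refl
∣toward∣≤ k -[1+ _ ] = ℕ.≤-reflexive (ℤ.∣-i∣≡∣i∣ (+ k))
∣toward∣≤ k +0       = ℕ.z≤n

distance-toward : ∀ k a c → distance c (toward k a) ≤ ℤ.∣ c ∣ ℕ.+ k
distance-toward k a c = ℕ.≤-trans (ℤ.∣i-j∣≤∣i∣+∣j∣ c (toward k a)) (ℕ.+-monoʳ-≤ ℤ.∣ c ∣ (∣toward∣≤ k a))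

distance-toward-same : ∀ {k} a c → sameSign a c ≡ true → k ≤ ℤ.∣ c ∣ → distance c (toward k a) ℕ.+ k ≡ ℤ.∣ c ∣
distance-toward-same {k} +[1+ m ] +[1+ n ] eq k≤ =
  trans (cong (λ i → ℤ.∣ i ∣ ℕ.+ k) (trans (ℤ.[+m]-[+n]≡m⊖n (suc n) k) (ℤ.⊖-≥ k≤))) (ℕ.m∸n+n≡m k≤)
distance-toward-same {k} -[1+ m ] -[1+ n ] eq k≤ =
  trans (cong (ℕ._+ k) (trans (cong ℤ.∣_∣ (lemma (+[1+ n ]) (+ k)))
    (trans (ℤ.∣-i∣≡∣i∣ (+[1+ n ] ℤ.- + k)) (cong ℤ.∣_∣ (trans (ℤ.[+m]-[+n]≡m⊖n (suc n) k) (ℤ.⊖-≥ k≤)))))) (ℕ.m∸n+n≡m k≤)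
  where
  open import Data.Integer.Solver
  open +-*-Solver
  lemma : ∀ x y → (ℤ.- x) ℤ.- (ℤ.- y) ≡ ℤ.- (x ℤ.- y)
  lemma = solve 2 (λ x y → (:- x) :- (:- y) := :- (x :- y)) refl

-- At most two steps towards c overshoot it only if its absolute value is 1, and then they end at
-- distance 1 on the other side.
distance-toward-≤2 : ∀ {k} a c → sameSign a c ≡ true → k ≤ 2 → distance c (toward k a) ≤ ℤ.∣ c ∣
distance-toward-≤2 {k} a c same k≤2 with k ℕ.≤? ℤ.∣ c ∣
... | yes k≤ = ℕ.≤-trans (ℕ.m≤m+n _ k) (ℕ.≤-reflexive (distance-toward-same a c same k≤))
... | no  k≰ = go a c same k≤2 k≰
  where
  go : ∀ {k} a c → sameSign a c ≡ true → k ≤ 2 → ¬ k ≤ ℤ.∣ c ∣ → distance c (toward k a) ≤ ℤ.∣ c ∣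
  go +0       c            () k≤2 k≰
  go +[1+ m ] +0           () k≤2 k≰
  go +[1+ m ] -[1+ n ]     () k≤2 k≰
  go -[1+ m ] (+ n)        () k≤2 k≰
  go +[1+ m ] +[1+ suc n ] _ k≤2 k≰ = contradiction (ℕ.≤-trans k≤2 (ℕ.s≤s (ℕ.s≤s ℕ.z≤n))) k≰
  go -[1+ m ] -[1+ suc n ] _ k≤2 k≰ = contradiction (ℕ.≤-trans k≤2 (ℕ.s≤s (ℕ.s≤s ℕ.z≤n))) k≰
  go +[1+ m ] +[1+ 0 ]     _ ℕ.z≤n k≰ = contradiction ℕ.z≤n k≰
  go +[1+ m ] +[1+ 0 ]     _ (ℕ.s≤s ℕ.z≤n) k≰ = contradiction ℕ.≤-refl k≰
  go +[1+ m ] +[1+ 0 ]     _ (ℕ.s≤s (ℕ.s≤s ℕ.z≤n)) k≰ = ℕ.≤-refl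
  go -[1+ m ] -[1+ 0 ]     _ ℕ.z≤n k≰ = contradiction ℕ.z≤n k≰
  go -[1+ m ] -[1+ 0 ]     _ (ℕ.s≤s ℕ.z≤n) k≰ = contradiction ℕ.≤-refl k≰
  go -[1+ m ] -[1+ 0 ]     _ (ℕ.s≤s (ℕ.s≤s ℕ.z≤n)) k≰ = ℕ.≤-refl

-- The part of a which c fails to share, on the coordinates where a is not positive.
excess : Bool → ℤ → ℤ → ℕ
excess s a c = if positive s a then 0 else if sameSign a c then ℤ.∣ a ∣ ℕ.∸ ℤ.∣ c ∣ else ℤ.∣ a ∣

private
  excess-same : ∀ a c → ℤ.∣ c ∣ ℕ.+ (ℤ.∣ a ∣ ℕ.∸ ℤ.∣ c ∣ ℕ.+ (ℤ.∣ a ∣ ℕ.∸ ℤ.∣ c ∣)) ≤ distance a c ℕ.+ ℤ.∣ a ∣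
  excess-same a c with ℤ.∣ a ∣ ℕ.≤? ℤ.∣ c ∣
  ... | yes a≤c = subst (λ e → ℤ.∣ c ∣ ℕ.+ (e ℕ.+ e) ≤ distance a c ℕ.+ ℤ.∣ a ∣) (sym (ℕ.m≤n⇒m∸n≡0 a≤c))
                    (subst (_≤ distance a c ℕ.+ ℤ.∣ a ∣) (sym (ℕ.+-identityʳ ℤ.∣ c ∣)) (∣c∣≤ a c))
  ... | no  a≰c = go (ℕ.m∸n+n≡m (ℕ.<⇒≤ (ℕ.≰⇒> a≰c))) (∣a∣≤ a c)
    where
    go : ∀ {A C D E} → E ℕ.+ C ≡ A → A ≤ D ℕ.+ C → C ℕ.+ (E ℕ.+ E) ≤ D ℕ.+ A
    go {C = C} {D} {E} refl h = linear (C ℕ.+ (E ℕ.+ E)) (D ℕ.+ (E ℕ.+ C)) 0 0 (ℕ.+-monoʳ-≤ E h) (e₁ C E) (e₂ C D E)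
      where
      e₁ : ∀ C E → E ℕ.+ (E ℕ.+ C) ≡ C ℕ.+ (E ℕ.+ E) ℕ.+ 0 ℕ.+ 0
      e₁ = solve-∀
      e₂ : ∀ C D E → E ℕ.+ (D ℕ.+ C) ≡ D ℕ.+ (E ℕ.+ C) ℕ.+ 0
      e₂ = solve-∀

  excess-opposite : ∀ a c → sameSign a c ≡ false → ℤ.∣ c ∣ ℕ.+ (ℤ.∣ a ∣ ℕ.+ ℤ.∣ a ∣) ≤ distance a c ℕ.+ ℤ.∣ a ∣
  excess-opposite a c opp rewrite distance-opposite a c opp = ℕ.≤-reflexive (e ℤ.∣ a ∣ ℤ.∣ c ∣)
    where
    e : ∀ A C → C ℕ.+ (A ℕ.+ A) ≡ A ℕ.+ C ℕ.+ A
    e = solve-∀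

-- Where a is positive, c is not, and their distance is the sum of the absolute values. Elsewhere
-- `excess` is twice counted because an unshared part of a both lengthens the distance and belongs
-- to the loss.
disjoint-local : ∀ s a c → positive s a ∧ positive s c ≡ false →
  gain s a ℕ.+ ℤ.∣ c ∣ ℕ.+ (excess s a c ℕ.+ excess s a c) ≤ distance a c ℕ.+ loss s a
disjoint-local true +[1+ m ] +0       disj = ℕ.≤-refl
disjoint-local true +[1+ m ] -[1+ n ] disj = ℕ.≤-refl
disjoint-local true +0       c disj = excess-opposite +0 c refl
disjoint-local true -[1+ m ] c disj with sameSign -[1+ m ] c in eq
... | true  = excess-same -[1+ m ] c
... | false = excess-opposite -[1+ m ] c eq
disjoint-local false a c disj with sameSign a c in eq
... | true  = excess-same a c
... | false = excess-opposite a c eq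

-- Without a marked direction both signs are negative.
negative : Bool → ℤ → Bool
negative true  -[1+ _ ] = true
negative true  _        = false
negative false +0       = false
negative false _        = true

negative-loss : ∀ s a → loss s a ≢ 0 → negative s a ≡ true
negative-loss true  +0       h = contradiction refl h
negative-loss true  +[1+ _ ] h = contradiction refl h
negative-loss true  -[1+ _ ] h = refl
negative-loss false +0       h = contradiction refl h
negative-loss false +[1+ _ ] h = refl
negative-loss false -[1+ _ ] h = refl

negative⇒ : ∀ s a → negative s a ≡ true → positive s a ≡ false × a ≢ +0
negative⇒ true  -[1+ _ ] _ = refl , λ ()
negative⇒ false +[1+ _ ] _ = refl , λ ()
negative⇒ false -[1+ _ ] _ = refl , λ ()

positive-direction : ∀ {s a} → positive s a ≡ true → s ≡ true
positive-direction {true} _ = refl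

positive-gain : ∀ s a → ⟦ positive s a ⟧ ≤ gain s a
positive-gain true  +[1+ n ] = ℕ.s≤s ℕ.z≤n
positive-gain true  +0       = ℕ.z≤n
positive-gain true  -[1+ _ ] = ℕ.z≤n
positive-gain false _        = ℕ.z≤n

gain+loss : ∀ s a → gain s a ℕ.+ loss s a ≡ ℤ.∣ a ∣
gain+loss s a with positive s a
... | true  = ℕ.+-identityʳ _
... | false = refl

neither⇒0 : ∀ s a → positive s a ≡ false → negative s a ≡ false → a ≡ +0
neither⇒0 true  +0 _ _ = refl
neither⇒0 false +0 _ _ = refl
neither⇒0 true  +[1+ _ ] () _
neither⇒0 true  -[1+ _ ] _ ()
neither⇒0 false +[1+ _ ] _ ()
neither⇒0 false -[1+ _ ] _ ()

-- A coordinate negative for a and positive for b would be entirely unshared and have positive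
-- excess.
three-local : ∀ s a b → positive s a ∧ positive s b ≡ false → excess s a b ≡ 0 →
  ⟦ positive s a ⟧ ℕ.+ ⟦ positive s b ⟧ ℕ.+ ⟦ negative s a ⟧ ≤ 1
three-local true  +[1+ _ ] +0       _ _ = ℕ.≤-refl
three-local true  +[1+ _ ] -[1+ _ ] _ _ = ℕ.≤-refl
three-local true  +0       +0       _ _ = ℕ.z≤n
three-local true  +0       +[1+ _ ] _ _ = ℕ.≤-refl
three-local true  +0       -[1+ _ ] _ _ = ℕ.z≤n
three-local true  -[1+ _ ] -[1+ _ ] _ _ = ℕ.≤-refl
three-local false +0       _        _ _ = ℕ.z≤n
three-local false +[1+ _ ] _        _ _ = ℕ.≤-refl
three-local false -[1+ _ ] _        _ _ = ℕ.≤-refl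

excess-own : ∀ s a c → ⟦ negative s a ∧ positive s c ⟧ ≤ excess s a c
excess-own true  -[1+ _ ] +[1+ _ ] = ℕ.s≤s ℕ.z≤n
excess-own true  -[1+ _ ] +0       = ℕ.z≤n
excess-own true  -[1+ _ ] -[1+ _ ] = ℕ.z≤n
excess-own true  +0       _        = ℕ.z≤n
excess-own true  +[1+ _ ] _        = ℕ.z≤n
excess-own false +0       _        = ℕ.z≤n
excess-own false +[1+ _ ] _        = ℕ.z≤n
excess-own false -[1+ _ ] _        = ℕ.z≤n

-- Zero excess forces b to follow a at its negative coordinates. So b is negative there as well, and
-- a positive c leaves at least one unit of b unshared.
excess-other : ∀ s a b c → excess s a b ≡ 0 → ⟦ negative s a ∧ positive s c ⟧ ≤ excess s b c
excess-other true  -[1+ _ ] -[1+ _ ] +[1+ _ ] _ = ℕ.s≤s ℕ.z≤n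
excess-other true  -[1+ _ ] -[1+ _ ] +0       _ = ℕ.z≤n
excess-other true  -[1+ _ ] -[1+ _ ] -[1+ _ ] _ = ℕ.z≤n
excess-other true  +0       _ _ _ = ℕ.z≤n
excess-other true  +[1+ _ ] _ _ _ = ℕ.z≤n
excess-other false +0       _ _ _ = ℕ.z≤n
excess-other false +[1+ _ ] _ _ _ = ℕ.z≤n
excess-other false -[1+ _ ] _ _ _ = ℕ.z≤n

unit : Bool → ℤ
unit t = if t then + 1 else +0

-- A unit step shortens the distance to a positive c by one and lengthens it by at most one
-- otherwise; the two differ by 2.
indicator-local : ∀ s t c → (t ≡ true → s ≡ true) →
  distance c (unit t) ℕ.+ (⟦ t ∧ positive s c ⟧ ℕ.+ ⟦ t ∧ positive s c ⟧) ≤ ℤ.∣ c ∣ ℕ.+ ⟦ t ⟧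
indicator-local s     false c        _ = ℕ.≤-reflexive (cong (λ i → ℤ.∣ i ∣ ℕ.+ 0) (ℤ.+-identityʳ c))
indicator-local false true  c        h = contradiction (h refl) (λ ())
indicator-local true  true  +0       _ = ℕ.≤-refl
indicator-local true  true  +[1+ n ] _ = ℕ.≤-reflexive (ℕ.+-suc n 1)
indicator-local true  true  -[1+ n ] _ = ℕ.≤-reflexive (e n)
  where
  e : ∀ n → suc (suc (n ℕ.+ 0)) ℕ.+ 0 ≡ suc n ℕ.+ 1
  e = solve-∀

private
  opposite-local : ∀ a c → sameSign a c ≡ false → ℤ.∣ c ∣ ℕ.+ 0 ℕ.+ ℤ.∣ a ∣ ≤ distance a c ℕ.+ 0 ℕ.+ 0
  opposite-local a c opp rewrite distance-opposite a c opp = ℕ.≤-reflexive (e ℤ.∣ a ∣ ℤ.∣ c ∣)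
    where
    e : ∀ A C → C ℕ.+ 0 ℕ.+ A ≡ A ℕ.+ C ℕ.+ 0 ℕ.+ 0
    e = solve-∀

-- At a common positive coordinate this is the triangle inequality; where only a is positive, the
-- distance is the sum of absolute values and a contributes at least 1 twice; elsewhere c opposes a.
partial-local : ∀ s a c → (positive s a ≡ false → sameSign a c ≡ false) →
  ℤ.∣ c ∣ ℕ.+ (⟦ positive s a ⟧ ℕ.+ ⟦ positive s a ⟧) ℕ.+ loss s a ℕ.≤
  distance a c ℕ.+ gain s a ℕ.+ (⟦ positive s a ∧ positive s c ⟧ ℕ.+ ⟦ positive s a ∧ positive s c ⟧)
partial-local true +[1+ m ] +[1+ n ] _ =
  subst (_≤ distance +[1+ m ] +[1+ n ] ℕ.+ suc m ℕ.+ 2) (sym (ℕ.+-identityʳ (suc n ℕ.+ 2)))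
    (ℕ.+-monoˡ-≤ 2 (∣c∣≤ +[1+ m ] +[1+ n ]))
partial-local true +[1+ m ] +0 _ = linear 2 _ 0 (m ℕ.+ m) ℕ.≤-refl (e m) (sym (ℕ.+-identityʳ _))
  where
  e : ∀ m → suc (m ℕ.+ 0) ℕ.+ suc m ℕ.+ 0 ≡ 2 ℕ.+ 0 ℕ.+ (m ℕ.+ m)
  e = solve-∀
partial-local true +[1+ m ] -[1+ n ] _ = linear (suc n ℕ.+ 2 ℕ.+ 0) _ 0 (m ℕ.+ m) ℕ.≤-refl (e m n) (sym (ℕ.+-identityʳ _))
  where
  e : ∀ m n → suc m ℕ.+ suc n ℕ.+ suc m ℕ.+ 0 ≡ suc n ℕ.+ 2 ℕ.+ 0 ℕ.+ 0 ℕ.+ (m ℕ.+ m)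
  e = solve-∀
partial-local true  +0       c h = opposite-local +0 c (h refl)
partial-local true  -[1+ m ] c h = opposite-local -[1+ m ] c (h refl)
partial-local false a        c h = opposite-local a c (h refl)

positive-toward : ∀ s k a → positive s a ≡ false → positive s (toward k a) ≡ false
positive-toward false k       a        _ = refl
positive-toward true  k       +0       _ = refl
positive-toward true  zero    -[1+ _ ] _ = refl
positive-toward true  (suc k) -[1+ _ ] _ = refl

∣toward∣ : ∀ k a → a ≢ +0 → ℤ.∣ toward k a ∣ ≡ k
∣toward∣ k +0       a≢0 = contradiction refl a≢0
∣toward∣ k +[1+ _ ] _   = refl
∣toward∣ k -[1+ _ ] _   = ℤ.∣-i∣≡∣i∣ (+ k)

-- Domination

module Core (r : ℕ) (10≤r : 10 ≤ r) {n : ℕ} (n≤6 : n ≤ 6) (S : Fin n → Bool) where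

  Coords : Set
  Coords = Fin n → ℤ

  ∥_∥ : Coords → ℕ
  ∥ a ∥ = Sum (λ i → ℤ.∣ a i ∣)

  dist : Coords → Coords → ℕ
  dist a c = Sum (λ i → distance (a i) (c i))

  pos neg : Coords → Fin n → Bool
  pos a i = positive (S i) (a i)
  neg a i = negative (S i) (a i)

  Gain Loss : Coords → ℕ
  Gain a = Sum (λ i → gain (S i) (a i))
  Loss a = Sum (λ i → loss (S i) (a i))

  Excess : Coords → Coords → ℕ
  Excess a c = Sum (λ i → excess (S i) (a i) (c i))

  card : (Fin n → Bool) → ℕ
  card T = Sum (λ i → ⟦ T i ⟧)

  meet : (Fin n → Bool) → Coords → ℕ
  meet T c = Sum (λ i → ⟦ T i ∧ pos c i ⟧)

  ind : (Fin n → Bool) → Coords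
  ind T i = unit (T i)

  Leads : Coords → Set
  Leads a = ∃[ i ] pos a i ≡ true × (∀ j → j Fin.< i → a j ≡ +0)

  -- Positive coordinates must be single steps so that none passes beyond 0 and `Gain` is the exact
  -- decrease of the norm.
  record Descends (w : Coords) : Set where
    field
      units : ∀ i → pos w i ≡ true → w i ≡ + 1
      below : Loss w < Gain w ⊎ (Loss w ≡ Gain w × Leads w)

  -- The vector `ind S` may have norm 6, but it is unique. All other candidates have norm at most 4,
  -- which gives mutual distances of at most 6 + 4.
  data Candidate (w : Coords) : Set where
    full  : (∀ i → w i ≡ ind S i) → Candidate w
    small : ∥ w ∥ ≤ 4 → Descends w → Candidate w

  record Below (a : Coords) : Set where
    field
      bounded : ∥ a ∥ ≤ r
      rises   : Loss a ≤ Gain a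
      ties    : Loss a ≡ Gain a → Leads a

  Gain+Loss : ∀ a → Gain a ℕ.+ Loss a ≡ ∥ a ∥
  Gain+Loss a = trans (sym (Sum-+ (λ i → gain (S i) (a i)) (λ i → loss (S i) (a i)))) (Sum-cong (λ i → gain+loss (S i) (a i)))

  ⟦⟧≡0 : ∀ {t} → ⟦ t ⟧ ≡ 0 → t ≡ false
  ⟦⟧≡0 {false} _ = refl

  ⟦⟧≢0 : ∀ {t} → ⟦ t ⟧ ≢ 0 → t ≡ true
  ⟦⟧≢0 {false} h = contradiction refl h
  ⟦⟧≢0 {true}  _ = refl

  ⟦⟧≤1 : ∀ t → ⟦ t ⟧ ≤ 1
  ⟦⟧≤1 true  = ℕ.≤-refl
  ⟦⟧≤1 false = ℕ.z≤n

  -- If c is positive at no coordinate where a is, only the losses of a can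
  -- bring a and c closer together.
  disjoint : ∀ a c → meet (pos a) c ≡ 0 → Gain a ℕ.+ ∥ c ∥ ℕ.+ (Excess a c ℕ.+ Excess a c) ≤ dist a c ℕ.+ Loss a
  disjoint a c m≡0 = subst₂ _≤_
    (trans (Sum-+ (λ i → gain (S i) (a i) ℕ.+ ℤ.∣ c i ∣) (λ i → excess (S i) (a i) (c i) ℕ.+ excess (S i) (a i) (c i)))
      (cong₂ ℕ._+_ (Sum-+ (λ i → gain (S i) (a i)) (λ i → ℤ.∣ c i ∣)) (Sum-+ (λ i → excess (S i) (a i) (c i)) (λ i → excess (S i) (a i) (c i)))))
    (Sum-+ (λ i → distance (a i) (c i)) (λ i → loss (S i) (a i)))
    (Sum-mono (λ i → disjoint-local (S i) (a i) (c i) (⟦⟧≡0 (Sum-zero⁻ (λ i → ⟦ pos a i ∧ pos c i ⟧) m≡0 i))))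

  indicator : ∀ T c → (∀ i → T i ≡ true → S i ≡ true) → dist c (ind T) ℕ.+ (meet T c ℕ.+ meet T c) ≤ ∥ c ∥ ℕ.+ card T
  indicator T c T⊆S = subst₂ _≤_
    (trans (Sum-+ (λ i → distance (c i) (ind T i)) (λ i → ⟦ T i ∧ pos c i ⟧ ℕ.+ ⟦ T i ∧ pos c i ⟧))
      (cong (dist c (ind T) ℕ.+_) (Sum-+ (λ i → ⟦ T i ∧ pos c i ⟧) (λ i → ⟦ T i ∧ pos c i ⟧))))
    (Sum-+ (λ i → ℤ.∣ c i ∣) (λ i → ⟦ T i ⟧))
    (Sum-mono (λ i → indicator-local (S i) (T i) (c i) (T⊆S i)))

  pos⊆S : ∀ a i → pos a i ≡ true → S i ≡ true
  pos⊆S a i = positive-direction {S i} {a i}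

  -- Bookkeeping for a vertex w that makes k steps: c, of norm N, approves m of them and saves 2 for
  -- each; `δ⁺` and `δ⁻` account for the corrected coordinate, and x is the room that c leaves below
  -- r.
  fit : ∀ D m N k δ⁺ δ⁻ x → D ℕ.+ (m ℕ.+ m) ℕ.+ δ⁻ ≤ N ℕ.+ k ℕ.+ δ⁺ → N ℕ.+ x ≤ r →
        k ℕ.+ δ⁺ ≤ m ℕ.+ m ℕ.+ δ⁻ ℕ.+ x → D ≤ r
  fit D m N k δ⁺ δ⁻ x h room h′ = linear D r (m ℕ.+ m ℕ.+ δ⁻ ℕ.+ N ℕ.+ x ℕ.+ k ℕ.+ δ⁺) 0
    (ℕ.+-mono-≤ (ℕ.+-mono-≤ h room) h′) (e₁ D m N k δ⁺ δ⁻ x) (e₂ r m N k δ⁺ δ⁻ x)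
    where
    e₁ : ∀ D m N k δ⁺ δ⁻ x → D ℕ.+ (m ℕ.+ m) ℕ.+ δ⁻ ℕ.+ (N ℕ.+ x) ℕ.+ (k ℕ.+ δ⁺) ≡ D ℕ.+ (m ℕ.+ m ℕ.+ δ⁻ ℕ.+ N ℕ.+ x ℕ.+ k ℕ.+ δ⁺) ℕ.+ 0
    e₁ = solve-∀
    e₂ : ∀ r m N k δ⁺ δ⁻ x → N ℕ.+ k ℕ.+ δ⁺ ℕ.+ r ℕ.+ (m ℕ.+ m ℕ.+ δ⁻ ℕ.+ x) ≡ r ℕ.+ (m ℕ.+ m ℕ.+ δ⁻ ℕ.+ N ℕ.+ x ℕ.+ k ℕ.+ δ⁺)
    e₂ = solve-∀

  twice : ∀ k {m} → k ≤ m → k ℕ.+ k ≤ m ℕ.+ m ℕ.+ 0 ℕ.+ 0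
  twice k {m} k≤m = subst (k ℕ.+ k ≤_) (e m) (ℕ.+-mono-≤ k≤m k≤m)
    where
    e : ∀ m → m ℕ.+ m ≡ m ℕ.+ m ℕ.+ 0 ℕ.+ 0
    e = solve-∀

  shift : (Fin n → Bool) → Fin n → ℕ → Coords → Coords
  shift T j k a i = if does (i Fin.≟ j) then toward k (a j) else ind T i

  module Shift (T : Fin n → Bool) (T⊆S : ∀ i → T i ≡ true → S i ≡ true) {j : Fin n} (Tj : T j ≡ false) (k : ℕ) (a : Coords) where

    w : Coords
    w = shift T j k a

    shift-dist : ∀ c {δ⁻ δ⁺} → distance (c j) (toward k (a j)) ℕ.+ δ⁻ ≤ ℤ.∣ c j ∣ ℕ.+ δ⁺ →
                 dist c w ℕ.+ (meet T c ℕ.+ meet T c) ℕ.+ δ⁻ ≤ ∥ c ∥ ℕ.+ card T ℕ.+ δ⁺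
    shift-dist c {δ⁻} {δ⁺} h = subst₂ _≤_
      (trans (Sum-+ (λ i → distance (c i) (w i) ℕ.+ (m i ℕ.+ m i)) (at j δ⁻))
        (cong₂ ℕ._+_ (trans (Sum-+ (λ i → distance (c i) (w i)) (λ i → m i ℕ.+ m i)) (cong (dist c w ℕ.+_) (Sum-+ m m))) (Sum-at j δ⁻)))
      (trans (Sum-+ (λ i → ℤ.∣ c i ∣ ℕ.+ ⟦ T i ⟧) (at j δ⁺))
        (cong₂ ℕ._+_ (Sum-+ (λ i → ℤ.∣ c i ∣) (λ i → ⟦ T i ⟧)) (Sum-at j δ⁺)))
      (Sum-mono local)
      where
      m : Fin n → ℕ
      m i = ⟦ T i ∧ pos c i ⟧
      local : ∀ i → distance (c i) (w i) ℕ.+ (m i ℕ.+ m i) ℕ.+ at j δ⁻ i ≤ ℤ.∣ c i ∣ ℕ.+ ⟦ T i ⟧ ℕ.+ at j δ⁺ i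
      local i with i Fin.≟ j
      ... | yes refl rewrite Tj = subst₂ _≤_ (e _ δ⁻) (e _ δ⁺) h
        where
        e : ∀ x y → x ℕ.+ y ≡ x ℕ.+ 0 ℕ.+ y
        e = solve-∀
      ... | no _ = ℕ.+-monoˡ-≤ 0 (indicator-local (S i) (T i) (c i) (T⊆S i))

    shift-fit : ∀ c δ⁻ δ⁺ x {q m} → distance (c j) (toward k (a j)) ℕ.+ δ⁻ ≤ ℤ.∣ c j ∣ ℕ.+ δ⁺ → ∥ c ∥ ℕ.+ x ≤ r →
                card T ≡ q → meet T c ≡ m → q ℕ.+ δ⁺ ≤ m ℕ.+ m ℕ.+ δ⁻ ℕ.+ x → dist c w ≤ r
    shift-fit c δ⁻ δ⁺ x h room refl refl = fit (dist c w) (meet T c) ∥ c ∥ (card T) δ⁺ δ⁻ x (shift-dist c {δ⁻} {δ⁺} h) room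

    module _ (pos-j : pos a j ≡ false) (a≢0 : a j ≢ +0) where

      pos-w : ∀ i → pos w i ≡ T i
      pos-w i with i Fin.≟ j
      ... | yes refl = trans (positive-toward (S j) k (a j) pos-j) (sym Tj)
      ... | no  _ with T i in eq
      ...   | false = positive-0 (S i)
      ...   | true rewrite T⊆S i eq = refl

      units-w : ∀ i → pos w i ≡ true → w i ≡ + 1
      units-w i pos-i with trans (sym (pos-w i)) pos-i
      ... | Ti with i Fin.≟ j
      ...   | yes refl = contradiction (trans (sym Ti) Tj) (λ ())
      ...   | no  _ rewrite Ti = refl

      gain-w : Gain w ≡ card T
      gain-w = Sum-cong local
        where
        local : ∀ i → gain (S i) (w i) ≡ ⟦ T i ⟧
        local i with positive (S i) (w i) in eq
        ... | false = cong ⟦_⟧ (trans (sym eq) (pos-w i))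
        ... | true  = trans (cong ℤ.∣_∣ (units-w i eq)) (cong ⟦_⟧ (trans (sym eq) (pos-w i)))

      loss-w : Loss w ≡ k
      loss-w = trans (Sum-cong local) (Sum-at j k)
        where
        local : ∀ i → loss (S i) (w i) ≡ at j k i
        local i with i Fin.≟ j
        ... | yes refl rewrite positive-toward (S j) k (a j) pos-j = ∣toward∣ k (a j) a≢0
        ... | no  _ with T i in eq
        ...   | true rewrite T⊆S i eq = refl
        ...   | false with S i
        ...     | true  = refl
        ...     | false = refl

      norm-w : ∥ w ∥ ≡ card T ℕ.+ k
      norm-w = trans (sym (Gain+Loss w)) (cong₂ ℕ._+_ gain-w loss-w)

  -- The coordinate j cannot precede the leading one, because a vanishes there but not at j.
  leads-shift : ∀ a {j} → (pos-j : pos a j ≡ false) → a j ≢ +0 → ∀ k → Leads a → Leads (shift (pos a) j k a)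
  leads-shift a {j} pos-j a≢0 k (i , pos-i , zeros) = i , trans (Shift.pos-w (pos a) (pos⊆S a) pos-j k a pos-j a≢0 i) pos-i , zeros′
    where
    zeros′ : ∀ i′ → i′ Fin.< i → shift (pos a) j k a i′ ≡ +0
    zeros′ i′ i′<i with i′ Fin.≟ j
    ... | yes refl = contradiction (zeros j i′<i) a≢0
    ... | no  _    = cong unit (trans (cong (positive (S i′)) (zeros i′ i′<i)) (positive-0 (S i′)))

  same⇒1≤ : ∀ a c → sameSign a c ≡ true → 1 ≤ ℤ.∣ c ∣
  same⇒1≤ +[1+ _ ] +[1+ _ ] _ = ℕ.s≤s ℕ.z≤n
  same⇒1≤ -[1+ _ ] -[1+ _ ] _ = ℕ.s≤s ℕ.z≤n

  1≤∣∣ : ∀ {a} → a ≢ +0 → 1 ≤ ℤ.∣ a ∣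
  1≤∣∣ {+0}       h = contradiction refl h
  1≤∣∣ {+[1+ _ ]} _ = ℕ.s≤s ℕ.z≤n
  1≤∣∣ { -[1+ _ ]} _ = ℕ.s≤s ℕ.z≤n

  excess≥ : ∀ a c {j} → pos a j ≡ false → sameSign (a j) (c j) ≡ false → ℤ.∣ a j ∣ ≤ Excess a c
  excess≥ a c {j} pos-j opp = ℕ.≤-trans (ℕ.≤-reflexive eq) (≤Sum (λ i → excess (S i) (a i) (c i)) j)
    where
    eq : ℤ.∣ a j ∣ ≡ excess (S j) (a j) (c j)
    eq rewrite pos-j | opp = refl

  excess≥-same : ∀ a c {j} → pos a j ≡ false → sameSign (a j) (c j) ≡ true → ℤ.∣ a j ∣ ℕ.∸ ℤ.∣ c j ∣ ≤ Excess a c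
  excess≥-same a c {j} pos-j same = ℕ.≤-trans (ℕ.≤-reflexive eq) (≤Sum (λ i → excess (S i) (a i) (c i)) j)
    where
    eq : ℤ.∣ a j ∣ ℕ.∸ ℤ.∣ c j ∣ ≡ excess (S j) (a j) (c j)
    eq rewrite pos-j | same = refl

  -- Without positive coordinates the gain is 0, so there is a tie, and a tie has a positive leading
  -- coordinate.
  card-pos≢0 : ∀ {a} → Below a → card (pos a) ≢ 0
  card-pos≢0 {a} B card≡0 = clash (Below.ties B (ℕ.≤-antisym (Below.rises B) (ℕ.≤-trans (ℕ.≤-reflexive gain≡0) ℕ.z≤n)))
    where
    not-pos : ∀ i → pos a i ≡ false
    not-pos i = ⟦⟧≡0 (Sum-zero⁻ (λ i → ⟦ pos a i ⟧) card≡0 i)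
    gain≡0 : Gain a ≡ 0
    gain≡0 = Sum-zero (λ i → gain (S i) (a i)) λ i → cong (λ t → if t then ℤ.∣ a i ∣ else 0) (not-pos i)
    clash : Leads a → ⊥
    clash (i , pos-i , _) = contradiction (trans (sym pos-i) (not-pos i)) (λ ())

  gain-ind : ∀ T → (∀ i → T i ≡ true → S i ≡ true) → ∀ i → gain (S i) (ind T i) ≡ ⟦ T i ⟧ × loss (S i) (ind T i) ≡ 0
  gain-ind T T⊆S i with T i in eq
  ... | true rewrite T⊆S i eq = refl , refl
  ... | false with S i
  ...   | true  = refl , refl
  ...   | false = refl , refl

  descends-ind : ∀ T → (∀ i → T i ≡ true → S i ≡ true) → card T ≢ 0 → card T ≤ 4 → Candidate (ind T)
  descends-ind T T⊆S card≢0 card≤4 = small (subst (_≤ 4) (sym norm) card≤4) record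
    { units = units
    ; below = inj₁ (subst₂ _<_ (sym loss≡) (sym gain≡) (ℕ.n≢0⇒n>0 card≢0))
    }
    where
    gain≡ : Gain (ind T) ≡ card T
    gain≡ = Sum-cong (λ i → proj₁ (gain-ind T T⊆S i))
    loss≡ : Loss (ind T) ≡ 0
    loss≡ = Sum-zero (λ i → loss (S i) (ind T i)) (λ i → proj₂ (gain-ind T T⊆S i))
    norm : ∥ ind T ∥ ≡ card T
    norm = trans (sym (Gain+Loss (ind T))) (trans (cong₂ ℕ._+_ gain≡ loss≡) (ℕ.+-identityʳ _))
    units : ∀ i → pos (ind T) i ≡ true → ind T i ≡ + 1
    units i pos-i with T i
    ... | true = refl
    ... | false with S i
    units i () | false | true
    units i () | false | false

  module Dominate (τ : List Coords) (below : ∀ {a} → a ∈ τ → Below a) (near : ∀ {a c} → a ∈ τ → c ∈ τ → dist a c ≤ r) where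

    Good : Coords → Set
    Good w = ∀ {c} → c ∈ τ → dist c w ≤ r

    Dominated : Set
    Dominated = ∃[ w ] Candidate w × Good w

    test : ∀ w → Good w ⊎ (∃[ c ] c ∈ τ × r < dist c w)
    test w with All.all? (λ c → dist c w ℕ.≤? r) τ
    ... | yes good = inj₁ (All.lookup good)
    ... | no  bad  = let (c , c∈ , far) = find (All.¬All⇒Any¬ (λ c → dist c w ℕ.≤? r) τ bad) in inj₂ (c , c∈ , ℕ.≰⇒> far)

    norm≤r : ∀ {c} → c ∈ τ → ∥ c ∥ ℕ.+ 0 ≤ r
    norm≤r {c} c∈ = subst (_≤ r) (sym (ℕ.+-identityʳ ∥ c ∥)) (Below.bounded (below c∈))

    module _ {a : Coords} (a∈ : a ∈ τ) where

      open Below (below a∈)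

      A : Fin n → Bool
      A = pos a

      disjoint≤ : ∀ {c} → c ∈ τ → meet A c ≡ 0 → Gain a ℕ.+ ∥ c ∥ ℕ.+ (Excess a c ℕ.+ Excess a c) ≤ r ℕ.+ Loss a
      disjoint≤ {c} c∈ m≡0 = ℕ.≤-trans (disjoint a c m≡0) (ℕ.+-monoˡ-≤ (Loss a) (near a∈ c∈))

      room : ∀ {c k} → c ∈ τ → meet A c ≡ 0 → k ≤ Excess a c → ∥ c ∥ ℕ.+ (k ℕ.+ k) ≤ r
      room {c} {k} c∈ m≡0 k≤ = go (disjoint≤ c∈ m≡0) rises k≤
        where
        go : ∀ {G n E L r k} → G ℕ.+ n ℕ.+ (E ℕ.+ E) ≤ r ℕ.+ L → L ≤ G → k ≤ E → n ℕ.+ (k ℕ.+ k) ≤ r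
        go {G} {n} {E} {L} {r} {k} h L≤G k≤E = linear (n ℕ.+ (k ℕ.+ k)) r (G ℕ.+ L ℕ.+ (E ℕ.+ E)) 0
          (ℕ.+-mono-≤ (ℕ.+-mono-≤ h L≤G) (ℕ.+-mono-≤ k≤E k≤E)) (e₁ G n E L k) (e₂ G E L r)
          where
          e₁ : ∀ G n E L k → G ℕ.+ n ℕ.+ (E ℕ.+ E) ℕ.+ L ℕ.+ (k ℕ.+ k) ≡ n ℕ.+ (k ℕ.+ k) ℕ.+ (G ℕ.+ L ℕ.+ (E ℕ.+ E)) ℕ.+ 0
          e₁ = solve-∀
          e₂ : ∀ G E L r → r ℕ.+ L ℕ.+ G ℕ.+ (E ℕ.+ E) ≡ r ℕ.+ (G ℕ.+ L ℕ.+ (E ℕ.+ E))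
          e₂ = solve-∀

      -- One common positive coordinate would save 2, which already pays for all steps of `ind A`.
      far⇒disjoint : ∀ {b} → b ∈ τ → card A ≤ 2 → r < dist b (ind A) → meet A b ≡ 0 × r < ∥ b ∥ ℕ.+ card A
      far⇒disjoint {b} b∈ card≤2 far = m≡0 (indicator A b (pos⊆S a)) , ℕ.≤-trans (ℕ.≤-trans far (ℕ.m≤m+n _ _)) (indicator A b (pos⊆S a))
        where
        m≡0 : ∀ {m} → dist b (ind A) ℕ.+ (m ℕ.+ m) ≤ ∥ b ∥ ℕ.+ card A → m ≡ 0
        m≡0 {zero}  h = refl
        m≡0 {suc m} h = ⊥-elim (absurd (m ℕ.+ m) (ℕ.≤-trans (ℕ.+-monoˡ-≤ (suc m ℕ.+ suc m) far)
          (ℕ.≤-trans h (ℕ.+-mono-≤ (Below.bounded (below b∈)) card≤2))) (e r m))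
          where
          e : ∀ r m → suc r ℕ.+ (suc m ℕ.+ suc m) ≡ suc (r ℕ.+ 2 ℕ.+ (m ℕ.+ m))
          e = solve-∀

      loss-witness : Loss a ≢ 0 → ∃[ j ] neg a j ≡ true
      loss-witness loss≢0 = let (j , h) = Sum-witness (λ i → loss (S i) (a i)) loss≢0 in j , negative-loss (S j) (a j) h

      -- If the single step fails for some b, then b has norm at least r and is disjoint from a,
      -- which forces a tie of gain and loss. One step along a at a negative coordinate j is then
      -- affordable for the order. A member c that meets A saves 2; one that follows a at j saves 1
      -- there; any other has excess at least 1 and hence two units of room.
      single : card A ≡ 1 → Dominated
      single card≡1 =
        [ (λ good → ind A , descends-ind A (pos⊆S a) (λ eq → ℕ.0≢1+n (trans (sym eq) card≡1))
            (subst (_≤ 4) (sym card≡1) (ℕ.s≤s ℕ.z≤n)) , good) , tie ]′ (test (ind A))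
        where
        tie : ∃[ b ] b ∈ τ × r < dist b (ind A) → Dominated
        tie (b , b∈ , far) = shift A j 1 a , small norm≤4 descends , good
          where
          m≡0 : meet A b ≡ 0
          m≡0 = proj₁ (far⇒disjoint b∈ (subst (_≤ 2) (sym card≡1) (ℕ.s≤s ℕ.z≤n)) far)
          r≤∥b∥ : r ≤ ∥ b ∥
          r≤∥b∥ = ℕ.≤-pred (subst (r <_) (trans (cong (∥ b ∥ ℕ.+_) card≡1) (ℕ.+-comm ∥ b ∥ 1))
            (proj₂ (far⇒disjoint b∈ (subst (_≤ 2) (sym card≡1) (ℕ.s≤s ℕ.z≤n)) far)))
          Loss≡Gain : Loss a ≡ Gain a
          Loss≡Gain = ℕ.≤-antisym rises (go {n = ∥ b ∥} {E = Excess a b} (disjoint≤ b∈ m≡0) r≤∥b∥)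
            where
            go : ∀ {G n E L r} → G ℕ.+ n ℕ.+ (E ℕ.+ E) ≤ r ℕ.+ L → r ≤ n → G ≤ L
            go {G} {n} {E} {L} {r} h r≤n = linear G L (n ℕ.+ r) (E ℕ.+ E) (ℕ.+-mono-≤ h r≤n) (e₁ G n E r) (e₂ n L r)
              where
              e₁ : ∀ G n E r → G ℕ.+ n ℕ.+ (E ℕ.+ E) ℕ.+ r ≡ G ℕ.+ (n ℕ.+ r) ℕ.+ (E ℕ.+ E)
              e₁ = solve-∀
              e₂ : ∀ n L r → r ℕ.+ L ℕ.+ n ≡ L ℕ.+ (n ℕ.+ r)
              e₂ = solve-∀
          Loss≢0 : Loss a ≢ 0
          Loss≢0 eq = ℕ.<⇒≱ (ℕ.≤-trans (ℕ.≤-reflexive (sym card≡1)) (Sum-mono (λ i → positive-gain (S i) (a i))))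
            (ℕ.≤-reflexive (trans (sym Loss≡Gain) eq))
          j : Fin n
          j = proj₁ (loss-witness Loss≢0)
          pos-j : A j ≡ false
          pos-j = proj₁ (negative⇒ (S j) (a j) (proj₂ (loss-witness Loss≢0)))
          a≢0 : a j ≢ +0
          a≢0 = proj₂ (negative⇒ (S j) (a j) (proj₂ (loss-witness Loss≢0)))
          open Shift A (pos⊆S a) pos-j 1 a
          toward-away : ∀ k (c : Coords) → distance (c j) (toward k (a j)) ℕ.+ 0 ≤ ℤ.∣ c j ∣ ℕ.+ k
          toward-away k c = subst (_≤ ℤ.∣ c j ∣ ℕ.+ k) (sym (ℕ.+-identityʳ (distance (c j) (toward k (a j))))) (distance-toward k (a j) (c j))
          toward-near : ∀ (c : Coords) → sameSign (a j) (c j) ≡ true → 1 ≤ ℤ.∣ c j ∣ → distance (c j) (toward 1 (a j)) ℕ.+ 1 ≤ ℤ.∣ c j ∣ ℕ.+ 0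
          toward-near c same 1≤ = ℕ.≤-reflexive (trans (distance-toward-same (a j) (c j) same 1≤) (sym (ℕ.+-identityʳ _)))
          norm≤4 : ∥ w ∥ ≤ 4
          norm≤4 = subst (_≤ 4) (sym (trans (norm-w pos-j a≢0) (cong (ℕ._+ 1) card≡1))) (ℕ.s≤s (ℕ.s≤s ℕ.z≤n))
          descends : Descends w
          descends = record
            { units = units-w pos-j a≢0
            ; below = inj₂ (trans (loss-w pos-j a≢0) (sym (trans (gain-w pos-j a≢0) card≡1)) , leads-shift a pos-j a≢0 1 (ties Loss≡Gain))
            }
          good : Good w
          good {c} c∈ = go (meet A c ℕ.≟ 0) (sameSign (a j) (c j)) refl
            where
            go : Dec (meet A c ≡ 0) → ∀ b → sameSign (a j) (c j) ≡ b → dist c w ≤ r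
            go (no m≢0) _ _ = shift-fit c 0 1 0 (toward-away 1 c) (norm≤r c∈) card≡1 refl (twice 1 {meet A c} (ℕ.n≢0⇒n>0 m≢0))
            go (yes m≡0) true same =
              shift-fit c 1 0 0 (toward-near c same (same⇒1≤ (a j) (c j) same)) (norm≤r c∈) card≡1 m≡0 ℕ.≤-refl
            go (yes m≡0) false opp =
              shift-fit c 0 1 2 (toward-away 1 c) (room {c} {1} c∈ m≡0 (ℕ.≤-trans (1≤∣∣ a≢0) (excess≥ a c pos-j opp))) card≡1 m≡0 ℕ.≤-refl

    module _ (no-single : ∀ {a} → a ∈ τ → card (pos a) ≢ 1) where

      2≤card : ∀ {a} → a ∈ τ → 2 ≤ card (pos a)
      2≤card {a} a∈ = go (card (pos a)) (card-pos≢0 (below a∈)) (no-single a∈)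
        where
        go : ∀ k → k ≢ 0 → k ≢ 1 → 2 ≤ k
        go 0             h _ = contradiction refl h
        go 1             _ h = contradiction refl h
        go (suc (suc k)) _ _ = ℕ.s≤s (ℕ.s≤s ℕ.z≤n)

      -- The critical case, reached when both `ind S` and `ind (pos a)` fail: a has only two
      -- positive coordinates, b shares none of them, and both norms are within 1 of r. Then the
      -- surplus of a is at most 1 and b follows all its losses.
      module _ {a b : Coords} (a∈ : a ∈ τ) (b∈ : b ∈ τ) (card≡2 : card (pos a) ≡ 2) (r≤∥a∥ : r ≤ ∥ a ∥ ℕ.+ 1)
               (disj : meet (pos a) b ≡ 0) (r≤∥b∥ : r ≤ ∥ b ∥ ℕ.+ 1) where

        open Below (below a∈)

        disj-i : ∀ i → pos a i ∧ pos b i ≡ false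
        disj-i i = ⟦⟧≡0 (Sum-zero⁻ (λ i → ⟦ pos a i ∧ pos b i ⟧) disj i)

        excess≡0 : Excess a b ≡ 0
        excess≡0 = go (Excess a b) (disjoint≤ a∈ b∈ disj) rises r≤∥b∥
          where
          go : ∀ E {G m L r} → G ℕ.+ m ℕ.+ (E ℕ.+ E) ≤ r ℕ.+ L → L ≤ G → r ≤ m ℕ.+ 1 → E ≡ 0
          go zero    _ _ _ = refl
          go (suc E) {G} {m} {L} {r} h L≤G r≤ = ⊥-elim (absurd (E ℕ.+ E) (ℕ.+-mono-≤ (ℕ.+-mono-≤ h L≤G) r≤) (e E G m L r))
            where
            e : ∀ E G m L r → G ℕ.+ m ℕ.+ (suc E ℕ.+ suc E) ℕ.+ L ℕ.+ r ≡ suc (r ℕ.+ L ℕ.+ G ℕ.+ (m ℕ.+ 1) ℕ.+ (E ℕ.+ E))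
            e = solve-∀

        excess-i : ∀ i → excess (S i) (a i) (b i) ≡ 0
        excess-i = Sum-zero⁻ (λ i → excess (S i) (a i) (b i)) excess≡0

        Gain≤1+Loss : Gain a ≤ suc (Loss a)
        Gain≤1+Loss = go {m = ∥ b ∥} {E = Excess a b} (disjoint≤ a∈ b∈ disj) r≤∥b∥
          where
          go : ∀ {G m E L r} → G ℕ.+ m ℕ.+ (E ℕ.+ E) ≤ r ℕ.+ L → r ≤ m ℕ.+ 1 → G ≤ suc L
          go {G} {m} {E} {L} {r} h r≤ = linear G (suc L) (m ℕ.+ r) (E ℕ.+ E) (ℕ.+-mono-≤ h r≤) (e₁ G m E r) (e₂ m L r)
            where
            e₁ : ∀ G m E r → G ℕ.+ m ℕ.+ (E ℕ.+ E) ℕ.+ r ≡ G ℕ.+ (m ℕ.+ r) ℕ.+ (E ℕ.+ E)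
            e₁ = solve-∀
            e₂ : ∀ m L r → r ℕ.+ L ℕ.+ (m ℕ.+ 1) ≡ suc L ℕ.+ (m ℕ.+ r)
            e₂ = solve-∀

        parts : Fin n → ℕ
        parts i = ⟦ pos a i ⟧ ℕ.+ ⟦ pos b i ⟧ ℕ.+ ⟦ neg a i ⟧

        parts≤1 : ∀ i → parts i ≤ 1
        parts≤1 i = three-local (S i) (a i) (b i) (disj-i i) (excess-i i)

        parts-sum : Sum parts ≡ card (pos a) ℕ.+ card (pos b) ℕ.+ card (neg a)
        parts-sum = trans (Sum-+ (λ i → ⟦ pos a i ⟧ ℕ.+ ⟦ pos b i ⟧) (λ i → ⟦ neg a i ⟧))
          (cong (ℕ._+ card (neg a)) (Sum-+ (λ i → ⟦ pos a i ⟧) (λ i → ⟦ pos b i ⟧)))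

        three≤6 : 2 ℕ.+ card (pos b) ℕ.+ card (neg a) ≤ 6
        three≤6 = subst (λ k → k ℕ.+ card (pos b) ℕ.+ card (neg a) ≤ 6) card≡2
          (subst (_≤ 6) parts-sum (ℕ.≤-trans (Sum≤n parts parts≤1) n≤6))

        9≤ : 9 ≤ Gain a ℕ.+ Loss a
        9≤ = subst (9 ≤_) (sym (Gain+Loss a)) (ℕ.≤-pred (subst (10 ≤_) (ℕ.+-comm ∥ a ∥ 1) (ℕ.≤-trans 10≤r r≤∥a∥)))

        -- Gain and loss of a add up to at least r - 1, hence to at least 9, and the gain exceeds
        -- the loss by at most 1.
        4≤Loss : 4 ≤ Loss a
        4≤Loss = go 9≤ Gain≤1+Loss
          where
          go : ∀ {G L} → 9 ≤ G ℕ.+ L → G ≤ suc L → 4 ≤ L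
          go {G} {L} h G≤ = ℕ.*-cancelˡ-≤ 2 (linear 8 (2 ℕ.* L) (suc G) 0 (ℕ.+-mono-≤ h G≤) (e₁ G) (e₂ G L))
            where
            e₁ : ∀ G → 9 ℕ.+ G ≡ 8 ℕ.+ suc G ℕ.+ 0
            e₁ = solve-∀
            e₂ : ∀ G L → G ℕ.+ L ℕ.+ suc L ≡ 2 ℕ.* L ℕ.+ suc G
            e₂ = solve-∀

        neg≢0 : card (neg a) ≢ 0
        neg≢0 card≡0 =
          let (j , neg-j) = loss-witness a∈ (λ loss≡0 → ℕ.<⇒≱ (ℕ.s≤s ℕ.z≤n) (subst (4 ≤_) loss≡0 4≤Loss)) in
          contradiction (trans (sym neg-j) (⟦⟧≡0 (Sum-zero⁻ (λ i → ⟦ neg a i ⟧) card≡0 j))) (λ ())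

        -- The count 2 + 2 + 2 exhausts the six coordinates. Of the two or more positive coordinates
        -- of c, each lies in T, where it saves 2, or is negative for a, where it adds to the excess
        -- of both a and b over c. If c misses `pos a` or `pos b`, that excess is room; if it meets
        -- both, it saves 4 outright.
        two-negatives : card (neg a) ≡ 2 → Dominated
        two-negatives neg≡2 = ind T , descends-ind T T⊆S (λ card≡0 → ℕ.<⇒≱ (ℕ.s≤s ℕ.z≤n) (subst (2 ≤_) card≡0 2≤cardT)) cardT≤4 , good
          where
          T : Fin n → Bool
          T i = pos a i ∨ pos b i
          T⊆S : ∀ i → T i ≡ true → S i ≡ true
          T⊆S i Ti with pos a i in eq
          ... | true  = pos⊆S a i eq
          ... | false = pos⊆S b i Ti
          ⟦∨⟧≤ : ∀ s t → ⟦ s ∨ t ⟧ ≤ ⟦ s ⟧ ℕ.+ ⟦ t ⟧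
          ⟦∨⟧≤ true  t = ℕ.m≤m+n 1 ⟦ t ⟧
          ⟦∨⟧≤ false t = ℕ.≤-refl
          ≤⟦∨⟧ : ∀ s t → ⟦ s ⟧ ≤ ⟦ s ∨ t ⟧
          ≤⟦∨⟧ true  t = ℕ.≤-refl
          ≤⟦∨⟧ false t = ℕ.z≤n
          cardB≤2 : card (pos b) ≤ 2
          cardB≤2 = linear (card (pos b)) 2 4 0 (subst (λ k → 2 ℕ.+ card (pos b) ℕ.+ k ≤ 6) neg≡2 three≤6) (e (card (pos b))) refl
            where
            e : ∀ k → 2 ℕ.+ k ℕ.+ 2 ≡ k ℕ.+ 4 ℕ.+ 0
            e = solve-∀
          cardT≤4 : card T ≤ 4
          cardT≤4 = ℕ.≤-trans (Sum-mono (λ i → ⟦∨⟧≤ (pos a i) (pos b i))) (subst (_≤ 4) (sym (Sum-+ (λ i → ⟦ pos a i ⟧) (λ i → ⟦ pos b i ⟧)))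
            (ℕ.+-mono-≤ (ℕ.≤-reflexive card≡2) cardB≤2))
          2≤cardT : 2 ≤ card T
          2≤cardT = ℕ.≤-trans (ℕ.≤-reflexive (sym card≡2)) (Sum-mono (λ i → ≤⟦∨⟧ (pos a i) (pos b i)))
          cover : ∀ i → 1 ≤ parts i
          cover = Sum≡n parts parts≤1 (ℕ.≤-trans n≤6 (subst (6 ≤_) (sym parts-sum)
            (ℕ.+-mono-≤ (ℕ.+-mono-≤ (ℕ.≤-reflexive (sym card≡2)) (2≤card b∈)) (ℕ.≤-reflexive (sym neg≡2)))))
          good : Good (ind T)
          good {c} c∈ = go (meet (pos a) c ℕ.≟ 0) (meet (pos b) c ℕ.≟ 0)
            where
            X : ℕ
            X = Sum (λ i → ⟦ neg a i ∧ pos c i ⟧)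
            covered : ∀ s t u v → 1 ≤ ⟦ s ⟧ ℕ.+ ⟦ t ⟧ ℕ.+ ⟦ u ⟧ → ⟦ v ⟧ ≤ ⟦ (s ∨ t) ∧ v ⟧ ℕ.+ ⟦ u ∧ v ⟧
            covered true  t     u    v _ = ℕ.m≤m+n ⟦ v ⟧ ⟦ u ∧ v ⟧
            covered false true  u    v _ = ℕ.m≤m+n ⟦ v ⟧ ⟦ u ∧ v ⟧
            covered false false true v _ = ℕ.≤-refl
            2≤m+X : 2 ≤ meet T c ℕ.+ X
            2≤m+X = ℕ.≤-trans (2≤card c∈) (subst (card (pos c) ≤_) (Sum-+ (λ i → ⟦ T i ∧ pos c i ⟧) (λ i → ⟦ neg a i ∧ pos c i ⟧))
              (Sum-mono (λ i → covered (pos a i) (pos b i) (neg a i) (pos c i) (cover i))))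
            both : ∀ s t v → s ∧ t ≡ false → ⟦ s ∧ v ⟧ ℕ.+ ⟦ t ∧ v ⟧ ≤ ⟦ (s ∨ t) ∧ v ⟧
            both true  false v _ = ℕ.≤-reflexive (ℕ.+-identityʳ ⟦ v ⟧)
            both false t     v _ = ℕ.≤-refl
            meets : meet (pos a) c ℕ.+ meet (pos b) c ≤ meet T c
            meets = subst (_≤ meet T c) (Sum-+ (λ i → ⟦ pos a i ∧ pos c i ⟧) (λ i → ⟦ pos b i ∧ pos c i ⟧))
              (Sum-mono (λ i → both (pos a i) (pos b i) (pos c i) (disj-i i)))
            bound : ∀ {x} → ∥ c ∥ ℕ.+ x ≤ r → 4 ≤ meet T c ℕ.+ meet T c ℕ.+ 0 ℕ.+ x → dist c (ind T) ≤ r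
            bound {x} room h = fit (dist c (ind T)) (meet T c) ∥ c ∥ 4 0 0 x
              (subst₂ _≤_ (sym (ℕ.+-identityʳ (dist c (ind T) ℕ.+ (meet T c ℕ.+ meet T c)))) (sym (ℕ.+-identityʳ (∥ c ∥ ℕ.+ 4)))
              (ℕ.≤-trans (indicator T c T⊆S) (ℕ.+-monoʳ-≤ ∥ c ∥ cardT≤4))) room h
            split4 : 4 ≤ meet T c ℕ.+ meet T c ℕ.+ 0 ℕ.+ (X ℕ.+ X)
            split4 = subst (4 ≤_) (e (meet T c) X) (ℕ.+-mono-≤ 2≤m+X 2≤m+X)
              where
              e : ∀ m x → m ℕ.+ x ℕ.+ (m ℕ.+ x) ≡ m ℕ.+ m ℕ.+ 0 ℕ.+ (x ℕ.+ x)
              e = solve-∀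
            X≤a : X ≤ Excess a c
            X≤a = Sum-mono (λ i → excess-own (S i) (a i) (c i))
            X≤b : X ≤ Excess b c
            X≤b = Sum-mono (λ i → excess-other (S i) (a i) (b i) (c i) (excess-i i))
            2≤m : meet (pos a) c ≢ 0 → meet (pos b) c ≢ 0 → 2 ≤ meet T c
            2≤m a≢0 b≢0 = ℕ.≤-trans (ℕ.+-mono-≤ (ℕ.n≢0⇒n>0 a≢0) (ℕ.n≢0⇒n>0 b≢0)) meets
            go : Dec (meet (pos a) c ≡ 0) → Dec (meet (pos b) c ≡ 0) → dist c (ind T) ≤ r
            go (yes a≡0) _        = bound {X ℕ.+ X} (room a∈ {c} {X} c∈ a≡0 X≤a) split4
            go (no _)   (yes b≡0) = bound {X ℕ.+ X} (room b∈ {c} {X} c∈ b≡0 X≤b) split4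
            go (no a≢0) (no b≢0)  = bound {0} (norm≤r c∈) (twice 2 {meet T c} (2≤m a≢0 b≢0))

        -- All loss of a, at least 4, is concentrated at j. Besides the two steps of `pos a`, w
        -- makes two steps along a at j in a tie and one if a has surplus 1, which keeps w below v.
        one-negative : card (neg a) ≡ 1 → Dominated
        one-negative neg≡1 = [ tie , strict ]′ (cases rises Gain≤1+Loss)
          where
          cases : ∀ {L G} → L ≤ G → G ≤ suc L → L ≡ G ⊎ G ≡ suc L
          cases {L} {G} L≤G G≤ with L ℕ.≟ G
          ... | yes eq = inj₁ eq
          ... | no  ≢  = inj₂ (ℕ.≤-antisym G≤ (ℕ.≤∧≢⇒< L≤G ≢))
          witness : ∃[ j ] neg a j ≡ true
          witness = let (j , h) = Sum-witness (λ i → ⟦ neg a i ⟧) (λ eq → ℕ.0≢1+n (trans (sym eq) neg≡1)) in j , ⟦⟧≢0 h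
          j : Fin n
          j = proj₁ witness
          pos-j : pos a j ≡ false
          pos-j = proj₁ (negative⇒ (S j) (a j) (proj₂ witness))
          a≢0 : a j ≢ +0
          a≢0 = proj₂ (negative⇒ (S j) (a j) (proj₂ witness))
          neg-other : ∀ {i} → i ≢ j → neg a i ≡ false
          neg-other {i} i≢j with neg a i in eq
          ... | false = refl
          ... | true  = contradiction
            (subst₂ _≤_ (cong₂ (λ s t → ⟦ s ⟧ ℕ.+ ⟦ t ⟧) eq (proj₂ witness)) neg≡1 (two≤Sum (λ i → ⟦ neg a i ⟧) i≢j)) (ℕ.<⇒≱ ℕ.≤-refl)
          4≤∣aj∣ : 4 ≤ ℤ.∣ a j ∣
          4≤∣aj∣ = ℕ.≤-trans 4≤Loss (ℕ.≤-trans (Sum-mono local) (ℕ.≤-reflexive (Sum-at j ℤ.∣ a j ∣)))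
            where
            loss≤ : ∀ s a → loss s a ≤ ℤ.∣ a ∣
            loss≤ s a with positive s a
            ... | true  = ℕ.z≤n
            ... | false = ℕ.≤-refl
            loss≡0 : ∀ {i} → i ≢ j → loss (S i) (a i) ≡ 0
            loss≡0 {i} i≢j with loss (S i) (a i) ℕ.≟ 0
            ... | yes eq = eq
            ... | no  ≢0 = contradiction (trans (sym (negative-loss (S i) (a i) ≢0)) (neg-other i≢j)) (λ ())
            local : ∀ i → loss (S i) (a i) ≤ at j ℤ.∣ a j ∣ i
            local i with i Fin.≟ j
            ... | yes refl = loss≤ (S j) (a j)
            ... | no i≢j   = ℕ.≤-reflexive (loss≡0 i≢j)
          -- k steps against j are balanced by the surplus s of a.
          module Balance (k s : ℕ) (k+s≡2 : k ℕ.+ s ≡ 2) (Gain≡ : Gain a ≡ s ℕ.+ Loss a) where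
            open Shift (pos a) (pos⊆S a) pos-j k a public
            k≤2 : k ≤ 2
            k≤2 = subst (k ≤_) k+s≡2 (ℕ.m≤m+n k s)
            norm≤4 : ∥ w ∥ ≤ 4
            norm≤4 = subst (_≤ 4) (sym (trans (norm-w pos-j a≢0) (cong (ℕ._+ k) card≡2))) (ℕ.+-monoʳ-≤ 2 k≤2)
            disjoint-s : ∀ {c} → c ∈ τ → meet (pos a) c ≡ 0 → ∥ c ∥ ℕ.+ s ≤ r
            disjoint-s {c} c∈ m≡0 = go {m = ∥ c ∥} {E = Excess a c} (disjoint≤ a∈ c∈ m≡0) Gain≡
              where
              go : ∀ {G m E L} → G ℕ.+ m ℕ.+ (E ℕ.+ E) ≤ r ℕ.+ L → G ≡ s ℕ.+ L → m ℕ.+ s ≤ r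
              go {m = m} {E} {L} h refl = linear (m ℕ.+ s) r L (E ℕ.+ E) h (e s L m E) refl
                where
                e : ∀ s L m E → s ℕ.+ L ℕ.+ m ℕ.+ (E ℕ.+ E) ≡ m ℕ.+ s ℕ.+ L ℕ.+ (E ℕ.+ E)
                e = solve-∀
            -- Here c opposes a wherever a is not positive, so the whole loss of a enters the
            -- distance; compared with the gain this leaves 2 - s, that is k, units of room.
            partial : ∀ {c} → c ∈ τ → meet (pos a) c ≡ 1 → sameSign (a j) (c j) ≡ false → ∥ c ∥ ℕ.+ k ≤ r
            partial {c} c∈ m≡1 opp = go {∥ c ∥} {Loss a} {dist a c} {Gain a} {k} {s}
              (subst₂ _≤_ left right (Sum-mono (λ i → partial-local (S i) (a i) (c i) (opposite i)))) (near a∈ c∈) Gain≡ k+s≡2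
              where
              p m : Fin n → ℕ
              p i = ⟦ pos a i ⟧
              m i = ⟦ pos a i ∧ pos c i ⟧
              opposite : ∀ i → pos a i ≡ false → sameSign (a i) (c i) ≡ false
              opposite i pos-i with i Fin.≟ j
              ... | yes refl = opp
              ... | no i≢j   = cong (λ z → sameSign z (c i)) (neither⇒0 (S i) (a i) pos-i (neg-other i≢j))
              left : Sum (λ i → ℤ.∣ c i ∣ ℕ.+ (p i ℕ.+ p i) ℕ.+ loss (S i) (a i)) ≡ ∥ c ∥ ℕ.+ 4 ℕ.+ Loss a
              left = trans (Sum-+ (λ i → ℤ.∣ c i ∣ ℕ.+ (p i ℕ.+ p i)) (λ i → loss (S i) (a i)))
                (cong (ℕ._+ Loss a) (trans (Sum-+ (λ i → ℤ.∣ c i ∣) (λ i → p i ℕ.+ p i))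
                  (cong (∥ c ∥ ℕ.+_) (trans (Sum-+ p p) (cong₂ ℕ._+_ card≡2 card≡2)))))
              right : Sum (λ i → distance (a i) (c i) ℕ.+ gain (S i) (a i) ℕ.+ (m i ℕ.+ m i)) ≡ dist a c ℕ.+ Gain a ℕ.+ 2
              right = trans (Sum-+ (λ i → distance (a i) (c i) ℕ.+ gain (S i) (a i)) (λ i → m i ℕ.+ m i))
                (cong₂ ℕ._+_ (Sum-+ (λ i → distance (a i) (c i)) (λ i → gain (S i) (a i))) (trans (Sum-+ m m) (cong₂ ℕ._+_ m≡1 m≡1)))
              go : ∀ {N L D G k s} → N ℕ.+ 4 ℕ.+ L ≤ D ℕ.+ G ℕ.+ 2 → D ≤ r → G ≡ s ℕ.+ L → k ℕ.+ s ≡ 2 → N ℕ.+ k ≤ r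
              go {N} {L} {D} {_} {k} {s} h D≤r refl k+s = linear (N ℕ.+ k) r (D ℕ.+ s ℕ.+ L ℕ.+ 2) 0 (ℕ.+-mono-≤ h D≤r)
                (trans (cong (λ z → N ℕ.+ (2 ℕ.+ z) ℕ.+ L ℕ.+ D) (sym k+s)) (e₁ N L D k s)) (e₂ r L D s)
                where
                e₁ : ∀ N L D k s → N ℕ.+ (2 ℕ.+ (k ℕ.+ s)) ℕ.+ L ℕ.+ D ≡ N ℕ.+ k ℕ.+ (D ℕ.+ s ℕ.+ L ℕ.+ 2) ℕ.+ 0
                e₁ = solve-∀
                e₂ : ∀ r L D s → D ℕ.+ (s ℕ.+ L) ℕ.+ 2 ℕ.+ r ≡ r ℕ.+ (D ℕ.+ s ℕ.+ L ℕ.+ 2)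
                e₂ = solve-∀
            -- The steps of `pos a` cost 2 minus twice the number m that c approves. For m = 0 they
            -- are paid by k saved at j together with the room s, or by the six units of room that
            -- an excess of 3 provides; for m = 1 only the correction at j is left; for m at least 2
            -- even that is covered.
            good : Good w
            good {c} c∈ = go (meet (pos a) c) refl (sameSign (a j) (c j)) refl
              where
              away : distance (c j) (toward k (a j)) ℕ.+ 0 ≤ ℤ.∣ c j ∣ ℕ.+ k
              away = subst (_≤ ℤ.∣ c j ∣ ℕ.+ k) (sym (ℕ.+-identityʳ (distance (c j) (toward k (a j))))) (distance-toward k (a j) (c j))
              6-room : meet (pos a) c ≡ 0 → 3 ≤ Excess a c → dist c w ≤ r
              6-room m≡0 3≤ = shift-fit c 0 k 6 away (room a∈ {c} {3} c∈ m≡0 3≤) card≡2 m≡0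
                (ℕ.+-mono-≤ (ℕ.≤-refl {2}) (ℕ.≤-trans k≤2 (ℕ.s≤s (ℕ.s≤s ℕ.z≤n))))
              go : ∀ m → meet (pos a) c ≡ m → ∀ b → sameSign (a j) (c j) ≡ b → dist c w ≤ r
              go 0 m≡0 false opp = 6-room m≡0 (ℕ.≤-trans (ℕ.n≤1+n 3) (ℕ.≤-trans 4≤∣aj∣ (excess≥ a c pos-j opp)))
              go 0 m≡0 true same = compare (k ℕ.≤? ℤ.∣ c j ∣)
                where
                compare : Dec (k ≤ ℤ.∣ c j ∣) → dist c w ≤ r
                compare (yes k≤) = shift-fit c k 0 s
                  (ℕ.≤-reflexive (trans (distance-toward-same (a j) (c j) same k≤) (sym (ℕ.+-identityʳ _))))
                  (disjoint-s c∈ m≡0) card≡2 m≡0 (ℕ.≤-reflexive (sym k+s≡2))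
                -- Since k is at most 2, `c j` has absolute value at most 1, and at least three of
                -- the four or more units of `a j` are unshared.
                compare (no k≰) = 6-room m≡0
                  (ℕ.≤-trans (ℕ.∸-mono 4≤∣aj∣ (ℕ.≤-pred (ℕ.≤-trans (ℕ.≰⇒> k≰) k≤2))) (excess≥-same a c pos-j same))
              go 1 m≡1 true same = shift-fit c 0 0 0
                (subst₂ _≤_ (sym (ℕ.+-identityʳ _)) (sym (ℕ.+-identityʳ _)) (distance-toward-≤2 (a j) (c j) same k≤2))
                (norm≤r c∈) card≡2 m≡1 ℕ.≤-refl
              go 1 m≡1 false opp = shift-fit c 0 k k away (partial c∈ m≡1 opp) card≡2 m≡1 ℕ.≤-refl
              go (suc (suc m)) m≡ _ _ = shift-fit c 0 k 0 away (norm≤r c∈) card≡2 m≡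
                (ℕ.≤-trans (ℕ.+-monoʳ-≤ 2 k≤2) (twice 2 {suc (suc m)} (ℕ.s≤s (ℕ.s≤s ℕ.z≤n))))
          tie : Loss a ≡ Gain a → Dominated
          tie Loss≡Gain = w , small norm≤4 (record
            { units = units-w pos-j a≢0
            ; below = inj₂ (trans (loss-w pos-j a≢0) (sym (trans (gain-w pos-j a≢0) card≡2)) , leads-shift a pos-j a≢0 2 (ties Loss≡Gain))
            }) , good
            where open Balance 2 0 refl (sym Loss≡Gain)
          strict : Gain a ≡ suc (Loss a) → Dominated
          strict Gain≡ = w , small norm≤4 (record
            { units = units-w pos-j a≢0
            ; below = inj₁ (subst₂ _<_ (sym (loss-w pos-j a≢0)) (sym (trans (gain-w pos-j a≢0) card≡2)) ℕ.≤-refl)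
            }) , good
            where open Balance 1 1 refl Gain≡

        pair : Dominated
        pair = go (card (neg a)) refl
          where
          go : ∀ k → card (neg a) ≡ k → Dominated
          go 0 eq = contradiction eq neg≢0
          go 1 eq = one-negative eq
          go 2 eq = two-negatives eq
          go (suc (suc (suc k))) eq = ⊥-elim (absurd k (ℕ.≤-trans (ℕ.+-monoˡ-≤ (3 ℕ.+ k) (ℕ.+-monoʳ-≤ 2 (2≤card b∈)))
            (subst (λ z → 2 ℕ.+ card (pos b) ℕ.+ z ≤ 6) eq three≤6)) refl)

      -- A member a far from `ind S` satisfies r + 1 + 2 p ≤ ‖a‖ + 6 with p positive coordinates.
      -- This leaves only p = 2 and norm at least r - 1, and failure of `ind (pos a)` then supplies
      -- b.
      multiple : Dominated
      multiple = [ (λ good → ind S , full (λ _ → refl) , good) , from-a ]′ (test (ind S))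
        where
        from-a : ∃[ a ] a ∈ τ × r < dist a (ind S) → Dominated
        from-a (a , a∈ , far) =
          [ (λ good → ind (pos a) , descends-ind (pos a) (pos⊆S a) (card-pos≢0 (below a∈))
              (subst (_≤ 4) (sym card≡2) (ℕ.s≤s (ℕ.s≤s ℕ.z≤n))) , good) , from-b ]′ (test (ind (pos a)))
          where
          meetS : meet S a ≡ card (pos a)
          meetS = Sum-cong λ i → cong ⟦_⟧ (absorb (S i) (a i))
            where
            absorb : ∀ s a → s ∧ positive s a ≡ positive s a
            absorb true  a = refl
            absorb false a = refl
          spare : suc r ℕ.+ (card (pos a) ℕ.+ card (pos a)) ≤ ∥ a ∥ ℕ.+ 6
          spare = ℕ.≤-trans (ℕ.+-monoˡ-≤ _ far) (ℕ.≤-trans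
            (subst (λ m → dist a (ind S) ℕ.+ (m ℕ.+ m) ≤ ∥ a ∥ ℕ.+ card S) meetS (indicator S a (λ _ eq → eq)))
            (ℕ.+-monoʳ-≤ ∥ a ∥ (ℕ.≤-trans (Sum≤n (λ i → ⟦ S i ⟧) (λ i → ⟦⟧≤1 (S i))) n≤6)))
          card≡2 : card (pos a) ≡ 2
          card≡2 = go (card (pos a)) (2≤card a∈) spare
            where
            go : ∀ k → 2 ≤ k → suc r ℕ.+ (k ℕ.+ k) ≤ ∥ a ∥ ℕ.+ 6 → k ≡ 2
            go 1 (ℕ.s≤s ()) _
            go 2 _ _ = refl
            go (suc (suc (suc k))) _ h = ⊥-elim (absurd (k ℕ.+ k) (ℕ.≤-trans h (ℕ.+-monoˡ-≤ 6 (Below.bounded (below a∈)))) (e r k))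
              where
              e : ∀ r k → suc r ℕ.+ (3 ℕ.+ k ℕ.+ (3 ℕ.+ k)) ≡ suc (r ℕ.+ 6 ℕ.+ (k ℕ.+ k))
              e = solve-∀
          r≤∥a∥ : r ≤ ∥ a ∥ ℕ.+ 1
          r≤∥a∥ = linear r (∥ a ∥ ℕ.+ 1) 5 0 (subst (λ k → suc r ℕ.+ (k ℕ.+ k) ≤ ∥ a ∥ ℕ.+ 6) card≡2 spare) (e₁ r) (e₂ ∥ a ∥)
            where
            e₁ : ∀ r → suc r ℕ.+ 4 ≡ r ℕ.+ 5 ℕ.+ 0
            e₁ = solve-∀
            e₂ : ∀ m → m ℕ.+ 6 ≡ m ℕ.+ 1 ℕ.+ 5
            e₂ = solve-∀
          from-b : ∃[ b ] b ∈ τ × r < dist b (ind (pos a)) → Dominated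
          from-b (b , b∈ , far′) = pair a∈ b∈ card≡2 r≤∥a∥ (proj₁ disjoint-b)
            (ℕ.≤-pred (subst (r <_) (trans (cong (∥ b ∥ ℕ.+_) card≡2) (ℕ.+-suc ∥ b ∥ 1)) (proj₂ disjoint-b)))
            where
            disjoint-b : meet (pos a) b ≡ 0 × r < ∥ b ∥ ℕ.+ card (pos a)
            disjoint-b = far⇒disjoint a∈ b∈ (ℕ.≤-reflexive card≡2) far′

    dominated : Dominated
    dominated with Any.any? (λ a → card (pos a) ℕ.≟ 1) τ
    ... | yes some = let (a , a∈ , card≡1) = find some in single a∈ card≡1
    ... | no  none = multiple (λ a∈ card≡1 → none (lose a∈ card≡1))

-- Finite boxes of lattice points

range : ℕ → ℤ → List ℤ
range k c = map (λ i → c ℤ.+ + i) (upTo (suc k)) ++ map (λ i → c ℤ.- + i) (upTo (suc k))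

∈-range : ∀ {k} c x → distance x c ≤ k → x ∈ range k c
∈-range {k} c x x≤k = go (x ℤ.- c) refl x≤k
  where
  open import Data.Integer.Solver
  open +-*-Solver
  recover : ∀ x c → c ℤ.+ (x ℤ.- c) ≡ x
  recover = solve 2 (λ x c → c :+ (x :- c) := x) refl
  go : ∀ i → x ℤ.- c ≡ i → ℤ.∣ i ∣ ≤ k → x ∈ range k c
  go (+ m) eq m≤k = ∈-++⁺ˡ (subst (_∈ map (λ i → c ℤ.+ + i) (upTo (suc k))) (trans (cong (λ z → c ℤ.+ z) (sym eq)) (recover x c))
    (∈-map⁺ (λ i → c ℤ.+ + i) (∈-upTo⁺ (ℕ.s≤s m≤k))))
  go -[1+ m ] eq m≤k = ∈-++⁺ʳ (map (λ i → c ℤ.+ + i) (upTo (suc k)))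
    (subst (_∈ map (λ i → c ℤ.- + i) (upTo (suc k))) (trans (cong (λ z → c ℤ.+ z) (sym eq)) (recover x c))
      (∈-map⁺ (λ i → c ℤ.- + i) (∈-upTo⁺ (ℕ.s≤s m≤k))))

box : ∀ {n} → ℕ → Vec ℤ n → List (Vec ℤ n)
box k []      = [] ∷ []
box k (c ∷ v) = cartesianProductWith _∷_ (range k c) (box k v)

∈-box : ∀ {n k} (v u : Vec ℤ n) → manhattan u v ≤ k → u ∈ box k v
∈-box []      []      _ = here refl
∈-box (c ∷ v) (x ∷ u) h = ∈-cartesianProductWith⁺ _∷_ (∈-range c x (ℕ.≤-trans (ℕ.m≤m+n _ _) h))
  (∈-box v u (ℕ.≤-trans (ℕ.m≤n+m _ (distance x c)) h))

manhattan-Sum : ∀ {n} (u v : Vec ℤ n) → manhattan u v ≡ Sum (λ i → distance (lookup u i) (lookup v i))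
manhattan-Sum []      []      = refl
manhattan-Sum (x ∷ u) (y ∷ v) = cong (distance x y ℕ.+_) (manhattan-Sum u v)

-- The order on the lattice: by norm, then lexicographically

norm : ∀ {n} → Vec ℤ n → ℕ
norm v = Sum (λ i → ℤ.∣ lookup v i ∣)

-- 0, -1, 1, -2, 2, ...
ζ : ℤ → ℕ
ζ (+ n)    = n ℕ.+ n
ζ -[1+ n ] = suc (n ℕ.+ n)

ζ≤ : ∀ x → ζ x ≤ ℤ.∣ x ∣ ℕ.+ ℤ.∣ x ∣
ζ≤ (+ n)    = ℕ.≤-refl
ζ≤ -[1+ n ] = ℕ.s≤s (ℕ.+-monoʳ-≤ n (ℕ.n≤1+n n))

≤ζ : ∀ x → ℤ.∣ x ∣ ℕ.+ ℤ.∣ x ∣ ≤ suc (ζ x)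
≤ζ (+ n)    = ℕ.n≤1+n _
≤ζ -[1+ n ] = ℕ.≤-reflexive (cong suc (ℕ.+-suc n n))

∣∣<⇒ζ< : ∀ {x y} → ℤ.∣ x ∣ < ℤ.∣ y ∣ → ζ x < ζ y
∣∣<⇒ζ< {x} {y} h = ℕ.≤-pred (ℕ.≤-trans (ℕ.s≤s (ℕ.s≤s (ζ≤ x)))
  (ℕ.≤-trans (subst (_≤ ℤ.∣ y ∣ ℕ.+ ℤ.∣ y ∣) (cong suc (ℕ.+-suc ℤ.∣ x ∣ ℤ.∣ x ∣)) (ℕ.+-mono-≤ h h)) (≤ζ y)))

ζ<⇒∣∣≤ : ∀ {x y} → ζ x < ζ y → ℤ.∣ x ∣ ≤ ℤ.∣ y ∣
ζ<⇒∣∣≤ {x} {y} h = ℕ.≮⇒≥ λ y<x → ℕ.<-asym h (∣∣<⇒ζ< {y} {x} y<x)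

ζ-injective : ∀ x y → ζ x ≡ ζ y → x ≡ y
ζ-injective (+ m)    (+ n)    eq = cong +_ (half m n eq)
  where
  half : ∀ m n → m ℕ.+ m ≡ n ℕ.+ n → m ≡ n
  half zero    zero    _  = refl
  half (suc m) (suc n) eq = cong suc (half m n
    (ℕ.suc-injective (ℕ.suc-injective (trans (sym (cong suc (ℕ.+-suc m m))) (trans eq (cong suc (ℕ.+-suc n n)))))))
ζ-injective -[1+ m ] -[1+ n ] eq with ζ-injective (+ m) (+ n) (ℕ.suc-injective eq)
... | refl = refl
ζ-injective (+ m)    -[1+ n ] eq = ⊥-elim (odd≢even n m (sym eq))
  where
  odd≢even : ∀ m n → suc (m ℕ.+ m) ≢ n ℕ.+ n
  odd≢even m       zero    ()
  odd≢even zero    (suc n) eq = contradiction (ℕ.suc-injective eq) (λ e → ℕ.0≢1+n (trans e (ℕ.+-suc n n)))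
  odd≢even (suc m) (suc n) eq = odd≢even m n (trans (sym (ℕ.+-suc m m)) (trans (ℕ.suc-injective eq′) refl))
    where
    eq′ : suc (m ℕ.+ suc m) ≡ suc (n ℕ.+ n)
    eq′ = trans (ℕ.suc-injective eq) (ℕ.+-suc n n)
ζ-injective -[1+ m ] (+ n)    eq = sym (ζ-injective (+ n) -[1+ m ] (sym eq))

data Lex : ∀ {n} → Vec ℤ n → Vec ℤ n → Set where
  head : ∀ {n x y} {u v : Vec ℤ n} → ζ x < ζ y → Lex (x ∷ u) (y ∷ v)
  tail : ∀ {n x} {u v : Vec ℤ n} → Lex u v → Lex (x ∷ u) (x ∷ v)

lex-compare : ∀ {n} (u v : Vec ℤ n) → Lex u v ⊎ u ≡ v ⊎ Lex v u
lex-compare []      []      = inj₂ (inj₁ refl)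
lex-compare (x ∷ u) (y ∷ v) with ℕ.<-cmp (ζ x) (ζ y)
... | tri< x<y _ _ = inj₁ (head x<y)
... | tri> _ _ y<x = inj₂ (inj₂ (head y<x))
... | tri≈ _ x≈y _ with ζ-injective x y x≈y
...   | refl with lex-compare u v
...     | inj₁ u<v         = inj₁ (tail u<v)
...     | inj₂ (inj₁ refl) = inj₂ (inj₁ refl)
...     | inj₂ (inj₂ v<u)  = inj₂ (inj₂ (tail v<u))

lex-first : ∀ {n} {u v : Vec ℤ n} → Lex u v → ∃[ i ] ζ (lookup u i) < ζ (lookup v i) × (∀ j → j Fin.< i → lookup u j ≡ lookup v j)
lex-first (head x<y) = zero , x<y , λ _ ()
lex-first (tail u<v) = let (i , h , before) = lex-first u<v in
  suc i , h , λ { zero _ → refl ; (suc j) (ℕ.s≤s j<i) → before j j<i }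

first-lex : ∀ {n} (u v : Vec ℤ n) i → ζ (lookup u i) < ζ (lookup v i) → (∀ j → j Fin.< i → lookup u j ≡ lookup v j) → Lex u v
first-lex (x ∷ u) (y ∷ v) zero    h before = head h
first-lex (x ∷ u) (y ∷ v) (suc i) h before with before zero (ℕ.s≤s ℕ.z≤n)
... | refl = tail (first-lex u v i h (λ j j<i → before (suc j) (ℕ.s≤s j<i)))

Less : ∀ {n} → Vec ℤ n → Vec ℤ n → Set
Less u v = norm u < norm v ⊎ (norm u ≡ norm v × Lex u v)

less-compare : ∀ {n} (u v : Vec ℤ n) → Less u v ⊎ u ≡ v ⊎ Less v u
less-compare u v with ℕ.<-cmp (norm u) (norm v)
... | tri< u<v _ _ = inj₁ (inj₁ u<v)
... | tri> _ _ v<u = inj₂ (inj₂ (inj₁ v<u))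
... | tri≈ _ u≈v _ with lex-compare u v
...   | inj₁ u<v        = inj₁ (inj₂ (u≈v , u<v))
...   | inj₂ (inj₁ eq)  = inj₂ (inj₁ eq)
...   | inj₂ (inj₂ v<u) = inj₂ (inj₂ (inj₂ (sym u≈v , v<u)))

-- The number with digits `ζ` in base q, most significant first, which turns the lexicographic order
-- into the numerical one.
code : ∀ {n} → ℕ → Vec ℤ n → ℕ
code q []                = 0
code q (_∷_ {n = n} x v) = ζ x ℕ.* q ℕ.^ n ℕ.+ code q v

code-bound : ∀ {n} (v : Vec ℤ n) R → norm v ≤ R → code (suc (R ℕ.+ R)) v < suc (R ℕ.+ R) ℕ.^ n
code-bound []      R h = ℕ.s≤s ℕ.z≤n
code-bound {suc n} (x ∷ v) R h = begin-strict
  ζ x ℕ.* q ℕ.^ n ℕ.+ code q v    <⟨ ℕ.+-monoʳ-< (ζ x ℕ.* q ℕ.^ n) (code-bound v R (ℕ.≤-trans (ℕ.m≤n+m _ ℤ.∣ x ∣) h)) ⟩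
  ζ x ℕ.* q ℕ.^ n ℕ.+ q ℕ.^ n     ≡⟨ ℕ.+-comm _ (q ℕ.^ n) ⟩
  suc (ζ x) ℕ.* q ℕ.^ n           ≤⟨ ℕ.*-monoˡ-≤ (q ℕ.^ n) (ℕ.s≤s (ℕ.≤-trans (ζ≤ x) (ℕ.+-mono-≤ x≤R x≤R))) ⟩
  q ℕ.* q ℕ.^ n                   ∎
  where
  open ℕ.≤-Reasoning
  q : ℕ
  q = suc (R ℕ.+ R)
  x≤R : ℤ.∣ x ∣ ≤ R
  x≤R = ℕ.≤-trans (ℕ.m≤m+n _ _) h

code-mono : ∀ {n} {u v : Vec ℤ n} R → norm u ≤ R → Lex u v → code (suc (R ℕ.+ R)) u < code (suc (R ℕ.+ R)) v
code-mono {suc n} {x ∷ u} {y ∷ v} R h (head x<y) = begin-strict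
  ζ x ℕ.* q ℕ.^ n ℕ.+ code q u    <⟨ ℕ.+-monoʳ-< (ζ x ℕ.* q ℕ.^ n) (code-bound u R (ℕ.≤-trans (ℕ.m≤n+m _ ℤ.∣ x ∣) h)) ⟩
  ζ x ℕ.* q ℕ.^ n ℕ.+ q ℕ.^ n     ≡⟨ ℕ.+-comm _ (q ℕ.^ n) ⟩
  suc (ζ x) ℕ.* q ℕ.^ n           ≤⟨ ℕ.*-monoˡ-≤ (q ℕ.^ n) x<y ⟩
  ζ y ℕ.* q ℕ.^ n                 ≤⟨ ℕ.m≤m+n _ (code q v) ⟩
  ζ y ℕ.* q ℕ.^ n ℕ.+ code q v    ∎
  where
  open ℕ.≤-Reasoning
  q : ℕ
  q = suc (R ℕ.+ R)
code-mono {suc n} {x ∷ u} {.x ∷ v} R h (tail u<v) =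
  ℕ.+-monoʳ-< (ζ x ℕ.* suc (R ℕ.+ R) ℕ.^ n) (code-mono R (ℕ.≤-trans (ℕ.m≤n+m _ ℤ.∣ x ∣) h) u<v)

base : ℕ → ℕ
base R = suc (R ℕ.+ R)

opaque
  -- The digits ζ of a vector of norm R are smaller than 2 R + 1.
  rank : ∀ {n} → Vec ℤ n → ℕ
  rank {n} v = norm v ℕ.* base (norm v) ℕ.^ n ℕ.+ code (base (norm v)) v

  -- For different norms, the code of u is below the full block (2R + 1)^n with R its norm, so its
  -- rank is below R + 1 such blocks, and v begins at no less than that many.
  rank-mono : ∀ {n} {u v : Vec ℤ n} → Less u v → rank u < rank v
  rank-mono {n} {u} {v} (inj₁ u<v) = begin-strict
    norm u ℕ.* p ℕ.^ n ℕ.+ code p u     <⟨ ℕ.+-monoʳ-< (norm u ℕ.* p ℕ.^ n) (code-bound u (norm u) ℕ.≤-refl) ⟩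
    norm u ℕ.* p ℕ.^ n ℕ.+ p ℕ.^ n      ≡⟨ ℕ.+-comm _ (p ℕ.^ n) ⟩
    suc (norm u) ℕ.* p ℕ.^ n            ≤⟨ ℕ.*-mono-≤ u<v (ℕ.^-monoˡ-≤ n (ℕ.s≤s (ℕ.+-mono-≤ (ℕ.<⇒≤ u<v) (ℕ.<⇒≤ u<v)))) ⟩
    norm v ℕ.* base (norm v) ℕ.^ n      ≤⟨ ℕ.m≤m+n _ _ ⟩
    rank v                              ∎
    where
    open ℕ.≤-Reasoning
    p : ℕ
    p = base (norm u)
  rank-mono {n} {u} {v} (inj₂ (eq , lex)) = subst
    (λ R → norm u ℕ.* base (norm u) ℕ.^ n ℕ.+ code (base (norm u)) u < R ℕ.* base R ℕ.^ n ℕ.+ code (base R) v) eq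
    (ℕ.+-monoʳ-< (norm u ℕ.* base (norm u) ℕ.^ n) (code-mono (norm u) ℕ.≤-refl lex))

  norm≤rank : ∀ {n} (v : Vec ℤ n) → norm v ≤ rank v
  norm≤rank {n} v = ℕ.≤-trans
    (ℕ.≤-trans (ℕ.≤-reflexive (sym (ℕ.*-identityʳ (norm v)))) (ℕ.*-monoʳ-≤ (norm v) (ℕ.m^n>0 (base (norm v)) n))) (ℕ.m≤m+n _ _)

  rank-origin : ∀ n → rank (replicate n +0) ≡ 0
  rank-origin n = trans (cong (λ R → R ℕ.* base R ℕ.^ n ℕ.+ code (base R) (replicate n +0)) (norm-origin n)) (code-origin n)
    where
    norm-origin : ∀ n → norm (replicate n +0) ≡ 0
    norm-origin zero    = refl
    norm-origin (suc n) = norm-origin n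
    code-origin : ∀ n {q} → code q (replicate n +0) ≡ 0
    code-origin zero    = refl
    code-origin (suc n) = code-origin n

rank-reflects : ∀ {n} {u v : Vec ℤ n} → rank u < rank v → Less u v
rank-reflects {u = u} {v} h with less-compare u v
... | inj₁ u<v        = u<v
... | inj₂ (inj₁ eq)  = contradiction h (ℕ.<-irrefl (cong rank eq))
... | inj₂ (inj₂ v<u) = contradiction (rank-mono v<u) (ℕ.<-asym h)

rank-injective : ∀ {n} {u v : Vec ℤ n} → rank u ≡ rank v → u ≡ v
rank-injective {u = u} {v} eq with less-compare u v
... | inj₁ u<v        = contradiction (rank-mono u<v) (ℕ.<-irrefl eq)
... | inj₂ (inj₁ u≡v) = u≡v
... | inj₂ (inj₂ v<u) = contradiction (rank-mono v<u) (ℕ.<-irrefl (sym eq))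

search : ∀ {n} → ℕ → List (Vec ℤ n) → Maybe (Vec ℤ n)
search j []      = nothing
search j (v ∷ l) with rank v ℕ.≟ j
... | yes _ = just v
... | no  _ = search j l

search-sound : ∀ {n j} {v : Vec ℤ n} l → search j l ≡ just v → rank v ≡ j
search-sound {j = j} (u ∷ l) eq with rank u ℕ.≟ j
search-sound (u ∷ l) refl | yes rank≡ = rank≡
search-sound (u ∷ l) eq   | no _      = search-sound l eq

search-complete : ∀ {n} {v : Vec ℤ n} {l} → v ∈ l → search (rank v) l ≡ just v
search-complete {v = v} {u ∷ l} v∈ with rank u ℕ.≟ rank v
... | yes eq = cong just (rank-injective eq)
... | no  ≢ with v∈
...   | here refl  = contradiction refl ≢
...   | there v∈l  = search-complete v∈l

-- The norm is bounded by the rank, so a vertex of rank j lies in the box of radius j around the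
-- origin.
unrank : ∀ n → ℕ → Maybe (Vec ℤ n)
unrank n j = search j (box j (replicate n +0))

unrank-rank : ∀ {n} (v : Vec ℤ n) → unrank n (rank v) ≡ just v
unrank-rank {n} v = search-complete (∈-box (replicate n +0) v (ℕ.≤-trans (ℕ.≤-reflexive (from-origin v)) (norm≤rank v)))
  where
  from-origin : ∀ {n} (v : Vec ℤ n) → manhattan v (replicate n +0) ≡ norm v
  from-origin []      = refl
  from-origin (x ∷ v) = cong₂ ℕ._+_ (cong ℤ.∣_∣ (ℤ.+-identityʳ x)) (from-origin v)

-- Coordinates relative to v in which the positive direction decreases the norm

nonzero : ℤ → Bool
nonzero +0 = false
nonzero _  = true

orient place : ℤ → ℤ → ℤ
orient +0       x = x
orient +[1+ m ] x = +[1+ m ] ℤ.- x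
orient -[1+ m ] x = x ℤ.- -[1+ m ]
place +0       a = a
place +[1+ m ] a = +[1+ m ] ℤ.- a
place -[1+ m ] a = a ℤ.+ -[1+ m ]

module _ where
  open import Data.Integer.Solver
  open +-*-Solver

  c-[c-a] : ∀ c a → c ℤ.- (c ℤ.- a) ≡ a
  c-[c-a] = solve 2 (λ c a → c :- (c :- a) := a) refl

  [a+c]-c : ∀ c a → (a ℤ.+ c) ℤ.- c ≡ a
  [a+c]-c = solve 2 (λ c a → (a :+ c) :- c := a) refl

  [c-x]-[c-y] : ∀ c x y → (c ℤ.- x) ℤ.- (c ℤ.- y) ≡ y ℤ.- x
  [c-x]-[c-y] = solve 3 (λ c x y → (c :- x) :- (c :- y) := y :- x) refl

  [x-c]-[y-c] : ∀ c x y → (x ℤ.- c) ℤ.- (y ℤ.- c) ≡ x ℤ.- y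
  [x-c]-[y-c] = solve 3 (λ c x y → (x :- c) :- (y :- c) := x :- y) refl

orient-place : ∀ c a → orient c (place c a) ≡ a
orient-place +0       a = refl
orient-place +[1+ m ] a = c-[c-a] +[1+ m ] a
orient-place -[1+ m ] a = [a+c]-c -[1+ m ] a

orient-isometry : ∀ c x y → distance (orient c x) (orient c y) ≡ distance x y
orient-isometry +0       x y = refl
orient-isometry +[1+ m ] x y = trans (cong ℤ.∣_∣ ([c-x]-[c-y] +[1+ m ] x y)) (distance-sym y x)
orient-isometry -[1+ m ] x y = cong ℤ.∣_∣ ([x-c]-[y-c] -[1+ m ] x y)

∣orient∣ : ∀ c x → ℤ.∣ orient c x ∣ ≡ distance x c
∣orient∣ +0       x = cong ℤ.∣_∣ (sym (ℤ.+-identityʳ x))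
∣orient∣ +[1+ m ] x = distance-sym +[1+ m ] x
∣orient∣ -[1+ m ] x = refl

orient-self : ∀ c → orient c c ≡ +0
orient-self c = ℤ.∣i∣≡0⇒i≡0 (trans (∣orient∣ c c) (cong ℤ.∣_∣ (ℤ.+-inverseʳ c)))

place-0 : ∀ c → place c +0 ≡ c
place-0 +0       = refl
place-0 +[1+ m ] = ℤ.+-identityʳ +[1+ m ]
place-0 -[1+ m ] = ℤ.+-identityˡ -[1+ m ]

private
  triangle : ∀ x c → ℤ.∣ c ∣ ≤ ℤ.∣ x ∣ ℕ.+ distance x c
  triangle x c = subst (ℤ.∣ c ∣ ≤_) (ℕ.+-comm (distance x c) ℤ.∣ x ∣) (∣c∣≤ x c)

  +0-left : ∀ {m k} → m ≤ k → m ℕ.+ 0 ≤ k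
  +0-left {m} = subst (_≤ _) (sym (ℕ.+-identityʳ m))

  past-pos : ∀ m x k → +[1+ m ] ℤ.- x ≡ -[1+ k ] → suc m ℕ.+ suc k ≡ ℤ.∣ x ∣
  past-pos m x k eq = sym (cong ℤ.∣_∣ (trans (sym (c-[c-a] +[1+ m ] x)) (cong (λ z → +[1+ m ] ℤ.- z) eq)))

  past-neg : ∀ m x k → x ℤ.- -[1+ m ] ≡ -[1+ k ] → suc m ℕ.+ suc k ≡ ℤ.∣ x ∣
  past-neg m x k eq = sym (trans (cong ℤ.∣_∣ (trans (recover x -[1+ m ]) (cong (λ z → -[1+ m ] ℤ.+ z) eq))) (cong suc (sym (ℕ.+-suc m k))))
    where
    open import Data.Integer.Solver
    open +-*-Solver
    recover : ∀ x c → x ≡ c ℤ.+ (x ℤ.- c)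
    recover = solve 2 (λ x c → x := c :+ (x :- c)) refl

-- Only an inequality, since x may lie beyond 0 as seen from c; then the gain counts more than the
-- absolute value decreases.
orient-norm : ∀ c x → ℤ.∣ c ∣ ℕ.+ loss (nonzero c) (orient c x) ≤ ℤ.∣ x ∣ ℕ.+ gain (nonzero c) (orient c x)
orient-norm +0 x = ℕ.≤-reflexive (sym (ℕ.+-identityʳ ℤ.∣ x ∣))
orient-norm +[1+ m ] x = go (+[1+ m ] ℤ.- x) refl
  where
  go : ∀ a → +[1+ m ] ℤ.- x ≡ a → suc m ℕ.+ loss true a ≤ ℤ.∣ x ∣ ℕ.+ gain true a
  go +[1+ k ] eq = +0-left (subst (λ z → suc m ≤ ℤ.∣ x ∣ ℕ.+ z) (trans (distance-sym x +[1+ m ]) (cong ℤ.∣_∣ eq)) (triangle x +[1+ m ]))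
  go +0       eq = +0-left (subst (λ z → suc m ≤ ℤ.∣ x ∣ ℕ.+ z) (trans (distance-sym x +[1+ m ]) (cong ℤ.∣_∣ eq)) (triangle x +[1+ m ]))
  go -[1+ k ] eq = ℕ.≤-reflexive (trans (past-pos m x k eq) (sym (ℕ.+-identityʳ _)))
orient-norm -[1+ m ] x = go (x ℤ.- -[1+ m ]) refl
  where
  go : ∀ a → x ℤ.- -[1+ m ] ≡ a → suc m ℕ.+ loss true a ≤ ℤ.∣ x ∣ ℕ.+ gain true a
  go +[1+ k ] eq = +0-left (subst (λ z → suc m ≤ ℤ.∣ x ∣ ℕ.+ z) (cong ℤ.∣_∣ eq) (triangle x -[1+ m ]))
  go +0       eq = +0-left (subst (λ z → suc m ≤ ℤ.∣ x ∣ ℕ.+ z) (cong ℤ.∣_∣ eq) (triangle x -[1+ m ]))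
  go -[1+ k ] eq = ℕ.≤-reflexive (trans (past-neg m x k eq) (sym (ℕ.+-identityʳ _)))

-- Exact because a nonzero coordinate loses precisely 1 under a unit step towards 0.
place-norm : ∀ c a → (positive (nonzero c) a ≡ true → a ≡ + 1) →
  ℤ.∣ place c a ∣ ℕ.+ gain (nonzero c) a ≡ ℤ.∣ c ∣ ℕ.+ loss (nonzero c) a
place-norm +0       a        _ = ℕ.+-identityʳ ℤ.∣ a ∣
place-norm +[1+ m ] +0       _ = cong (ℕ._+ 0) (cong suc (ℕ.+-identityʳ m))
place-norm +[1+ m ] -[1+ k ] _ = ℕ.+-identityʳ _
place-norm +[1+ m ] +[1+ k ] h with h refl
... | refl = trans (ℕ.+-comm m 1) (sym (ℕ.+-identityʳ (suc m)))
place-norm -[1+ m ] +0       _ = refl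
place-norm -[1+ m ] -[1+ k ] _ = trans (ℕ.+-identityʳ _) (cong suc (trans (cong suc (ℕ.+-comm k m)) (sym (ℕ.+-suc m k))))
place-norm -[1+ m ] +[1+ k ] h with h refl
place-norm -[1+ zero  ] +[1+ .0 ] h | refl = refl
place-norm -[1+ suc m ] +[1+ .0 ] h | refl = trans (ℕ.+-comm (suc m) 1) (sym (ℕ.+-identityʳ (suc (suc m))))

-- Elimination data for the lattice

module Lattice {n : ℕ} (n≤6 : n ≤ 6) (r : ℕ) (10≤r : 10 ≤ r) where

  module _ (v : Vec ℤ n) where

    S : Fin n → Bool
    S i = nonzero (lookup v i)

    open Core r 10≤r n≤6 S public

    relative : Vec ℤ n → Coords
    relative u i = orient (lookup v i) (lookup u i)

    absolute : Coords → Vec ℤ n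
    absolute w = tabulate (λ i → place (lookup v i) (w i))

    lookup-absolute : ∀ w i → lookup (absolute w) i ≡ place (lookup v i) (w i)
    lookup-absolute w = Vec.lookup∘tabulate (λ i → place (lookup v i) (w i))

    dist-relative : ∀ u u′ → dist (relative u) (relative u′) ≡ manhattan u u′
    dist-relative u u′ = trans (Sum-cong (λ i → orient-isometry (lookup v i) (lookup u i) (lookup u′ i))) (sym (manhattan-Sum u u′))

    relative-absolute : ∀ w i → relative (absolute w) i ≡ w i
    relative-absolute w i = trans (cong (orient (lookup v i)) (lookup-absolute w i)) (orient-place (lookup v i) (w i))

    dist-absolute : ∀ u w → manhattan u (absolute w) ≡ dist (relative u) w
    dist-absolute u w = trans (sym (dist-relative u (absolute w))) (Sum-cong (λ i → cong (distance (relative u i)) (relative-absolute w i)))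

    norm-relative : ∀ u → ∥ relative u ∥ ≡ manhattan u v
    norm-relative u = trans (Sum-cong (λ i → ∣orient∣ (lookup v i) (lookup u i))) (sym (manhattan-Sum u v))

    manhattan-absolute : ∀ w → manhattan (absolute w) v ≡ ∥ w ∥
    manhattan-absolute w = trans (sym (norm-relative (absolute w))) (Sum-cong (λ i → cong ℤ.∣_∣ (relative-absolute w i)))

    norm-balance : ∀ u → norm v ℕ.+ Loss (relative u) ≤ norm u ℕ.+ Gain (relative u)
    norm-balance u = subst₂ _≤_
      (Sum-+ (λ i → ℤ.∣ lookup v i ∣) (λ i → loss (S i) (relative u i)))
      (Sum-+ (λ i → ℤ.∣ lookup u i ∣) (λ i → gain (S i) (relative u i)))
      (Sum-mono (λ i → orient-norm (lookup v i) (lookup u i)))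

    -- With gain equal to loss, the norm of u is at least that of v, so u precedes v
    -- lexicographically, and the first coordinate in which they differ leads.
    less⇒below : ∀ u → Less u v → manhattan u v ≤ r → Below (relative u)
    less⇒below u less near = record
      { bounded = subst (_≤ r) (sym (norm-relative u)) near
      ; rises   = rises
      ; ties    = ties less
      }
      where
      norm≤ : Less u v → norm u ≤ norm v
      norm≤ (inj₁ u<v)      = ℕ.<⇒≤ u<v
      norm≤ (inj₂ (eq , _)) = ℕ.≤-reflexive eq
      rises : Loss (relative u) ≤ Gain (relative u)
      rises = ℕ.+-cancelˡ-≤ (norm v) _ _ (ℕ.≤-trans (norm-balance u) (ℕ.+-monoˡ-≤ _ (norm≤ less)))
      ties : Less u v → Loss (relative u) ≡ Gain (relative u) → Leads (relative u)
      ties (inj₁ u<v) eq = contradiction u<v (ℕ.≤⇒≯ (ℕ.+-cancelʳ-≤ (Gain (relative u)) (norm v) (norm u)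
        (subst (λ z → norm v ℕ.+ z ≤ norm u ℕ.+ Gain (relative u)) eq (norm-balance u))))
      ties (inj₂ (_ , lex)) _ =
        let (i , ζ< , before) = lex-first lex in
        i , leading i ζ< , λ j j<i → trans (cong (orient (lookup v j)) (before j j<i)) (orient-self (lookup v j))
        where
        leading : ∀ i → ζ (lookup u i) < ζ (lookup v i) → pos (relative u) i ≡ true
        -- A smaller `ζ` means that the absolute value does not grow. If the displacement were not
        -- positive, it would count entirely as loss and have to be 0, against the strict
        -- inequality.
        leading i ζ< = go (pos (relative u) i) refl
          where
          x c : ℤ
          x = lookup u i
          c = lookup v i
          go : ∀ b → pos (relative u) i ≡ b → pos (relative u) i ≡ true
          go true  eq = eq
          go false eq = contradiction orient≡0 orient≢0
            where
            balance : ℤ.∣ c ∣ ℕ.+ ℤ.∣ orient c x ∣ ≤ ℤ.∣ x ∣ ℕ.+ 0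
            balance = subst₂ (λ l g → ℤ.∣ c ∣ ℕ.+ l ≤ ℤ.∣ x ∣ ℕ.+ g)
              (cong (λ t → if t then 0 else ℤ.∣ orient c x ∣) eq) (cong (λ t → if t then ℤ.∣ orient c x ∣ else 0) eq) (orient-norm c x)
            orient≡0 : ℤ.∣ orient c x ∣ ≡ 0
            orient≡0 = ℕ.n≤0⇒n≡0 (ℕ.+-cancelˡ-≤ ℤ.∣ x ∣ _ _ (ℕ.≤-trans (ℕ.+-monoˡ-≤ ℤ.∣ orient c x ∣ (ζ<⇒∣∣≤ {x} {c} ζ<)) balance))
            orient≢0 : ℤ.∣ orient c x ∣ ≢ 0
            orient≢0 eq′ = ℕ.<-irrefl (cong ζ (ℤ.i-j≡0⇒i≡j x c (ℤ.∣i∣≡0⇒i≡0 (trans (sym (∣orient∣ c x)) eq′)))) ζ<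

    absolute-balance : ∀ w → (∀ i → pos w i ≡ true → w i ≡ + 1) → norm (absolute w) ℕ.+ Gain w ≡ norm v ℕ.+ Loss w
    absolute-balance w units = begin
      norm (absolute w) ℕ.+ Gain w
        ≡⟨ Sum-+ (λ i → ℤ.∣ lookup (absolute w) i ∣) (λ i → gain (S i) (w i)) ⟨
      Sum (λ i → ℤ.∣ lookup (absolute w) i ∣ ℕ.+ gain (S i) (w i))
        ≡⟨ Sum-cong (λ i → trans (cong (λ z → ℤ.∣ z ∣ ℕ.+ gain (S i) (w i)) (lookup-absolute w i)) (place-norm (lookup v i) (w i) (units i))) ⟩
      Sum (λ i → ℤ.∣ lookup v i ∣ ℕ.+ loss (S i) (w i))
        ≡⟨ Sum-+ (λ i → ℤ.∣ lookup v i ∣) (λ i → loss (S i) (w i)) ⟩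
      norm v ℕ.+ Loss w ∎
      where open ≡-Reasoning

    -- In a tie the leading coordinate makes one step towards 0, which lowers its `ζ`, and all
    -- earlier coordinates agree with those of v.
    descends⇒less : ∀ w → Descends w → Less (absolute w) v
    descends⇒less w D = [ strict , tie ]′ (Descends.below D)
      where
      balance : norm (absolute w) ℕ.+ Gain w ≡ norm v ℕ.+ Loss w
      balance = absolute-balance w (Descends.units D)
      strict : Loss w < Gain w → Less (absolute w) v
      strict L<G = inj₁ (ℕ.+-cancelʳ-< (Gain w) _ _ (ℕ.≤-<-trans (ℕ.≤-reflexive balance) (ℕ.+-monoʳ-< (norm v) L<G)))
      tie : Loss w ≡ Gain w × Leads w → Less (absolute w) v
      tie (L≡G , i , pos-i , zeros) = inj₂ (ℕ.+-cancelʳ-≡ (Gain w) _ _ (trans balance (cong (norm v ℕ.+_) L≡G)) ,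
        first-lex (absolute w) v i (∣∣<⇒ζ< {lookup (absolute w) i} {lookup v i} smaller)
          (λ j j<i → trans (lookup-absolute w j) (trans (cong (place (lookup v j)) (zeros j j<i)) (place-0 (lookup v j)))))
        where
        smaller : ℤ.∣ lookup (absolute w) i ∣ < ℤ.∣ lookup v i ∣
        smaller = subst (λ z → ℤ.∣ z ∣ < ℤ.∣ lookup v i ∣) (sym (lookup-absolute w i)) (ℕ.≤-reflexive
          (trans (sym (ℕ.+-comm ℤ.∣ place (lookup v i) (w i) ∣ 1))
            (trans (cong (ℤ.∣ place (lookup v i) (w i) ∣ ℕ.+_) (sym gain≡1)) (trans (place-norm (lookup v i) (w i) (Descends.units D i))
              (trans (cong (ℤ.∣ lookup v i ∣ ℕ.+_) loss≡0) (ℕ.+-identityʳ _))))))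
          where
          gain≡1 : gain (S i) (w i) ≡ 1
          gain≡1 = trans (cong (λ t → if t then ℤ.∣ w i ∣ else 0) pos-i) (cong ℤ.∣_∣ (Descends.units D i pos-i))
          loss≡0 : loss (S i) (w i) ≡ 0
          loss≡0 = cong (λ t → if t then 0 else ℤ.∣ w i ∣) pos-i

    inward : Vec ℤ n
    inward = absolute (ind S)

    inward-near : manhattan inward v ≤ 6
    inward-near = subst (_≤ 6) (sym (manhattan-absolute (ind S))) (ℕ.≤-trans (Sum≤n _ (λ i → ∣unit∣≤1 (S i))) n≤6)
      where
      ∣unit∣≤1 : ∀ t → ℤ.∣ unit t ∣ ≤ 1
      ∣unit∣≤1 true  = ℕ.≤-refl
      ∣unit∣≤1 false = ℕ.z≤n

    inward-less : rank v ≢ 0 → Less inward v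
    inward-less rank≢0 = inj₁ (ℕ.+-cancelʳ-< (Gain (ind S)) _ _ (subst₂ _<_
      (sym (trans (absolute-balance (ind S) units) (trans (cong (norm v ℕ.+_) loss≡0) (ℕ.+-identityʳ _)))) refl
      (subst (norm v <_) (cong (norm v ℕ.+_) (sym gain≡)) (ℕ.m<m+n (norm v) (ℕ.n≢0⇒n>0 card≢0)))))
      where
      gain≡ : Gain (ind S) ≡ card S
      gain≡ = Sum-cong (λ i → proj₁ (gain-ind S (λ _ eq → eq) i))
      loss≡0 : Loss (ind S) ≡ 0
      loss≡0 = Sum-zero (λ i → loss (S i) (ind S i)) (λ i → proj₂ (gain-ind S (λ _ eq → eq) i))
      units : ∀ i → pos (ind S) i ≡ true → ind S i ≡ + 1
      units i pos-i = cong unit (positive-direction {S i} {ind S i} pos-i)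
      card≢0 : card S ≢ 0
      card≢0 card≡0 = rank≢0 (trans (cong rank v≡0) (rank-origin n))
        where
        zero-i : ∀ x → ⟦ nonzero x ⟧ ≡ 0 → x ≡ +0
        zero-i +0 _ = refl
        v≡0 : v ≡ replicate n +0
        v≡0 = trans (sym (Vec.tabulate∘lookup v)) (trans
          (Vec.tabulate-cong (λ i → trans (zero-i (lookup v i) (Sum-zero⁻ (λ i → ⟦ S i ⟧) card≡0 i)) (sym (Vec.lookup-replicate i +0))))
          (Vec.tabulate∘lookup (replicate n +0)))

    -- A finite list containing the images of all candidates. It may contain further points: being
    -- of smaller rank and within distance 4 of v is all that the pushing of weights asks of them.
    candidates W : List (Vec ℤ n)
    candidates = inward ∷ filter (λ w → manhattan w v ℕ.≤? 4) (box 4 v)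
    W = filter (λ w → rank w ℕ.<? rank v) candidates

    W⊆ : ∀ {w} → w ∈ W → w ∈ candidates × rank w < rank v
    W⊆ = ∈-filter⁻ (λ w → rank w ℕ.<? rank v) {xs = candidates}

    data Kind (w : Vec ℤ n) : Set where
      is-inward : w ≡ inward → Kind w
      is-near   : manhattan w v ≤ 4 → Kind w

    kind : ∀ {w} → w ∈ candidates → Kind w
    kind (here eq)  = is-inward eq
    kind (there w∈) = is-near (proj₂ (∈-filter⁻ (λ w → manhattan w v ℕ.≤? 4) {xs = box 4 v} w∈))

    candidate∈W : rank v ≢ 0 → ∀ {w} → Candidate w → absolute w ∈ W
    candidate∈W rank≢0 {w} (full eq) = subst (_∈ W) (Vec.tabulate-cong (λ i → cong (place (lookup v i)) (sym (eq i))))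
      (∈-filter⁺ (λ w → rank w ℕ.<? rank v) (here refl) (rank-mono (inward-less rank≢0)))
    candidate∈W rank≢0 {w} (small norm≤4 D) = ∈-filter⁺ (λ w → rank w ℕ.<? rank v)
      (there (∈-filter⁺ (λ w → manhattan w v ℕ.≤? 4) (∈-box v (absolute w) near) near)) (rank-mono (descends⇒less w D))
      where
      near : manhattan (absolute w) v ≤ 4
      near = subst (_≤ 4) (sym (manhattan-absolute w)) norm≤4

    W-dominates : (τ : List (Vec ℤ n)) → rank v ≢ 0 → (∀ {u u′} → u ∈ τ → u′ ∈ τ → manhattan u u′ ≤ r) →
                  (∀ {u} → u ∈ τ → rank u < rank v × manhattan u v ≤ r) →
                  ∃[ w ] w ∈ W × (∀ {u} → u ∈ τ → manhattan u w ≤ r)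
    W-dominates τ rank≢0 clique under = finish dominated
      where
      below : ∀ {a} → a ∈ map relative τ → Below a
      below a∈ with ∈-map⁻ relative a∈
      ... | u , u∈ , refl = less⇒below u (rank-reflects (proj₁ (under u∈))) (proj₂ (under u∈))
      near : ∀ {a c} → a ∈ map relative τ → c ∈ map relative τ → dist a c ≤ r
      near a∈ c∈ with ∈-map⁻ relative a∈ | ∈-map⁻ relative c∈
      ... | u , u∈ , refl | u′ , u′∈ , refl = subst (_≤ r) (sym (dist-relative u u′)) (clique u∈ u′∈)
      open Dominate (map relative τ) below near
      finish : Dominated → ∃[ w ] w ∈ W × (∀ {u} → u ∈ τ → manhattan u w ≤ r)
      finish (w , cand , good) = absolute w , candidate∈W rank≢0 cand ,
        λ {u} u∈ → subst (_≤ r) (sym (dist-absolute u w)) (good (∈-map⁺ relative u∈))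

    W-near : ∀ {w} → w ∈ W → manhattan w v ≤ r
    W-near w∈ with kind (proj₁ (W⊆ w∈))
    ... | is-inward refl = ℕ.≤-trans inward-near (ℕ.≤-trans (ℕ.m≤m+n 6 4) 10≤r)
    ... | is-near near   = ℕ.≤-trans near (ℕ.≤-trans (ℕ.m≤m+n 4 6) 10≤r)

    -- Through v the distance is at most 6 + 4 or 4 + 4; the combination 6 + 6 does not occur
    -- because `inward` is a single vertex.
    W-clique : ∀ {w w′} → w ∈ W → w′ ∈ W → manhattan w w′ ≤ r
    W-clique {w} {w′} w∈ w′∈ = ℕ.≤-trans (pair (kind (proj₁ (W⊆ w∈))) (kind (proj₁ (W⊆ w′∈)))) 10≤r
      where
      open IsMetric (manhattan-isMetric n) using () renaming (triangle to ▵; sym to m-sym; ≈⇒0 to m-refl)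
      via : ∀ w w′ {k l} → manhattan w v ≤ k → manhattan w′ v ≤ l → k ℕ.+ l ≤ 10 → manhattan w w′ ≤ 10
      via w w′ p q h = ℕ.≤-trans (▵ w v w′) (ℕ.≤-trans (ℕ.+-mono-≤ p (subst (_≤ _) (m-sym w′ v) q)) h)
      pair : ∀ {w w′} → Kind w → Kind w′ → manhattan w w′ ≤ 10
      pair {w} {w′} (is-inward refl) (is-inward refl) = ℕ.≤-trans (ℕ.≤-reflexive (m-refl {inward} refl)) ℕ.z≤n
      pair {w} {w′} (is-inward refl) (is-near q)      = via w w′ inward-near q ℕ.≤-refl
      pair {w} {w′} (is-near p)      (is-inward refl) = via w w′ p inward-near ℕ.≤-refl
      pair {w} {w′} (is-near p)      (is-near q)      = via w w′ p q (ℕ.m≤m+n 8 2)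

  elimination : Elimination (manhattan {n}) r
  elimination = record
    { _≟_         = Vec.≡-dec ℤ._≟_
    ; nbrs        = box r
    ; ∈-nbrs      = λ {u} {v} near → ∈-box v u near
    ; rank        = rank
    ; unrank      = unrank n
    ; unrank-rank = unrank-rank
    ; rank-unrank = λ {j} eq → search-sound (box j (replicate n +0)) eq
    ; base        = replicate n +0
    ; rank-base   = rank-origin n
    ; W           = W
    ; W-rank      = λ {v} w∈ → proj₂ (W⊆ v w∈)
    ; W-near      = λ {v} → W-near v
    ; W-clique    = λ {v} → W-clique v
    ; W-dominates = λ {v} → W-dominates v
    }

theorem3p13 : (r : ℕ) → 10 ℕ.≤ r → Contractible (realization (VR (manhattan-isMetric 6) r))
theorem3p13 r 10≤r =
  Realization.contractible (manhattan-isMetric 6) r (Lattice.elimination {6} ℕ.≤-refl r 10≤r)
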